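{- For every integer $\ell\ge 16$, \[\tilde{r}(P_3,P_3,C_\ell)=\begin{cases}(3\ell+1)/2, & \text{if } \ell \equiv 3\pmod{4}; \\ \left\lfloor 3(\ell+1)/2 \right\rfloor, & \text{otherwise}. \end{cases}\]
   Context: $P_m$ denotes the path on $m$ vertices and $C_m$ the cycle on $m$ vertices. The three-color online Ramsey game for graphs $G_1,G_2,G_3$ is played by Builder and Painter on an infinite vertex set with initially no edges. In each round Builder draws an edge between two currently nonadjacent vertices, and Painter immediately colors it with one of the colors red, blue, green. Builder wins once the colored graph contains a red copy of $G_1$, a blue copy of $G_2$, or a green copy of $G_3$ (as a subgraph). The online Ramsey number $\tilde{r}(G_1,G_2,G_3)$ is the minimum number of rounds within which Builder can guarantee a win against every strategy of Painter. -}

module Defs where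

open import Data.Nat using (ℕ; zero; suc; _≤_)
open import Data.Fin using (Fin; toℕ)
open import Data.Product using (Σ; _×_; _,_)
open import Data.Sum using (_⊎_)
open import Data.List using (List; _∷_; [])
open import Data.List.Membership.Propositional using (_∈_)
open import Relation.Nullary using (¬_)
open import Relation.Binary.PropositionalEquality using (_≡_; _≢_)
open import Function.Definitions using (Injective)

data Colour : Set where
  red blue green : Colour

-- A board: the finitely many edges drawn so far (vertex set ℕ), each with its colour.
-- An entry (x , y , c) is the edge {x,y} coloured c.
Board : Set
Board = List (ℕ × ℕ × Colour)

HasEdge : Board → Colour → ℕ → ℕ → Set
HasEdge B c x y = ((x , y , c) ∈ B) ⊎ ((y , x , c) ∈ B)

Adjacent : Board → ℕ → ℕ → Set
Adjacent B x y = Σ Colour λ c → HasEdge B c x y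

record Graph : Set₁ where
  field
    order : ℕ
    Edge  : Fin order → Fin order → Set
open Graph public

Path : ℕ → Graph
Path m = record { order = m ; Edge = λ i j → suc (toℕ i) ≡ toℕ j }

Cycle : ℕ → Graph
Cycle m = record
  { order = m
  ; Edge  = λ i j → (suc (toℕ i) ≡ toℕ j) ⊎ ((toℕ i ≡ 0) × (suc (toℕ j) ≡ m)) }

ContainsMono : Board → Colour → Graph → Set
ContainsMono B c G =
  Σ (Fin (order G) → ℕ) λ f →
    Injective _≡_ _≡_ f × (∀ i j → Edge G i j → HasEdge B c (f i) (f j))

Won : Graph → Graph → Graph → Board → Set
Won G₁ G₂ G₃ B = ContainsMono B red G₁ ⊎ ContainsMono B blue G₂ ⊎ ContainsMono B green G₃

-- Builder can force a win within n further rounds from board B, against every Painter.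
-- A round: Builder draws a new edge between two distinct nonadjacent vertices,
-- Painter colours it with any colour.
WinIn : Graph → Graph → Graph → ℕ → Board → Set
WinIn G₁ G₂ G₃ zero    B = Won G₁ G₂ G₃ B
WinIn G₁ G₂ G₃ (suc n) B =
  Won G₁ G₂ G₃ B ⊎
  Σ ℕ λ x → Σ ℕ λ y → (x ≢ y) × (¬ Adjacent B x y) ×
    (∀ c → WinIn G₁ G₂ G₃ n ((x , y , c) ∷ B))

IsOnlineRamseyNumber : Graph → Graph → Graph → ℕ → Set
IsOnlineRamseyNumber G₁ G₂ G₃ N =
  WinIn G₁ G₂ G₃ N [] × (∀ m → WinIn G₁ G₂ G₃ m [] → N ≤ m)

{-# OPTIONS --safe #-}
module Submission where

-- Lower bound.  Painter uses the first of red, blue, green that creates no red or blue P₃.  Then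
-- red and blue are matchings, and each edge of a green C_ℓ meets a red edge and meets a blue edge,
-- so that a win of Builder takes ℓ green edges, ⌈ℓ/4⌉ red and ⌈ℓ/4⌉ blue ones.  If 4 ∣ ℓ, Painter
-- gains a round by using green also where red or blue would leave every vertex with as many red
-- as blue edges: a win in 3ℓ/2 rounds would need red-blue degrees 0, 2, 0, 2, … or 1, 1, 1, …
-- along the cycle, and neither is possible any more.
--
-- Upper bound.  All further edges at a vertex with a red and a blue edge are forced to be green.
-- Builder prolongs a red-blue path; each of its inner vertices prolongs a green path Z by two
-- forced edges, so that one red or blue edge pays for two edges of the cycle.  Painter can only
-- stop this by answering green twice at an end of the red-blue path, and the green P₃ made in this
-- way is worth more than what it takes to join it to Z and to start again.  This shows up as
-- bounds 3 r + const ≤ 2 b, where r edges of the cycle are missing and b rounds are left, which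
-- plans of a few rounds preserve.  Small r is settled by explicit plans.

-- The obstacle on Builder's side is that a round has three branches and that ℓ is arbitrary. A
-- strategy is therefore data, a `Plan`, tested by the Boolean function `works`, whose soundness is
-- proved once. A state forgets the inner vertices of green paths, and a plan is run on numerals for
-- the missing edges and the remaining rounds, to which unknown offsets r₀ and b₀ are added
-- afterwards. One evaluation thus covers infinitely many ℓ; only steps that complete the cycle need
-- r₀ = 0. The residue 3 modulo 4 is exceptional because then 2⌈ℓ/4⌉ = (ℓ + 1)/2, so that counting
-- gives (3ℓ + 1)/2, one less than ⌊3(ℓ + 1)/2⌋. This leaves Builder no round to waste, and the
-- induction has to keep track of whether the two ends of the red-blue path have equal colours.

open import Defs
open import Data.Nat using (ℕ; _≤_; _+_; _*_; _/_; _%_)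
open import Data.Product using (_×_)
open import Relation.Nullary using (¬_)
open import Relation.Binary.PropositionalEquality using (_≡_)
open import Data.Bool using (Bool; true; false; T; not; _∧_; _∨_; if_then_else_)
open import Data.Bool.Properties using (T-∧; T-∨)
open import Data.Empty using (⊥-elim)
open import Data.Fin using (Fin; zero; suc; toℕ; fromℕ; fromℕ<)
open import Data.Fin.Properties using (toℕ-fromℕ; toℕ-fromℕ<; toℕ<n)
open import Data.List using (List; []; _∷_; _++_; length; lookup; map; tabulate)
open import Data.List.Membership.Propositional using (_∈_; _∉_; find; lose)
open import Data.List.Membership.Propositional.Properties using (∈-lookup)
open import Data.List.Properties using (length-++; ++-assoc; length-tabulate)
open import Data.List.Relation.Binary.Permutation.Propositional using (_↭_; ↭-refl; ↭-trans; ↭-reflexive; ↭⇒↭ₛ; prep)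
open import Data.List.Relation.Binary.Permutation.Propositional.Properties using (All-resp-↭; ↭-length; ++⁺ˡ; ++⁺ʳ; shifts; ∷↭∷ʳ)
import Data.List.Relation.Binary.Permutation.Setoid.Properties as PermSetoid
open import Data.List.Relation.Unary.All as All using (All; []; _∷_)
import Data.List.Relation.Unary.All.Properties as All
open import Data.List.Relation.Unary.AllPairs using ([]; _∷_)
open import Data.List.Relation.Unary.Any using (here; there; any?)
open import Data.List.Relation.Unary.Unique.Propositional using (Unique)
open import Data.List.Relation.Unary.Unique.Propositional.Properties using (Unique[x∷xs]⇒x∉xs; tabulate⁺)
open import Data.Maybe using (Maybe; just; nothing)
open import Data.Nat using (zero; suc; _∸_; _<_; z≤n; s≤s; _≡ᵇ_; _<ᵇ_; _≤ᵇ_; _≟_; _≤?_)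
open import Data.List.Membership.DecPropositional _≟_ using (_∈?_)
open import Data.Nat.DivMod using (m≡m%n+[m/n]*n; m*n/n≡m; m<n*o⇒m/o<n; m%n<n)
open import Data.Nat.ListAction using (sum)
open import Data.Nat.Properties hiding (_≟_; _≤?_)
open import Data.Nat.Tactic.RingSolver using (solve-∀)
open import Data.Product using (Σ; ∃; _,_; proj₁; proj₂)
open import Data.Sum using (_⊎_; inj₁; inj₂)
open import Data.Unit using (⊤; tt)
open import Function using (_∘_; case_of_; Equivalence; Injective)
open import Relation.Binary.PropositionalEquality using (_≢_; refl; sym; trans; cong; cong₂; subst; subst₂; setoid; module ≡-Reasoning)
open import Relation.Nullary using (Dec; yes; no; ¬?)
open import Relation.Nullary.Decidable using (decidable-stable; map′)

-- Boards

Unique-resp-↭ : ∀ {xs ys : List ℕ} → xs ↭ ys → Unique xs → Unique ys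
Unique-resp-↭ p = PermSetoid.Unique-resp-↭ (setoid ℕ) (↭⇒↭ₛ p)

∧-T : ∀ {x y} → T (x ∧ y) → T x × T y
∧-T = Equivalence.to T-∧

∨-T : ∀ {x y} → T (x ∨ y) → T x ⊎ T y
∨-T = Equivalence.to T-∨

T-not : ∀ {x} → T (not x) → ¬ T x
T-not {false} _ ()

hasEdge-∷ : ∀ {B c x y} e → HasEdge B c x y → HasEdge (e ∷ B) c x y
hasEdge-∷ e (inj₁ p) = inj₁ (there p)
hasEdge-∷ e (inj₂ p) = inj₂ (there p)

hasEdge-sym : ∀ {B c x y} → HasEdge B c x y → HasEdge B c y x
hasEdge-sym (inj₁ p) = inj₂ p
hasEdge-sym (inj₂ p) = inj₁ p

hasEdge-new : ∀ {B c x y} → HasEdge ((x , y , c) ∷ B) c x y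
hasEdge-new = inj₁ (here refl)

adjacent-∷ : ∀ {B x y c u v} → Adjacent ((x , y , c) ∷ B) u v →
             (u ≡ x × v ≡ y) ⊎ (u ≡ y × v ≡ x) ⊎ Adjacent B u v
adjacent-∷ (_ , inj₁ (here refl)) = inj₁ (refl , refl)
adjacent-∷ (_ , inj₁ (there p))   = inj₂ (inj₂ (_ , inj₁ p))
adjacent-∷ (_ , inj₂ (here refl)) = inj₂ (inj₁ (refl , refl))
adjacent-∷ (_ , inj₂ (there p))   = inj₂ (inj₂ (_ , inj₂ p))

-- Green paths and cycles

data GreenPath (B : Board) : ℕ → ℕ → List ℕ → Set where
  single : ∀ x → GreenPath B x x (x ∷ [])
  _∷_  : ∀ {x y z vs} → HasEdge B green x y → GreenPath B y z vs → GreenPath B x z (x ∷ vs)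

greenPath-∷ : ∀ {B x y vs} e → GreenPath B x y vs → GreenPath (e ∷ B) x y vs
greenPath-∷ e (single x) = single x
greenPath-∷ e (h ∷ p) = hasEdge-∷ e h ∷ greenPath-∷ e p

join : ∀ {B u x y v xs ys} → GreenPath B u x xs → HasEdge B green x y → GreenPath B y v ys →
       GreenPath B u v (xs ++ ys)
join (single _)   e q = e ∷ q
join (h ∷ p) e q = h ∷ join p e q

flip : ∀ {B x y vs} → GreenPath B x y vs → Σ (List ℕ) λ ws → GreenPath B y x ws × vs ↭ ws
flip (single x) = _ , single x , ↭-refl
flip (_∷_ {x} h p) with flip p
... | ws , q , π = _ , join q (hasEdge-sym h) (single x) , ↭-trans (prep x π) (∷↭∷ʳ x ws)

-- The end of a path is in its list, so a path with an edge that returns to its start would list the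
-- start twice. Hence a piece (u , u) stands for one vertex and contains no green edge.
loop-length : ∀ {B x vs} → GreenPath B x x vs → Unique vs → length vs ≡ 1
loop-length (single _) _ = refl
loop-length (h ∷ p) u = ⊥-elim (Unique[x∷xs]⇒x∉xs u (end p))
  where
  end : ∀ {B x y vs} → GreenPath B x y vs → y ∈ vs
  end (single _)   = here refl
  end (_ ∷ p) = there (end p)

lookup-injective : ∀ {xs : List ℕ} → Unique xs → ∀ i j → lookup xs i ≡ lookup xs j → i ≡ j
lookup-injective (_ ∷ _) zero    zero    _ = refl
lookup-injective {_ ∷ xs} (p ∷ _) zero    (suc j) e = ⊥-elim (All.lookup p (∈-lookup j) e)
lookup-injective {_ ∷ xs} (p ∷ _) (suc i) zero    e = ⊥-elim (All.lookup p (∈-lookup i) (sym e))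
lookup-injective (_ ∷ u) (suc i) (suc j) e = cong suc (lookup-injective u i j e)

module _ {B : Board} where

  lookup-first : ∀ {x y vs} → GreenPath B x y vs → ∀ i → toℕ i ≡ 0 → lookup vs i ≡ x
  lookup-first (single _)   zero _ = refl
  lookup-first (_ ∷ _) zero _ = refl

  lookup-last : ∀ {x y vs} → GreenPath B x y vs → ∀ i → suc (toℕ i) ≡ length vs → lookup vs i ≡ y
  lookup-last (single _)          zero    _ = refl
  lookup-last (_ ∷ (single _))    zero    ()
  lookup-last (_ ∷ (_ ∷ _))  zero    ()
  lookup-last (_ ∷ p)        (suc i) e = lookup-last p i (suc-injective e)

  lookup-step : ∀ {x y vs} → GreenPath B x y vs → ∀ i j → suc (toℕ i) ≡ toℕ j →
         HasEdge B green (lookup vs i) (lookup vs j)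
  lookup-step (single _)   zero    zero    ()
  lookup-step (h ∷ p) zero    (suc j) e =
    subst (HasEdge B green _) (sym (lookup-first p j (sym (suc-injective e)))) h
  lookup-step (h ∷ p) (suc i) (suc j) e = lookup-step p i j (suc-injective e)

  greenCycle : ∀ {x y vs} → GreenPath B x y vs → Unique vs → HasEdge B green x y →
               ContainsMono B green (Cycle (length vs))
  greenCycle {vs = vs} p u e = lookup vs , (λ {i} {j} → lookup-injective u i j) , edges
    where
    edges : ∀ i j → Edge (Cycle (length vs)) i j → HasEdge B green (lookup vs i) (lookup vs j)
    edges i j (inj₁ s) = lookup-step p i j s
    edges i j (inj₂ (i0 , jl)) rewrite lookup-first p i i0 | lookup-last p j jl = e

  monoP₃ : ∀ {c w x y} → w ≢ x → w ≢ y → x ≢ y → HasEdge B c w x → HasEdge B c x y →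
           ContainsMono B c (Path 3)
  monoP₃ {c} {w} {x} {y} w≢x w≢y x≢y e e′ = f , inj , edges
    where
    f : Fin 3 → ℕ
    f zero = w
    f (suc zero) = x
    f (suc (suc zero)) = y
    inj : Injective _≡_ _≡_ f
    inj {zero} {zero} _ = refl
    inj {zero} {suc zero} p = ⊥-elim (w≢x p)
    inj {zero} {suc (suc zero)} p = ⊥-elim (w≢y p)
    inj {suc zero} {zero} p = ⊥-elim (w≢x (sym p))
    inj {suc zero} {suc zero} _ = refl
    inj {suc zero} {suc (suc zero)} p = ⊥-elim (x≢y p)
    inj {suc (suc zero)} {zero} p = ⊥-elim (w≢y (sym p))
    inj {suc (suc zero)} {suc zero} p = ⊥-elim (x≢y (sym p))
    inj {suc (suc zero)} {suc (suc zero)} _ = refl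
    edges : ∀ i j → suc (toℕ i) ≡ toℕ j → HasEdge B c (f i) (f j)
    edges zero (suc zero) _ = e
    edges (suc zero) (suc (suc zero)) _ = e′
    edges zero zero ()
    edges zero (suc (suc zero)) ()
    edges (suc zero) zero ()
    edges (suc zero) (suc zero) ()
    edges (suc (suc zero)) zero ()
    edges (suc (suc zero)) (suc zero) ()
    edges (suc (suc zero)) (suc (suc zero)) ()

module _ {G₁ G₂ G₃ : Graph} where

  won⇒winIn : ∀ n {B} → Won G₁ G₂ G₃ B → WinIn G₁ G₂ G₃ n B
  won⇒winIn zero    w = w
  won⇒winIn (suc n) w = inj₁ w

  winIn-suc : ∀ n {B} → WinIn G₁ G₂ G₃ n B → WinIn G₁ G₂ G₃ (suc n) B
  winIn-suc zero    w = inj₁ w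
  winIn-suc (suc n) (inj₁ w) = inj₁ w
  winIn-suc (suc n) (inj₂ (x , y , x≢y , ¬a , k)) = inj₂ (x , y , x≢y , ¬a , λ c → winIn-suc n (k c))

  winIn-mono : ∀ {m n B} → m ≤ n → WinIn G₁ G₂ G₃ m B → WinIn G₁ G₂ G₃ n B
  winIn-mono {m} {n} {B} m≤n w = subst (λ k → WinIn G₁ G₂ G₃ k B) (m∸n+n≡m m≤n) (go (n ∸ m))
    where
    go : ∀ d → WinIn G₁ G₂ G₃ (d + m) B
    go zero    = w
    go (suc d) = winIn-suc (d + m) (go d)

-- Plans of Builder

-- What Builder remembers of a board.  Labels below `size` stand for vertices.  A piece (u , v) is a
-- green path from u to v with forgotten inner vertices, just a vertex if u ≡ v.  A mark (l , c)
-- tells of an edge of colour c at l, perhaps to a forgotten vertex.  Labels that are not linked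
-- are nonadjacent.
record State : Set where
  constructor state
  field
    size   : ℕ
    pieces : List (ℕ × ℕ)
    marks  : List (ℕ × Colour)
    links  : List (ℕ × ℕ)
open State

sameᶜ : Colour → Colour → Bool
sameᶜ red   red   = true
sameᶜ blue  blue  = true
sameᶜ green green = true
sameᶜ _     _     = false

sameᶜ⇒≡ : ∀ {c d} → T (sameᶜ c d) → c ≡ d
sameᶜ⇒≡ {red}   {red}   _ = refl
sameᶜ⇒≡ {blue}  {blue}  _ = refl
sameᶜ⇒≡ {green} {green} _ = refl

marked : ℕ → Colour → List (ℕ × Colour) → Bool
marked l c []             = false
marked l c ((k , d) ∷ ms) = ((k ≡ᵇ l) ∧ sameᶜ d c) ∨ marked l c ms

linked : ℕ → ℕ → List (ℕ × ℕ) → Bool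
linked u v []             = false
linked u v ((a , b) ∷ ls) = ((a ≡ᵇ u) ∧ (b ≡ᵇ v)) ∨ ((a ≡ᵇ v) ∧ (b ≡ᵇ u)) ∨ linked u v ls

consʳ : ℕ × ℕ → Maybe (ℕ × List (ℕ × ℕ)) → Maybe (ℕ × List (ℕ × ℕ))
consʳ p nothing         = nothing
consʳ p (just (u , ps)) = just (u , p ∷ ps)

extract : ℕ → List (ℕ × ℕ) → Maybe (ℕ × List (ℕ × ℕ))
extract u []             = nothing
extract u ((a , b) ∷ ps) =
  if a ≡ᵇ u then just (b , ps) else if b ≡ᵇ u then just (a , ps) else consʳ (a , b) (extract u ps)

-- The game is symmetric in red and blue, so one plan serves both namings; the flag records which of
-- them the board uses.
swapIf : Bool → Colour → Colour
swapIf false c     = c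
swapIf true  red   = blue
swapIf true  blue  = red
swapIf true  green = green

onColours : ∀ s {P : Colour → Set} → P (swapIf s red) → P (swapIf s blue) → P green → ∀ c → P c
onColours false r b g red   = r
onColours false r b g blue  = b
onColours false r b g green = g
onColours true  r b g red   = b
onColours true  r b g blue  = r
onColours true  r b g green = g

-- The vertex lists are concatenated, so that a single `Unique` says both that every path is simple
-- and that the paths are disjoint.
data Pieces (B : Board) (ρ : ℕ → ℕ) : List (ℕ × ℕ) → List ℕ → Set where
  []  : Pieces B ρ [] []
  _∷_ : ∀ {u v ps vs ws} → GreenPath B (ρ u) (ρ v) vs → Pieces B ρ ps ws →
        Pieces B ρ ((u , v) ∷ ps) (vs ++ ws)

pieces-∷ : ∀ {B ρ ps ws} e → Pieces B ρ ps ws → Pieces (e ∷ B) ρ ps ws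
pieces-∷ e []       = []
pieces-∷ e (p ∷ ps) = greenPath-∷ e p ∷ pieces-∷ e ps

-- The path is turned so as to end at `u`, where the next edge is going to be attached.
record Extracted (B : Board) (ρ : ℕ → ℕ) (u u′ : ℕ) (rest ps : List (ℕ × ℕ)) (ws : List ℕ) : Set where
  constructor extracted
  field
    {vs ws′} : List ℕ
    path     : GreenPath B (ρ u′) (ρ u) vs
    others   : Pieces B ρ rest ws′
    perm     : ws ↭ vs ++ ws′
    count    : length ps ≡ suc (length rest)

module _ {B : Board} {ρ : ℕ → ℕ} where

  extract-sound : ∀ u {ps u′ rest ws} → extract u ps ≡ just (u′ , rest) → Pieces B ρ ps ws →
                  Extracted B ρ u u′ rest ps ws
  extract-sound u {(a , b) ∷ ps} eq (p ∷ q) with a ≡ᵇ u in ea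
  extract-sound u {(a , b) ∷ ps} refl (p ∷ q) | true
    with refl ← ≡ᵇ⇒≡ a u (subst T (sym ea) tt) with vs , p′ , π ← flip p =
    extracted p′ q (++⁺ʳ _ π) refl
  extract-sound u {(a , b) ∷ ps} eq (p ∷ q) | false with b ≡ᵇ u in eb
  extract-sound u {(a , b) ∷ ps} refl (p ∷ q) | false | true
    with refl ← ≡ᵇ⇒≡ b u (subst T (sym eb) tt) = extracted p q ↭-refl refl
  extract-sound u {(a , b) ∷ ps} eq (p ∷ q) | false | false with extract u ps in ex
  extract-sound u {(a , b) ∷ ps} refl (_∷_ {vs = vs} p q) | false | false | just (u′ , rest)
    with extracted {vs′} p′ q′ π k ← extract-sound u ex q =
    extracted p′ (p ∷ q′) (↭-trans (++⁺ˡ vs π) (shifts vs vs′)) (cong suc k)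

unique-++⁻ : ∀ xs {ys : List ℕ} → Unique (xs ++ ys) → Unique xs × Unique ys
unique-++⁻ []       u       = [] , u
unique-++⁻ (x ∷ xs) (p ∷ u) =
  let q , q′ = unique-++⁻ xs u in (All.++⁻ˡ xs p ∷ q) , q′

singles : List (ℕ × ℕ) → Bool
singles []             = true
singles ((a , b) ∷ ps) = (a ≡ᵇ b) ∧ singles ps

link : ℕ → ℕ → State → State
link u v σ = record σ { links = (u , v) ∷ links σ }

mark : ℕ → Colour → State → State
mark l c σ = record σ { marks = (l , c) ∷ marks σ }

withPieces : List (ℕ × ℕ) → State → State
withPieces ps σ = record σ { pieces = ps }

fresh : State → State
fresh σ = record σ { size = suc (size σ) ; pieces = (size σ , size σ) ∷ pieces σ }

prepare : ℕ → State → State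
prepare v σ = if v ≡ᵇ size σ then fresh σ else σ

-- This is tested together with each plan instead of being proved as an invariant of states. It
-- ensures that giving a vertex to the label `n` leaves the pieces as they are.
endsBelow : ℕ → List (ℕ × ℕ) → Bool
endsBelow n []             = true
endsBelow n ((a , b) ∷ ps) = (a <ᵇ n) ∧ (b <ᵇ n) ∧ endsBelow n ps

playable : ℕ → ℕ → State → Bool
playable u v σ = (u <ᵇ size σ) ∧ (v <ᵇ size σ) ∧ not (u ≡ᵇ v) ∧ not (linked u v (links σ))

-- The answer `c` would complete a P₃ of colour `c` and so needs no plan.
blocked : Colour → ℕ → ℕ → State → Bool
blocked c u v σ = marked u c (marks σ) ∨ marked v c (marks σ)

colour : ℕ → ℕ → Colour → State → State
colour u v c σ = mark v c (mark u c (link u v σ))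

-- The default 0 is harmless: it is a label like any other, and `fits` tests the resulting map on
-- all labels.
at : List ℕ → ℕ → ℕ
at []       _       = 0
at (x ∷ xs) zero    = x
at (x ∷ xs) (suc l) = at xs l

onJust : ∀ {A : Set} → Maybe A → (A → Bool) → Bool
onJust nothing  f = false
onJust (just a) f = f a

below : ℕ → (ℕ → Bool) → Bool
below zero    f = true
below (suc n) f = f n ∧ below n f

-- What remains of `ps` has to be isolated vertices, because the green edges of a dropped path would
-- have to be counted as missing again.
placed : List ℕ → List (ℕ × ℕ) → List (ℕ × ℕ) → Bool
placed μ []             ps = singles ps
placed μ ((u , v) ∷ qs) ps =
  onJust (extract (at μ v) ps) λ (w , rest) → (w ≡ᵇ at μ u) ∧ placed μ qs rest

marksIn : List ℕ → Bool → ℕ → List (ℕ × Colour) → List (ℕ × Colour) → Bool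
marksIn μ t n ms′ []             = true
marksIn μ t n ms′ ((l , c) ∷ ms) =
  (l <ᵇ n) ∧ marked (at μ l) (swapIf t c) ms′ ∧ marksIn μ t n ms′ ms

infixr 5 _⇒ᵇ_
_⇒ᵇ_ : Bool → Bool → Bool
a ⇒ᵇ b = not a ∨ b

-- σ is at least as good as τ, if label l of τ is label at μ l of σ and t tells whether red and blue
-- are exchanged.
fits : State → List ℕ → Bool → State → Bool
fits τ μ t σ =
  placed μ (pieces τ) (pieces σ) ∧
  marksIn μ t (size τ) (marks σ) (marks τ) ∧
  (below (size τ) λ k → at μ k <ᵇ size σ) ∧
  (below (size τ) λ k → below (size τ) λ l → (at μ k ≡ᵇ at μ l) ⇒ᵇ (k ≡ᵇ l)) ∧
  (below (size τ) λ k → below (size τ) λ l →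
     linked (at μ k) (at μ l) (links σ) ⇒ᵇ linked k l (links τ))

-- The edge to draw is followed by the plans for the answers red, blue and green; a label equal to
-- `size` means a new vertex.  After `play` a green edge joins two pieces, after `waste` it is not
-- used, after `close` it completes the cycle.  `probe u v` draws uw and, if that is green, wv for a
-- new vertex w, with plans for red and blue in either case.  `goto k μ t` continues as in situation
-- k, see `fits`.
data Plan : Set where
  play  : ℕ → ℕ → Plan → Plan → Plan → Plan
  waste : ℕ → ℕ → Plan → Plan → Plan → Plan
  close : ℕ → ℕ → Plan → Plan → Plan
  probe : ℕ → ℕ → Plan → Plan → Plan → Plan → Plan
  goto  : ℕ → List ℕ → Bool → Plan
  stop  : Plan

-- `known k r b` grants a win from situation `k`. When `exact` is false, `r` is only a part of the
-- number of missing edges, and `close` and `probe` are refused.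
module Run (claim : ℕ → State) (known : ℕ → ℕ → ℕ → Bool) (exact : Bool) where

  works : Plan → State → ℕ → ℕ → Bool

  answers : ℕ → ℕ → Plan → Plan → State → ℕ → ℕ → Bool
  answers u v pr pb σ r b =
    playable u v σ ∧
    (blocked red u v σ ∨ works pr (colour u v red σ) r b) ∧
    (blocked blue u v σ ∨ works pb (colour u v blue σ) r b)

  prepared : ℕ → ℕ → (State → Bool) → State → Bool
  prepared u v f σ =
    endsBelow (size σ) (pieces σ) ∧
    endsBelow (size (prepare u σ)) (pieces (prepare u σ)) ∧
    f (prepare v (prepare u σ))

  merged : ℕ → ℕ → Plan → Plan → Plan → ℕ → ℕ → State → Bool
  merged u v pr pb pg r b σ =
    answers u v pr pb σ (suc r) b ∧
    onJust (extract u (pieces σ)) λ (u′ , rest) → onJust (extract v rest) λ (v′ , rest′) →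
      works pg (withPieces ((u′ , v′) ∷ rest′) (link u v σ)) r b

  wasted : ℕ → ℕ → Plan → Plan → Plan → ℕ → ℕ → State → Bool
  wasted u v pr pb pg r b σ = answers u v pr pb σ r b ∧ works pg (link u v σ) r b

  works (play u v pr pb pg) σ (suc r) (suc b) = prepared u v (merged u v pr pb pg r b) σ
  works (waste u v pr pb pg) σ r (suc b) = prepared u v (wasted u v pr pb pg r b) σ
  works (close u v pr pb) σ 1 (suc b) =
    exact ∧ answers u v pr pb σ 1 b ∧
    onJust (extract u (pieces σ)) λ (u′ , rest) → (u′ ≡ᵇ v) ∧ singles rest
  works (probe u v pr pb qr qb) σ 2 (suc (suc b)) =
    exact ∧ endsBelow (size σ) (pieces σ) ∧
    answers u (size σ) pr pb (fresh σ) 2 (suc b) ∧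
    -- If the second edge is not green, the first one is given up and is kept as a link only. A path
    -- prolonged to the new vertex could be closed by no other edge than this second one, so Builder
    -- needs a different vertex for the last two edges.
    answers (size σ) v qr qb (link u (size σ) (fresh σ)) 2 b ∧
    onJust (extract u (pieces (fresh σ))) λ (u′ , rest) → onJust (extract (size σ) rest) λ (n , rest′) →
      (u′ ≡ᵇ v) ∧ (n ≡ᵇ size σ) ∧ singles rest′
  works (goto k μ t) σ r b = fits (claim k) μ t σ ∧ known k r b
  works _ σ r b = false

-- Reflection of the Boolean tests

linked-here : ∀ {u v ls} → T (linked u v ((u , v) ∷ ls))
linked-here {u} {v} with u ≡ᵇ u | ≡⇒≡ᵇ u u refl | v ≡ᵇ v | ≡⇒≡ᵇ v v refl
... | true | _ | true | _ = tt

linked-there : ∀ {u v a b} ls → T (linked u v ls) → T (linked u v ((a , b) ∷ ls))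
linked-there {u} {v} {a} {b} ls t with (a ≡ᵇ u) ∧ (b ≡ᵇ v) | (a ≡ᵇ v) ∧ (b ≡ᵇ u)
... | true  | _     = tt
... | false | true  = tt
... | false | false = t

linked-swap : ∀ {u v} ls → T (linked u v ls) → T (linked v u ls)
linked-swap {u} {v} ((a , b) ∷ ls) t with (a ≡ᵇ u) ∧ (b ≡ᵇ v) | (a ≡ᵇ v) ∧ (b ≡ᵇ u)
... | true  | true  = tt
... | true  | false = tt
... | false | true  = tt
... | false | false = linked-swap ls t

extend : (ℕ → ℕ) → ℕ → ℕ → ℕ → ℕ
extend ρ n N l = if l ≡ᵇ n then N else ρ l

extend-old : ∀ ρ {n} N {l} → l < n → extend ρ n N l ≡ ρ l
extend-old ρ {n} N {l} l< with l ≡ᵇ n in e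
... | false = refl
... | true  = ⊥-elim (<-irrefl (≡ᵇ⇒≡ l n (subst T (sym e) tt)) l<)

extend-new : ∀ ρ n N → extend ρ n N n ≡ N
extend-new ρ n N with n ≡ᵇ n | ≡⇒≡ᵇ n n refl
... | true | _ = refl

pieces-extend : ∀ {B ρ n} N {ps ws} → T (endsBelow n ps) → Pieces B ρ ps ws →
                Pieces B (extend ρ n N) ps ws
pieces-extend N t [] = []
pieces-extend {B} {ρ} {n} N t (_∷_ {u} {v} p q) =
  let u< , t′ = ∧-T {u <ᵇ n} t
      v< , t″ = ∧-T {v <ᵇ n} t′
  in subst₂ (λ x y → GreenPath B x y _) (sym (extend-old ρ N (<ᵇ⇒< u n u<)))
       (sym (extend-old ρ N (<ᵇ⇒< v n v<))) p ∷ pieces-extend N t″ q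

adjacent-sym : ∀ {B x y} → Adjacent B x y → Adjacent B y x
adjacent-sym (c , h) = c , hasEdge-sym h

below-T : ∀ {n} f → T (below n f) → ∀ {l} → l < n → T (f l)
below-T {suc n} f t l< with m<1+n⇒m<n∨m≡n l<
... | inj₁ p    = below-T f (proj₂ (∧-T {f n} t)) p
... | inj₂ refl = proj₁ (∧-T {f n} t)

⇒ᵇ-T : ∀ {a b} → T (a ⇒ᵇ b) → T a → T b
⇒ᵇ-T {true} t _ = t

singles-length : ∀ {B ρ ps ws} → T (singles ps) → Pieces B ρ ps ws → Unique ws → length ws ≡ length ps
singles-length {ps = []}           t []      u = refl
singles-length {ps = (a , b) ∷ ps} t (_∷_ {vs = vs} {ws} p q) u with ∧-T {a ≡ᵇ b} t
... | a≡b , t′ with refl ← ≡ᵇ⇒≡ a b a≡b =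
  trans (length-++ vs) (cong₂ _+_ (loop-length p (proj₁ (unique-++⁻ vs u))) (singles-length t′ q (proj₂ (unique-++⁻ vs u))))

record Placed (B : Board) (ρ : ℕ → ℕ) (qs ps : List (ℕ × ℕ)) (ws : List ℕ) : Set where
  constructor placing
  field
    {ws₁ ws₂} : List ℕ
    kept      : Pieces B ρ qs ws₁
    perm      : ws ↭ ws₁ ++ ws₂
    dropped   : length qs + length ws₂ ≡ length ps

placed-sound : ∀ {B ρ} μ qs {ps ws} → T (placed μ qs ps) → Pieces B ρ ps ws → Unique ws →
               Placed B (ρ ∘ at μ) qs ps ws
placed-sound μ [] t P u = placing [] ↭-refl (singles-length t P u)
placed-sound {B} {ρ} μ ((u , v) ∷ qs) {ps} t P uq with extract (at μ v) ps in ex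
... | just (w , rest) with t₁ , t₂ ← ∧-T {w ≡ᵇ at μ u} t
  with refl ← ≡ᵇ⇒≡ w (at μ u) t₁
  with extracted {vs} {ws′} p q π k ← extract-sound (at μ v) ex P
  with placing {ws₁} {ws₂} P′ π′ e ←
    placed-sound μ qs t₂ q (proj₂ (unique-++⁻ vs (Unique-resp-↭ π uq))) =
  placing (p ∷ P′)
    (↭-trans π (↭-trans (++⁺ˡ vs π′) (↭-reflexive (sym (++-assoc vs ws₁ ws₂)))))
    (trans (cong suc e) (sym k))

xor : Bool → Bool → Bool
xor true  b = not b
xor false b = b

swapIf-xor : ∀ s t c → swapIf (xor s t) c ≡ swapIf s (swapIf t c)
swapIf-xor false t     c     = refl
swapIf-xor true  false c     = refl
swapIf-xor true  true  red   = refl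
swapIf-xor true  true  blue  = refl
swapIf-xor true  true  green = refl

-- Soundness of plans

module Strategy (ℓ : ℕ) where

  Win : ℕ → Board → Set
  Win = WinIn (Path 3) (Path 3) (Cycle ℓ)

  -- The number of vertices minus the number of pieces is the number of green edges in the pieces;
  -- `missing` says without subtraction that `r` more make ℓ. All vertices of the board and of the
  -- pieces are below `bound`, which can thus serve as the next new vertex. In `marks-ok` the
  -- neighbour differs from the marked vertex because boards as such may contain loops, and these
  -- make no P₃.
  record Realises (σ : State) (r : ℕ) (B : Board) (s : Bool) (ρ : ℕ → ℕ) : Set where
    field
      {vertices} : List ℕ
      {bound}    : ℕ
      paths      : Pieces B ρ (pieces σ) vertices
      unique     : Unique vertices
      missing    : length vertices + r ≡ ℓ + length (pieces σ)
      vertices<  : All (_< bound) vertices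
      board<     : ∀ {x y} → Adjacent B x y → x < bound
      labels<    : ∀ {l} → l < size σ → ρ l < bound
      injective  : ∀ {k l} → k < size σ → l < size σ → ρ k ≡ ρ l → k ≡ l
      marks-ok   : ∀ {l} c → T (marked l c (marks σ)) →
                   l < size σ × ∃ λ w → w ≢ ρ l × HasEdge B (swapIf s c) (ρ l) w
      links-ok   : ∀ {k l} → k < size σ → l < size σ → Adjacent B (ρ k) (ρ l) →
                   T (linked k l (links σ))
  open Realises

  Wins : State → ℕ → ℕ → Set
  Wins σ r b = ∀ {B s ρ} → Realises σ r B s ρ → Win b B

  module _ {σ : State} {r : ℕ} {B : Board} {s : Bool} {ρ : ℕ → ℕ} (R : Realises σ r B s ρ) where

    realises-link : ∀ {u v} c → u < size σ → v < size σ →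
                    Realises (link u v σ) r ((ρ u , ρ v , c) ∷ B) s ρ
    realises-link {u} {v} c u< v< = record
      { paths     = pieces-∷ _ (paths R)
      ; unique    = unique R
      ; missing   = missing R
      ; vertices< = vertices< R
      ; board<    = λ a → case adjacent-∷ a of λ where
          (inj₁ (refl , _))        → labels< R u<
          (inj₂ (inj₁ (refl , _))) → labels< R v<
          (inj₂ (inj₂ a′))         → board< R a′
      ; labels<   = labels< R
      ; injective = injective R
      ; marks-ok  = λ d t → let l< , w , w≢ , h = marks-ok R d t in l< , w , w≢ , hasEdge-∷ _ h
      ; links-ok  = new
      }
      where
      new : ∀ {k l} → k < size σ → l < size σ → Adjacent ((ρ u , ρ v , c) ∷ B) (ρ k) (ρ l) →
            T (linked k l ((u , v) ∷ links σ))
      new {k} {l} k< l< a with adjacent-∷ a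
      ... | inj₁ (p , q) rewrite injective R k< u< p | injective R l< v< q = linked-here {u} {v} {links σ}
      ... | inj₂ (inj₁ (p , q)) rewrite injective R k< v< p | injective R l< u< q =
              linked-swap {u} {v} ((u , v) ∷ links σ) (linked-here {u} {v} {links σ})
      ... | inj₂ (inj₂ a′) = linked-there {k} {l} {u} {v} (links σ) (links-ok R k< l< a′)

    realises-mark : ∀ {l} c w → l < size σ → w ≢ ρ l → HasEdge B (swapIf s c) (ρ l) w →
                    Realises (mark l c σ) r B s ρ
    realises-mark {l} c w l< w≢ h = record
      { paths     = paths R
      ; unique    = unique R
      ; missing   = missing R
      ; vertices< = vertices< R
      ; board<    = board< R
      ; labels<   = labels< R
      ; injective = injective R
      ; marks-ok  = λ {k} → new {k}
      ; links-ok  = links-ok R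
      }
      where
      new : ∀ {k} d → T (marked k d ((l , c) ∷ marks σ)) →
            k < size σ × ∃ λ w → w ≢ ρ k × HasEdge B (swapIf s d) (ρ k) w
      new {k} d t with ∨-T {(l ≡ᵇ k) ∧ sameᶜ c d} t
      ... | inj₂ t′ = marks-ok R d t′
      ... | inj₁ t′ with ∧-T {l ≡ᵇ k} t′
      ... | p , q with refl ← ≡ᵇ⇒≡ l k p with refl ← sameᶜ⇒≡ {c} {d} q = l< , w , w≢ , h

    realises-pieces : ∀ {ps vs r′} → Pieces B ρ ps vs → vertices R ↭ vs →
                      length vs + r′ ≡ ℓ + length ps → Realises (withPieces ps σ) r′ B s ρ
    realises-pieces P π e = record
      { paths     = P
      ; unique    = Unique-resp-↭ π (unique R)
      ; missing   = e
      ; vertices< = All-resp-↭ π (vertices< R)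
      ; board<    = board< R
      ; labels<   = labels< R
      ; injective = injective R
      ; marks-ok  = marks-ok R
      ; links-ok  = links-ok R
      }

  -- Joining two paths permutes the list of vertices and takes away one piece, hence one missing
  -- edge.
  realises-merge : ∀ {σ r B s ρ} u v {u′ v′ rest rest′} →
    extract u (pieces σ) ≡ just (u′ , rest) → extract v rest ≡ just (v′ , rest′) →
    Realises σ (suc r) B s ρ → HasEdge B green (ρ u) (ρ v) →
    Realises (withPieces ((u′ , v′) ∷ rest′) σ) r B s ρ
  realises-merge {σ} {r} u v {u′} {v′} {rest} {rest′} eu ev R h
    with extracted {vs₁} {ws₁} p q π₁ k₁ ← extract-sound u eu (paths R)
    with extracted {vs₂} {ws₂} p′ q′ π₂ k₂ ← extract-sound v ev q
    with vs₃ , p″ , π₃ ← flip p′ =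
    realises-pieces R (join p h p″ ∷ q′) perm count
    where
    perm : vertices R ↭ (vs₁ ++ vs₃) ++ ws₂
    perm = ↭-trans π₁ (↭-trans (++⁺ˡ vs₁ (↭-trans π₂ (++⁺ʳ ws₂ π₃))) (↭-reflexive (sym (++-assoc vs₁ vs₃ ws₂))))
    count : length ((vs₁ ++ vs₃) ++ ws₂) + r ≡ ℓ + suc (length rest′)
    count = suc-injective (begin
      suc (length ((vs₁ ++ vs₃) ++ ws₂) + r) ≡⟨ cong (λ n → suc (n + r)) (sym (↭-length perm)) ⟩
      suc (length (vertices R) + r)          ≡⟨ sym (+-suc _ r) ⟩
      length (vertices R) + suc r            ≡⟨ missing R ⟩
      ℓ + length (pieces σ)                  ≡⟨ cong (ℓ +_) (trans k₁ (cong suc k₂)) ⟩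
      ℓ + suc (suc (length rest′))           ≡⟨ +-suc ℓ _ ⟩
      suc (ℓ + suc (length rest′))           ∎)
      where open ≡-Reasoning

  -- One edge is missing and all other pieces are isolated vertices, so the path has ℓ - 1 edges and
  -- ℓ vertices.
  closed : ∀ {σ B s ρ} u v {rest} → extract u (pieces σ) ≡ just (v , rest) → T (singles rest) →
           Realises σ 1 B s ρ → HasEdge B green (ρ u) (ρ v) → Won (Path 3) (Path 3) (Cycle ℓ) B
  closed {σ} {B} {s} {ρ} u v {rest} eu t R h
    with extracted {vs} {ws} p q π k ← extract-sound u eu (paths R) =
    inj₂ (inj₂ (subst (λ n → ContainsMono B green (Cycle n)) len
      (greenCycle p (proj₁ (unique-++⁻ vs uq)) (hasEdge-sym h))))
    where
    uq : Unique (vs ++ ws)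
    uq = Unique-resp-↭ π (unique R)
    len : length vs ≡ ℓ
    len = +-cancelʳ-≡ (suc (length rest)) (length vs) ℓ (begin
      length vs + suc (length rest)  ≡⟨ +-suc _ _ ⟩
      suc (length vs + length rest)  ≡⟨ cong (λ n → suc (length vs + n)) (sym (singles-length t q (proj₂ (unique-++⁻ vs uq)))) ⟩
      suc (length vs + length ws)    ≡⟨ cong suc (sym (length-++ vs)) ⟩
      suc (length (vs ++ ws))        ≡⟨ cong suc (sym (↭-length π)) ⟩
      suc (length (vertices R))      ≡⟨ sym (+-comm _ 1) ⟩
      length (vertices R) + 1        ≡⟨ missing R ⟩
      ℓ + length (pieces σ)          ≡⟨ cong (ℓ +_) k ⟩
      ℓ + suc (length rest)          ∎)
      where open ≡-Reasoning

  realises-fresh : ∀ {σ r B s ρ} → T (endsBelow (size σ) (pieces σ)) → (R : Realises σ r B s ρ) →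
                   Realises (fresh σ) r B s (extend ρ (size σ) (bound R))
  realises-fresh {σ} {r} {B} {s} {ρ} t R = record
    { vertices  = N ∷ vertices R
    ; bound     = suc N
    ; paths     = subst₂ (λ x y → GreenPath B x y (N ∷ [])) (sym new) (sym new) (single N)
                    ∷ pieces-extend N t (paths R)
    ; unique    = All.map (λ x<N e → <-irrefl (sym e) x<N) (vertices< R) ∷ unique R
    ; missing   = trans (cong suc (missing R)) (sym (+-suc ℓ _))
    ; vertices< = n<1+n N ∷ All.map m<n⇒m<1+n (vertices< R)
    ; board<    = λ a → m<n⇒m<1+n (board< R a)
    ; labels<   = labels
    ; injective = inj
    ; marks-ok  = λ c m → let l< , w , w≢ , h = marks-ok R c m in
                    m<n⇒m<1+n l< , w , (λ e → w≢ (trans e (old l<))) ,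
                    subst (λ x → HasEdge B (swapIf s c) x w) (sym (old l<)) h
    ; links-ok  = lnk
    }
    where
    N = bound R
    n = size σ
    ρ′ = extend ρ n N
    new : ρ′ n ≡ N
    new = extend-new ρ n N
    old : ∀ {l} → l < n → ρ′ l ≡ ρ l
    old = extend-old ρ N
    labels : ∀ {l} → l < suc n → ρ′ l < suc N
    labels {l} l< with m<1+n⇒m<n∨m≡n l<
    ... | inj₁ l<n  = subst (_< suc N) (sym (old l<n)) (m<n⇒m<1+n (labels< R l<n))
    ... | inj₂ refl = subst (_< suc N) (sym new) (n<1+n N)
    inj : ∀ {k l} → k < suc n → l < suc n → ρ′ k ≡ ρ′ l → k ≡ l
    inj {k} {l} k< l< e with m<1+n⇒m<n∨m≡n k< | m<1+n⇒m<n∨m≡n l<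
    ... | inj₁ p    | inj₁ q    = injective R p q (trans (sym (old p)) (trans e (old q)))
    ... | inj₁ p    | inj₂ refl = ⊥-elim (<-irrefl (trans (sym (old p)) (trans e new)) (labels< R p))
    ... | inj₂ refl | inj₁ q    = ⊥-elim (<-irrefl (trans (sym (old q)) (trans (sym e) new)) (labels< R q))
    ... | inj₂ refl | inj₂ refl = refl
    lnk : ∀ {k l} → k < suc n → l < suc n → Adjacent B (ρ′ k) (ρ′ l) → T (linked k l (links σ))
    lnk {k} {l} k< l< a with m<1+n⇒m<n∨m≡n k< | m<1+n⇒m<n∨m≡n l<
    ... | inj₁ p    | inj₁ q    = links-ok R p q (subst₂ (Adjacent B) (old p) (old q) a)
    ... | inj₁ p    | inj₂ refl = ⊥-elim (<-irrefl refl (subst (_< N) new (board< R (adjacent-sym a))))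
    ... | inj₂ refl | _         = ⊥-elim (<-irrefl refl (subst (_< N) new (board< R a)))

  unless : Bool → Set → Set
  unless true  _ = ⊤
  unless false A = A

  wonP₃ : ∀ {B} s c → c ≢ green → ContainsMono B (swapIf s c) (Path 3) → Won (Path 3) (Path 3) (Cycle ℓ) B
  wonP₃ false red   _ w = inj₁ w
  wonP₃ true  red   _ w = inj₂ (inj₁ w)
  wonP₃ false blue  _ w = inj₂ (inj₁ w)
  wonP₃ true  blue  _ w = inj₁ w
  wonP₃ _     green n _ = ⊥-elim (n refl)

  -- A blocked answer makes a P₃ with the marked neighbour of one end. This neighbour is not the
  -- other end, since the two ends were nonadjacent before the round.
  wins-play : ∀ {σ r b} u v → T (playable u v σ) →
    unless (blocked red u v σ) (Wins (colour u v red σ) r b) →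
    unless (blocked blue u v σ) (Wins (colour u v blue σ) r b) →
    ∀ {B s ρ} → Realises σ r B s ρ →
    (Realises (link u v σ) r ((ρ u , ρ v , green) ∷ B) s ρ → Win b ((ρ u , ρ v , green) ∷ B)) →
    Win (suc b) B
  wins-play {σ} {r} {b} u v t wr wb {B} {s} {ρ} R wg =
    inj₂ (ρ u , ρ v , x≢y , ¬adj ,
      onColours s {λ c → Win b ((ρ u , ρ v , c) ∷ B)} (answer red (λ ()) wr) (answer blue (λ ()) wb)
        (wg (realises-link R green u< v<)))
    where
    t₁ = ∧-T {u <ᵇ size σ} t
    t₂ = ∧-T {v <ᵇ size σ} (proj₂ t₁)
    t₃ = ∧-T {not (u ≡ᵇ v)} (proj₂ t₂)
    u< = <ᵇ⇒< u (size σ) (proj₁ t₁)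
    v< = <ᵇ⇒< v (size σ) (proj₁ t₂)
    x≢y : ρ u ≢ ρ v
    x≢y e = T-not (proj₁ t₃) (≡⇒≡ᵇ u v (injective R u< v< e))
    ¬adj : ¬ Adjacent B (ρ u) (ρ v)
    ¬adj a = T-not (proj₂ t₃) (links-ok R u< v< a)
    answer : ∀ c → c ≢ green → unless (blocked c u v σ) (Wins (colour u v c σ) r b) →
             Win b ((ρ u , ρ v , swapIf s c) ∷ B)
    answer c ng w with marked u c (marks σ) in eu
    ... | true with marks-ok R {u} c (subst T (sym eu) tt)
    ...   | _ , x , x≢ , h = won⇒winIn b (wonP₃ s c ng
              (monoP₃ x≢ (λ { refl → ¬adj (_ , h) }) x≢y (hasEdge-∷ _ (hasEdge-sym h)) hasEdge-new))
    answer c ng w | false with marked v c (marks σ) in ev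
    ... | true with marks-ok R {v} c (subst T (sym ev) tt)
    ...   | _ , x , x≢ , h = won⇒winIn b (wonP₃ s c ng
              (monoP₃ x≢ (λ { refl → ¬adj (adjacent-sym (_ , h)) }) (x≢y ∘ sym)
                (hasEdge-∷ _ (hasEdge-sym h)) (hasEdge-sym hasEdge-new)))
    answer c ng w | false | false =
      w (realises-mark (realises-mark (realises-link R _ u< v<) c (ρ v) u< (x≢y ∘ sym) hasEdge-new)
           c (ρ u) v< x≢y (hasEdge-sym hasEdge-new))

  -- The board stays the same and only less is remembered of it. Forgetting isolated vertices
  -- removes as many vertices as pieces, so `r` remains correct.
  wins-fit : ∀ {σ τ r b} μ t → T (fits τ μ t σ) → Wins τ r b → Wins σ r b
  wins-fit {σ} {τ} {r} μ t f w {B} {s} {ρ} R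
    with f₁ , g₁ ← ∧-T {placed μ (pieces τ) (pieces σ)} f
    with f₂ , g₂ ← ∧-T {marksIn μ t (size τ) (marks σ) (marks τ)} g₁
    with f₃ , g₃ ← ∧-T {below (size τ) λ k → at μ k <ᵇ size σ} g₂
    with f₄ , f₅ ← ∧-T {below (size τ) λ k → below (size τ) λ l → (at μ k ≡ᵇ at μ l) ⇒ᵇ (k ≡ᵇ l)} g₃
    with placing {ws₁} {ws₂} P π e ← placed-sound μ (pieces τ) f₁ (paths R) (unique R) =
    w {s = xor s t} {ρ = ρ ∘ at μ} record
      { vertices  = ws₁
      ; bound     = bound R
      ; paths     = P
      ; unique    = proj₁ (unique-++⁻ ws₁ (Unique-resp-↭ π (unique R)))
      ; missing   = miss
      ; vertices< = All.++⁻ˡ ws₁ (All-resp-↭ π (vertices< R))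
      ; board<    = board< R
      ; labels<   = λ l< → labels< R (inside l<)
      ; injective = λ {k} {l} k< l< q →
          ≡ᵇ⇒≡ k l (⇒ᵇ-T (below-T (λ l → (at μ k ≡ᵇ at μ l) ⇒ᵇ (k ≡ᵇ l)) (below-T _ f₄ k<) l<)
            (≡⇒≡ᵇ (at μ k) (at μ l) (injective R (inside k<) (inside l<) q)))
      ; marks-ok  = λ {l} c → mk (marks τ) f₂ {l} c
      ; links-ok  = λ {k} {l} k< l< a →
          ⇒ᵇ-T (below-T (λ l → linked (at μ k) (at μ l) (links σ) ⇒ᵇ linked k l (links τ)) (below-T _ f₅ k<) l<)
            (links-ok R (inside k<) (inside l<) a)
      }
    where
    inside : ∀ {l} → l < size τ → at μ l < size σ
    inside {l} l< = <ᵇ⇒< (at μ l) (size σ) (below-T (λ k → at μ k <ᵇ size σ) f₃ l<)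
    miss : length ws₁ + r ≡ ℓ + length (pieces τ)
    miss = +-cancelʳ-≡ (length ws₂) _ _ (begin
      length ws₁ + r + length ws₂            ≡⟨ +-assoc (length ws₁) r _ ⟩
      length ws₁ + (r + length ws₂)          ≡⟨ cong (length ws₁ +_) (+-comm r _) ⟩
      length ws₁ + (length ws₂ + r)          ≡⟨ sym (+-assoc (length ws₁) _ r) ⟩
      length ws₁ + length ws₂ + r            ≡⟨ cong (_+ r) (trans (sym (length-++ ws₁)) (sym (↭-length π))) ⟩
      length (vertices R) + r                ≡⟨ missing R ⟩
      ℓ + length (pieces σ)                  ≡⟨ cong (ℓ +_) (sym e) ⟩
      ℓ + (length (pieces τ) + length ws₂)   ≡⟨ sym (+-assoc ℓ _ _) ⟩
      ℓ + length (pieces τ) + length ws₂     ∎)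
      where open ≡-Reasoning
    mk : ∀ ms → T (marksIn μ t (size τ) (marks σ) ms) → ∀ {l} c → T (marked l c ms) →
         l < size τ × ∃ λ x → x ≢ ρ (at μ l) × HasEdge B (swapIf (xor s t) c) (ρ (at μ l)) x
    mk ((k , d) ∷ ms) g {l} c m with ∧-T {k <ᵇ size τ} g
    ... | g₁ , g′ with ∧-T {marked (at μ k) (swapIf t d) (marks σ)} g′
    ... | g₂ , g₃ with ∨-T {(k ≡ᵇ l) ∧ sameᶜ d c} m
    ... | inj₂ m′ = mk ms g₃ c m′
    ... | inj₁ m′ with ∧-T {k ≡ᵇ l} m′
    ... | p , q with refl ← ≡ᵇ⇒≡ k l p with refl ← sameᶜ⇒≡ {d} {c} q
      with _ , x , x≢ , h ← marks-ok R {at μ k} (swapIf t d) g₂ =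
      <ᵇ⇒< k (size τ) g₁ , x , x≢ , subst (λ c → HasEdge B c (ρ (at μ k)) x) (sym (swapIf-xor s t d)) h

  wins-prepare : ∀ {σ} r b v → T (endsBelow (size σ) (pieces σ)) → Wins (prepare v σ) r b → Wins σ r b
  wins-prepare {σ} r b v t w with v ≡ᵇ size σ
  ... | true  = λ R → w (realises-fresh t R)
  ... | false = w

  module _ (claim : ℕ → State) (known : ℕ → ℕ → ℕ → Bool) (exact : Bool) where
    open Run claim known exact

    -- Plans are run on the known parts r and b of the numbers r + r₀ of missing edges and b + b₀
    -- of rounds; closing the cycle needs r₀ ≡ 0.
    module _ (r₀ b₀ : ℕ) (exact⇒ : T exact → r₀ ≡ 0)
             (known⇒ : ∀ k r b → T (known k r b) → Wins (claim k) (r + r₀) (b + b₀)) where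

      works⇒wins : ∀ p {σ} r b → T (works p σ r b) → Wins σ (r + r₀) (b + b₀)

      unless-works : ∀ x p {σ} r b → T (x ∨ works p σ r b) → unless x (Wins σ (r + r₀) (b + b₀))
      unless-works true  p r b _ = tt
      unless-works false p r b w = works⇒wins p r b w

      wins-answers : ∀ {σ} r b u v pr pb → T (answers u v pr pb σ r b) →
        ∀ {B s ρ} → Realises σ (r + r₀) B s ρ →
        (Realises (link u v σ) (r + r₀) ((ρ u , ρ v , green) ∷ B) s ρ →
          Win (b + b₀) ((ρ u , ρ v , green) ∷ B)) →
        Win (suc (b + b₀)) B
      wins-answers {σ} r b u v pr pb t =
        let t₁ , t₂ = ∧-T {playable u v σ} t
            wr , wb = ∧-T {blocked red u v σ ∨ works pr (colour u v red σ) r b} t₂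
        in wins-play {σ} {r + r₀} {b + b₀} u v t₁
             (unless-works (blocked red u v σ) pr r b wr) (unless-works (blocked blue u v σ) pb r b wb)

      wins-prepared : ∀ r b u v f → (∀ {σ} → T (f σ) → Wins σ (r + r₀) (b + b₀)) →
                      ∀ {σ} → T (prepared u v f σ) → Wins σ (r + r₀) (b + b₀)
      wins-prepared r b u v f w {σ} t =
        let t₁ , t₂ = ∧-T {endsBelow (size σ) (pieces σ)} t
            t₃ , t₄ = ∧-T {endsBelow (size (prepare u σ)) (pieces (prepare u σ))} t₂
        in wins-prepare (r + r₀) (b + b₀) u t₁ (wins-prepare (r + r₀) (b + b₀) v t₃ (w t₄))

      wins-merged : ∀ r b u v pr pb pg {σ} → T (merged u v pr pb pg r b σ) →
                    Wins σ (suc (r + r₀)) (suc (b + b₀))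
      wins-merged r b u v pr pb pg {σ} t R
        with a , g ← ∧-T {answers u v pr pb σ (suc r) b} t with extract u (pieces σ) in eu
      ... | just (u′ , rest) with extract v rest in ev
      ... | just (v′ , rest′) = wins-answers (suc r) b u v pr pb a R
              λ R′ → works⇒wins pg r b g (realises-merge u v eu ev R′ hasEdge-new)

      works⇒wins (play u v pr pb pg) (suc r) (suc b) =
        wins-prepared (suc r) (suc b) u v (merged u v pr pb pg r b) (wins-merged r b u v pr pb pg)
      works⇒wins (waste u v pr pb pg) r (suc b) =
        wins-prepared r (suc b) u v (wasted u v pr pb pg r b) λ {σ} t R →
        let a , g = ∧-T {answers u v pr pb σ r b} t
        in wins-answers r b u v pr pb a R (works⇒wins pg r b g)
      works⇒wins (close u v pr pb) {σ} 1 (suc b) t R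
        with x , t₁ ← ∧-T {exact} t with refl ← exact⇒ x
        with a , g ← ∧-T {answers u v pr pb σ 1 b} t₁ with extract u (pieces σ) in eu
      ... | just (u′ , rest) with g₁ , g₂ ← ∧-T {u′ ≡ᵇ v} g with refl ← ≡ᵇ⇒≡ u′ v g₁ =
        wins-answers 1 b u v pr pb a R
          λ R′ → won⇒winIn (b + b₀) (closed u v eu g₂ R′ hasEdge-new)
      works⇒wins (probe u v pr pb qr qb) {σ} 2 (suc (suc b)) t R
        with x , t₁ ← ∧-T {exact} t with refl ← exact⇒ x
        with e , t₂ ← ∧-T {endsBelow (size σ) (pieces σ)} t₁
        with a , t₃ ← ∧-T {answers u (size σ) pr pb (fresh σ) 2 (suc b)} t₂
        with a′ , g ← ∧-T {answers (size σ) v qr qb (link u (size σ) (fresh σ)) 2 b} t₃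
        with extract u (pieces (fresh σ)) in eu
      ... | just (u′ , rest) with extract (size σ) rest in en
      ... | just (n , rest′) with g₁ , g₂ ← ∧-T {u′ ≡ᵇ v} g with refl ← ≡ᵇ⇒≡ u′ v g₁
        with g₃ , g₄ ← ∧-T {n ≡ᵇ size σ} g₂ with refl ← ≡ᵇ⇒≡ n (size σ) g₃ =
        wins-answers 2 (suc b) u (size σ) pr pb a (realises-fresh e R) λ R₁ →
        wins-answers 2 b (size σ) v qr qb a′ R₁ λ R₂ →
        -- The path now runs from `v` through `u` to the new vertex, and the second green edge joins
        -- its two ends.
        won⇒winIn (b + b₀) (closed v (size σ) (extract-first v) g₄
          (realises-merge u (size σ) eu en R₂ (hasEdge-∷ _ hasEdge-new)) (hasEdge-sym hasEdge-new))
        where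
        extract-first : ∀ v {w ps} → extract v ((v , w) ∷ ps) ≡ just (w , ps)
        extract-first v with v ≡ᵇ v | ≡⇒≡ᵇ v v refl
        ... | true | _ = refl
      works⇒wins (goto k μ t) {σ} r b w =
        let f , q = ∧-T {fits (claim k) μ t σ} w in wins-fit μ t f (known⇒ k r b q)

-- The plans

record Entry : Set where
  constructor entry
  field
    situation : State
    edges     : ℕ
    rounds    : ℕ
    plan      : Plan
open Entry

situationAt : List Entry → ℕ → State
situationAt []       _       = state 0 [] [] []
situationAt (e ∷ es) zero    = situation e
situationAt (e ∷ es) (suc k) = situationAt es k

listed : List Entry → ℕ → ℕ → ℕ → Bool
listed []       _       r b = false
listed (e ∷ es) zero    r b = (r ≡ᵇ edges e) ∧ (rounds e ≤ᵇ b)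
listed (e ∷ es) (suc k) r b = listed es k r b

-- Each plan is run against the entries behind its own, so references point forwards only and
-- induction on the list proves all entries.
sound : List Entry → Bool
sound []       = true
sound (e ∷ es) =
  Run.works (situationAt es) (listed es) true (plan e) (situation e) (edges e) (rounds e) ∧ sound es

-- Found by computer search.  In each entry, `goto k` means the (k + 1)-st entry after it.
table : List Entry
table =
  entry (state 4 ((2 , 3) ∷ (0 , 0) ∷ (1 , 1) ∷ []) ((0 , red) ∷ (1 , red) ∷ []) []) 11 16 (play 0 2
    stop (play 1 2 stop stop (play 4 5 (play 5 6 stop (play 6 1 stop stop (goto 1 (4 ∷ 5 ∷ 3 ∷ 6 ∷ 0
    ∷ []) false)) (play 6 0 stop stop (play 4 3 stop (goto 15 (4 ∷ 1 ∷ 3 ∷ 5 ∷ 0 ∷ []) false) (goto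
    16 (4 ∷ 1 ∷ 5 ∷ 0 ∷ []) false)))) (play 5 1 stop stop (play 4 6 (goto 1 (6 ∷ 4 ∷ 3 ∷ 5 ∷ 0 ∷ [])
    false) stop (play 5 7 (play 6 5 stop stop (play 3 0 stop stop (goto 57 (7 ∷ 4 ∷ 0 ∷ []) false)))
    stop (play 3 4 (play 7 4 stop stop (goto 18 (6 ∷ 3 ∷ 0 ∷ []) false)) stop (play 7 0 stop stop
    (goto 73 (6 ∷ 0 ∷ []) false)))))) (play 4 0 stop stop (goto 13 (3 ∷ 1 ∷ 5 ∷ 0 ∷ []) false))))
    (play 1 3 stop (play 1 0 stop stop (play 4 5 (play 5 6 stop (goto 0 (6 ∷ 4 ∷ 5 ∷ 3 ∷ 1 ∷ [])
    true) (play 5 3 stop stop (goto 28 (4 ∷ 6 ∷ 1 ∷ []) false))) (play 5 6 (goto 0 (4 ∷ 6 ∷ 5 ∷ 3 ∷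
    1 ∷ []) true) stop (play 5 7 (play 7 3 stop stop (goto 7 (4 ∷ 6 ∷ 5 ∷ 7 ∷ 1 ∷ []) true)) stop
    (play 4 6 (play 6 1 stop stop (goto 18 (7 ∷ 3 ∷ 4 ∷ []) true)) stop (play 4 8 (play 8 1 stop
    stop (goto 79 (7 ∷ 4 ∷ 8 ∷ 3 ∷ []) false)) stop (play 7 3 (play 3 9 stop stop (goto 80 (8 ∷ 7 ∷
    9 ∷ 1 ∷ []) false)) stop (goto 106 (8 ∷ 1 ∷ []) false)))))) (play 3 6 (play 4 3 stop stop (goto
    28 (6 ∷ 5 ∷ 1 ∷ []) false)) stop (goto 3 (4 ∷ 5 ∷ 6 ∷ 1 ∷ []) false)))) (play 1 4 stop (play 4 0
    stop stop (goto 24 (4 ∷ 1 ∷ []) true)) (goto 64 (4 ∷ 0 ∷ []) false)))) ∷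
  entry (state 5 ((3 , 4) ∷ (0 , 0) ∷ (1 , 1) ∷ (2 , 2) ∷ []) ((0 , red) ∷ (1 , blue) ∷ (2 , red) ∷
    (2 , blue) ∷ (3 , red) ∷ (4 , red) ∷ (4 , blue) ∷ []) ((0 , 2) ∷ (1 , 2) ∷ (3 , 4) ∷ [])) 9 11
    (play 1 3 stop stop (goto 5 (0 ∷ 2 ∷ 1 ∷ 4 ∷ []) false)) ∷
  entry (state 5 ((2 , 3) ∷ (0 , 0) ∷ (1 , 1) ∷ (4 , 4) ∷ []) ((0 , red) ∷ (1 , red) ∷ (1 , blue) ∷
    (3 , blue) ∷ (4 , red) ∷ (4 , blue) ∷ []) ((0 , 1) ∷ (1 , 3) ∷ [])) 9 11 (play 2 4 stop stop
    (goto 4 (0 ∷ 1 ∷ 3 ∷ 4 ∷ []) false)) ∷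
  entry (state 4 ((2 , 3) ∷ (0 , 0) ∷ (1 , 1) ∷ []) ((0 , red) ∷ (1 , red) ∷ []) []) 10 15 (play 0 1
    stop (play 0 2 stop stop (goto 20 (1 ∷ 3 ∷ 0 ∷ []) false)) (play 2 0 stop (play 2 1 stop stop
    (play 4 5 (goto 2 (5 ∷ 4 ∷ 3 ∷ 0 ∷ []) false) (goto 2 (5 ∷ 4 ∷ 3 ∷ 0 ∷ []) true) (goto 0 (4 ∷ 5
    ∷ 3 ∷ 0 ∷ []) false))) (goto 61 (3 ∷ 1 ∷ []) false))) ∷
  entry (state 4 ((0 , 1) ∷ (2 , 3) ∷ []) ((3 , red) ∷ (3 , blue) ∷ []) ((0 , 1) ∷ [])) 7 11 (play 0
    4 (goto 0 (4 ∷ 1 ∷ 0 ∷ 2 ∷ 3 ∷ []) false) (goto 0 (4 ∷ 1 ∷ 0 ∷ 2 ∷ 3 ∷ []) true) (play 1 2 (goto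
    22 (4 ∷ 1 ∷ 2 ∷ 3 ∷ []) false) (goto 22 (4 ∷ 1 ∷ 2 ∷ 3 ∷ []) true) (goto 69 (4 ∷ 3 ∷ [])
    false))) ∷
  entry (state 5 ((1 , 2) ∷ (3 , 4) ∷ (0 , 0) ∷ []) ((0 , red) ∷ (2 , red) ∷ (4 , red) ∷ (4 , blue)
    ∷ []) ((0 , 2) ∷ (1 , 2) ∷ [])) 7 10 (play 0 1 stop (play 0 3 stop stop (goto 22 (2 ∷ 1 ∷ 4 ∷ 0
    ∷ []) false)) (play 0 5 stop (play 4 2 stop stop (goto 70 (5 ∷ 3 ∷ 0 ∷ []) true)) (goto 24 (5 ∷
    2 ∷ 3 ∷ 4 ∷ []) false))) ∷
  entry (state 4 ((2 , 3) ∷ (0 , 0) ∷ (1 , 1) ∷ []) ((0 , red) ∷ (1 , red) ∷ (3 , red) ∷ (3 , blue)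
    ∷ []) ((0 , 1) ∷ [])) 8 11 (play 0 2 stop (goto 0 (1 ∷ 0 ∷ 2 ∷ 3 ∷ []) false) (goto 19 (1 ∷ 0 ∷
    3 ∷ []) false)) ∷
  entry (state 4 ((2 , 3) ∷ (0 , 0) ∷ (1 , 1) ∷ []) ((0 , red) ∷ (1 , red) ∷ (1 , blue) ∷ (2 , blue)
    ∷ (3 , red) ∷ (3 , blue) ∷ []) ((0 , 1) ∷ (1 , 2) ∷ [])) 8 10 (play 1 4 stop stop (goto 0 (0 ∷ 4
    ∷ 1 ∷ 2 ∷ 3 ∷ []) false)) ∷
  entry (state 5 ((1 , 2) ∷ (3 , 4) ∷ (0 , 0) ∷ []) ((0 , red) ∷ (2 , red) ∷ (2 , blue) ∷ (3 , blue)
    ∷ (4 , red) ∷ (4 , blue) ∷ []) ((0 , 2) ∷ (1 , 2) ∷ (2 , 3) ∷ [])) 7 9 (play 1 4 stop stop (goto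
    49 (0 ∷ 3 ∷ 2 ∷ []) false)) ∷
  entry (state 4 ((2 , 3) ∷ (0 , 0) ∷ (1 , 1) ∷ []) ((0 , red) ∷ (1 , blue) ∷ []) []) 10 15 (play 0
    2 stop (play 0 3 stop stop (play 1 4 (play 1 5 stop stop (goto 0 (4 ∷ 5 ∷ 1 ∷ 2 ∷ 0 ∷ [])
    false)) stop (play 1 5 (goto 0 (5 ∷ 4 ∷ 1 ∷ 2 ∷ 0 ∷ []) false) stop (play 4 2 (play 5 2 stop
    stop (goto 63 (4 ∷ 0 ∷ []) false)) stop (goto 29 (5 ∷ 0 ∷ []) false))))) (play 1 0 stop stop
    (goto 55 (3 ∷ 1 ∷ []) true))) ∷
  entry (state 5 ((1 , 2) ∷ (3 , 4) ∷ (0 , 0) ∷ []) ((0 , red) ∷ (2 , red) ∷ (2 , blue) ∷ (3 , blue)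
    ∷ (4 , red) ∷ (4 , blue) ∷ []) ((0 , 2) ∷ (1 , 2) ∷ (3 , 4) ∷ [])) 8 11 (play 1 4 stop stop
    (goto 61 (0 ∷ 3 ∷ 2 ∷ []) false)) ∷
  entry (state 4 ((0 , 1) ∷ (2 , 3) ∷ []) [] []) 9 15 (play 0 2 (goto 0 (1 ∷ 0 ∷ 3 ∷ 2 ∷ []) false)
    (goto 0 (1 ∷ 0 ∷ 3 ∷ 2 ∷ []) true) (goto 52 (1 ∷ 3 ∷ []) false)) ∷
  entry (state 4 ((0 , 1) ∷ (2 , 3) ∷ []) ((1 , red) ∷ (3 , red) ∷ []) ((1 , 3) ∷ [])) 9 14 (play 1
    4 stop (play 4 3 stop stop (goto 1 (2 ∷ 4 ∷ 0 ∷ 1 ∷ []) true)) (play 0 5 (play 5 2 stop (play 0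
    2 stop stop (play 4 5 stop stop (goto 60 (3 ∷ 5 ∷ []) false))) (play 4 5 stop (goto 0 (0 ∷ 4 ∷ 3
    ∷ 5 ∷ []) false) (goto 43 (0 ∷ 3 ∷ []) false))) (play 5 4 (play 5 2 stop stop (goto 0 (4 ∷ 0 ∷ 3
    ∷ 5 ∷ []) false)) stop (play 2 5 (play 3 0 stop stop (goto 60 (2 ∷ 5 ∷ []) false)) stop (play 3
    6 stop (goto 60 (0 ∷ 3 ∷ []) true) (goto 80 (6 ∷ 0 ∷ []) true)))) (goto 53 (4 ∷ 5 ∷ 2 ∷ 3 ∷ [])
    false))) ∷
  entry (state 4 ((0 , 1) ∷ (2 , 3) ∷ []) ((0 , red) ∷ (1 , blue) ∷ (2 , red) ∷ (3 , red) ∷ (3 ,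
    blue) ∷ []) ((0 , 3) ∷ (1 , 3) ∷ [])) 7 10 (play 1 2 stop stop (goto 59 (0 ∷ 3 ∷ []) false)) ∷
  entry (state 4 ((0 , 1) ∷ (2 , 3) ∷ []) ((1 , red) ∷ (3 , red) ∷ (3 , blue) ∷ []) ((1 , 3) ∷ []))
    8 12 (play 0 4 (play 4 2 stop (play 0 2 stop stop (goto 3 (1 ∷ 3 ∷ 4 ∷ []) false)) (goto 2 (0 ∷
    1 ∷ 4 ∷ 3 ∷ []) false)) (play 4 2 (goto 1 (4 ∷ 1 ∷ 0 ∷ 2 ∷ 3 ∷ []) false) stop (goto 0 (0 ∷ 1 ∷
    4 ∷ 3 ∷ []) true)) (play 4 2 (goto 2 (4 ∷ 1 ∷ 2 ∷ 3 ∷ []) false) (goto 0 (4 ∷ 1 ∷ 2 ∷ 3 ∷ [])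
    true) (goto 58 (1 ∷ 3 ∷ []) false))) ∷
  entry (state 4 ((0 , 1) ∷ (2 , 3) ∷ []) ((0 , red) ∷ (1 , blue) ∷ (2 , red) ∷ (3 , red) ∷ (3 ,
    blue) ∷ []) ((0 , 2) ∷ (1 , 3) ∷ [])) 7 10 (play 1 2 stop stop (goto 57 (0 ∷ 3 ∷ []) false)) ∷
  entry (state 5 ((1 , 2) ∷ (3 , 4) ∷ (0 , 0) ∷ []) ((0 , red) ∷ (0 , blue) ∷ (1 , red) ∷ (2 , blue)
    ∷ (3 , red) ∷ (4 , red) ∷ (4 , blue) ∷ []) ((0 , 2) ∷ (0 , 3) ∷ (1 , 4) ∷ [])) 8 10 (play 2 3
    stop stop (goto 1 (1 ∷ 4 ∷ 0 ∷ []) false)) ∷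
  entry (state 4 ((0 , 1) ∷ (2 , 3) ∷ []) ((0 , red) ∷ (1 , red) ∷ (2 , red) ∷ (3 , red) ∷ (3 ,
    blue) ∷ []) ((0 , 2) ∷ (1 , 3) ∷ [])) 7 10 (play 0 4 stop (play 4 1 stop stop (play 4 5 (play 4
    6 stop stop (goto 69 (5 ∷ 6 ∷ 0 ∷ 2 ∷ 3 ∷ []) false)) stop (goto 62 (5 ∷ 0 ∷ 2 ∷ 3 ∷ [])
    false))) (goto 27 (4 ∷ 1 ∷ 2 ∷ 3 ∷ []) false)) ∷
  entry (state 3 ((0 , 1) ∷ (2 , 2) ∷ []) ((0 , red) ∷ (1 , red) ∷ (1 , blue) ∷ (2 , red) ∷ (2 ,
    blue) ∷ []) ((0 , 1) ∷ [])) 7 9 (play 1 3 stop stop (goto 0 (3 ∷ 0 ∷ 2 ∷ []) false)) ∷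
  entry (state 3 ((0 , 1) ∷ (2 , 2) ∷ []) ((1 , red) ∷ (2 , red) ∷ (2 , blue) ∷ []) []) 6 8 (play 3
    4 (play 4 5 stop (play 5 1 stop stop (goto 16 (3 ∷ 4 ∷ 0 ∷ 5 ∷ 2 ∷ []) false)) (play 5 2 stop
    stop (play 3 0 stop (goto 17 (3 ∷ 1 ∷ 0 ∷ 4 ∷ 2 ∷ []) true) (goto 77 (3 ∷ 1 ∷ 4 ∷ 2 ∷ [])
    false)))) (play 4 1 stop stop (goto 14 (3 ∷ 0 ∷ 4 ∷ 2 ∷ []) true)) (play 3 2 stop stop (goto 61
    (0 ∷ 1 ∷ 4 ∷ 2 ∷ []) false))) ∷
  entry (state 4 ((0 , 1) ∷ (2 , 3) ∷ []) [] []) 8 14 (play 0 2 (goto 0 (1 ∷ 0 ∷ 3 ∷ 2 ∷ []) false)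
    (goto 0 (1 ∷ 0 ∷ 3 ∷ 2 ∷ []) true) (goto 57 (1 ∷ 3 ∷ []) false)) ∷
  entry (state 4 ((0 , 1) ∷ (2 , 3) ∷ []) ((1 , red) ∷ (3 , red) ∷ []) ((1 , 3) ∷ [])) 8 13 (play 0
    3 stop (play 3 4 stop stop (play 2 5 (goto 0 (5 ∷ 4 ∷ 2 ∷ 1 ∷ 0 ∷ []) false) (goto 0 (5 ∷ 4 ∷ 2
    ∷ 0 ∷ 1 ∷ []) true) (goto 22 (4 ∷ 5 ∷ 1 ∷ 0 ∷ []) false))) (goto 18 (2 ∷ 1 ∷ []) false)) ∷
  entry (state 5 ((1 , 2) ∷ (3 , 4) ∷ (0 , 0) ∷ []) ((0 , red) ∷ (2 , red) ∷ (3 , red) ∷ (4 , blue)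
    ∷ []) ((0 , 2) ∷ [])) 7 10 (play 0 1 stop (play 3 1 stop stop (play 2 5 stop (play 0 6 stop stop
    (play 5 6 (play 6 4 stop stop (play 2 7 stop stop (goto 66 (7 ∷ 0 ∷ 5 ∷ []) false))) stop (goto
    65 (5 ∷ 0 ∷ 4 ∷ 2 ∷ []) true))) (play 6 7 (play 7 0 stop stop (play 6 5 stop (goto 14 (6 ∷ 4 ∷ 5
    ∷ 7 ∷ 0 ∷ []) true) (play 4 7 stop stop (goto 99 (6 ∷ 0 ∷ []) false)))) (goto 11 (7 ∷ 5 ∷ 4 ∷ 0
    ∷ []) true) (play 6 0 stop stop (goto 59 (5 ∷ 4 ∷ 7 ∷ 0 ∷ []) true))))) (play 3 5 stop (play 4 0
    stop stop (goto 53 (5 ∷ 2 ∷ 3 ∷ []) true)) (play 0 6 stop (goto 36 (6 ∷ 4 ∷ 5 ∷ 2 ∷ 0 ∷ [])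
    true) (goto 25 (6 ∷ 2 ∷ 5 ∷ 4 ∷ []) false)))) ∷
  entry (state 3 ((1 , 2) ∷ (0 , 0) ∷ []) ((0 , red) ∷ []) []) 9 14 (play 0 1 stop (goto 0 (0 ∷ 2 ∷
    1 ∷ []) true) (goto 41 (2 ∷ 0 ∷ []) false)) ∷
  entry (state 3 ((1 , 2) ∷ (0 , 0) ∷ []) ((0 , red) ∷ (0 , blue) ∷ (2 , red) ∷ []) ((0 , 2) ∷ []))
    9 13 (play 0 1 stop stop (goto 0 (2 ∷ 0 ∷ []) false)) ∷
  entry (state 2 ((0 , 1) ∷ []) ((0 , red) ∷ (1 , red) ∷ (1 , blue) ∷ []) ((0 , 1) ∷ [])) 8 12 (play
    0 2 stop (play 0 3 stop stop (goto 3 (2 ∷ 3 ∷ 1 ∷ []) true)) (play 2 3 (goto 0 (3 ∷ 2 ∷ 1 ∷ [])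
    false) (goto 0 (3 ∷ 2 ∷ 1 ∷ []) true) (goto 13 (3 ∷ 1 ∷ []) false))) ∷
  entry (state 3 ((1 , 2) ∷ (0 , 0) ∷ []) ((0 , red) ∷ (1 , red) ∷ (2 , red) ∷ (2 , blue) ∷ []) ((0
    , 1) ∷ [])) 7 10 (play 0 3 stop (play 2 4 stop stop (goto 27 (3 ∷ 0 ∷ 4 ∷ 1 ∷ []) true)) (goto 0
    (3 ∷ 0 ∷ 1 ∷ 2 ∷ []) false)) ∷
  entry (state 4 ((0 , 1) ∷ (2 , 3) ∷ []) ((1 , red) ∷ (2 , red) ∷ (3 , red) ∷ (3 , blue) ∷ []) ((0
    , 1) ∷ (1 , 2) ∷ [])) 6 9 (play 0 2 stop (goto 0 (1 ∷ 0 ∷ 3 ∷ 2 ∷ []) false) (goto 46 (1 ∷ 3 ∷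
    []) false)) ∷
  entry (state 4 ((0 , 1) ∷ (2 , 3) ∷ []) ((0 , red) ∷ (1 , blue) ∷ (2 , red) ∷ (2 , blue) ∷ (3 ,
    red) ∷ (3 , blue) ∷ []) ((0 , 1) ∷ (0 , 3) ∷ (1 , 3) ∷ [])) 6 8 (play 2 4 stop stop (goto 51 (4
    ∷ 3 ∷ 0 ∷ 1 ∷ []) false)) ∷
  entry (state 3 ((1 , 2) ∷ (0 , 0) ∷ []) ((0 , red) ∷ (2 , red) ∷ (2 , blue) ∷ []) []) 7 10 (play 3
    4 (play 0 1 stop (play 4 1 stop stop (play 2 5 stop stop (goto 4 (3 ∷ 5 ∷ 4 ∷ 0 ∷ []) false)))
    (play 4 0 stop (play 2 5 stop stop (goto 47 (3 ∷ 4 ∷ 5 ∷ 0 ∷ []) false)) (goto 45 (3 ∷ 4 ∷ 2 ∷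
    []) false))) (play 4 2 stop stop (play 3 5 (play 3 6 stop stop (play 0 6 stop (play 0 1 stop
    stop (goto 33 (5 ∷ 4 ∷ 0 ∷ 6 ∷ 3 ∷ []) false)) (play 5 1 stop (play 1 0 stop stop (goto 32 (5 ∷
    4 ∷ 3 ∷ []) true)) (play 4 0 stop stop (goto 92 (5 ∷ 3 ∷ []) false))))) stop (play 1 6 (play 1 7
    stop (goto 1 (0 ∷ 6 ∷ 7 ∷ 5 ∷ 3 ∷ 4 ∷ 1 ∷ []) false) (play 6 7 stop (play 0 3 stop stop (play 6
    4 stop stop (goto 3 (5 ∷ 0 ∷ 7 ∷ 6 ∷ []) false))) (play 0 4 stop stop (goto 20 (5 ∷ 3 ∷ 0 ∷ 6 ∷
    []) true)))) (play 1 7 (goto 1 (0 ∷ 7 ∷ 6 ∷ 5 ∷ 3 ∷ 4 ∷ 1 ∷ []) false) stop (play 6 7 (play 0 4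
    stop stop (play 6 5 stop stop (goto 3 (0 ∷ 7 ∷ 3 ∷ 6 ∷ []) false))) stop (play 0 3 stop stop
    (goto 20 (5 ∷ 0 ∷ 6 ∷ 4 ∷ []) false)))) (play 6 5 (play 6 7 stop (play 3 6 stop stop (play 0 7
    stop stop (play 5 7 stop stop (close 0 4 stop stop)))) (play 0 3 stop stop (goto 20 (7 ∷ 4 ∷ 0 ∷
    5 ∷ []) true))) (play 4 7 (play 0 5 stop stop (goto 2 (7 ∷ 0 ∷ 3 ∷ 6 ∷ 4 ∷ []) false)) stop
    (play 0 6 stop stop (play 7 3 (goto 3 (0 ∷ 7 ∷ 5 ∷ 3 ∷ []) false) stop (goto 23 (0 ∷ 5 ∷ [])
    false)))) (play 0 7 stop (play 0 4 stop stop (goto 92 (3 ∷ 0 ∷ []) true)) (goto 22 (7 ∷ 0 ∷ 4 ∷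
    3 ∷ []) false)))))) (play 0 3 stop (play 0 4 stop stop (goto 50 (1 ∷ 2 ∷ 0 ∷ 3 ∷ []) false))
    (goto 0 (4 ∷ 0 ∷ 1 ∷ 2 ∷ []) false))) ∷
  entry (state 4 ((0 , 1) ∷ (2 , 3) ∷ []) ((1 , red) ∷ (3 , red) ∷ (3 , blue) ∷ []) []) 5 8 (play 1
    2 stop (goto 49 (0 ∷ 1 ∷ 3 ∷ 2 ∷ []) false) (goto 76 (0 ∷ 3 ∷ []) false)) ∷
  entry (state 7 ((3 , 4) ∷ (5 , 6) ∷ (0 , 0) ∷ (1 , 1) ∷ (2 , 2) ∷ []) ((0 , red) ∷ (1 , red) ∷ (2
    , blue) ∷ (4 , blue) ∷ (5 , blue) ∷ (6 , red) ∷ (6 , blue) ∷ []) ((1 , 6) ∷ (2 , 6) ∷ (3 , 4) ∷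
    (4 , 5) ∷ [])) 5 5 (play 0 4 stop stop (play 2 0 stop stop (goto 0 (1 ∷ 3 ∷ 2 ∷ 5 ∷ 6 ∷ [])
    false))) ∷
  entry (state 5 ((1 , 2) ∷ (3 , 4) ∷ (0 , 0) ∷ []) ((0 , red) ∷ (2 , blue) ∷ (3 , blue) ∷ (4 , red)
    ∷ (4 , blue) ∷ []) ((0 , 4) ∷ (2 , 4) ∷ [])) 3 3 (play 0 3 stop stop (goto 0 (1 ∷ 2 ∷ 0 ∷ 4 ∷
    []) true)) ∷
  entry (state 4 ((0 , 1) ∷ (2 , 3) ∷ []) ((1 , red) ∷ (2 , blue) ∷ (3 , red) ∷ (3 , blue) ∷ []) ((1
    , 3) ∷ (2 , 3) ∷ [])) 2 2 (play 1 2 stop stop (close 0 3 stop stop)) ∷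
  entry (state 4 ((1 , 2) ∷ (0 , 0) ∷ (3 , 3) ∷ []) ((0 , red) ∷ (2 , red) ∷ (3 , red) ∷ (3 , blue)
    ∷ []) ((0 , 2) ∷ [])) 5 6 (play 0 4 stop (goto 1 (4 ∷ 0 ∷ 1 ∷ 2 ∷ 3 ∷ []) true) (play 2 5 stop
    (play 5 0 stop stop (play 1 3 stop stop (goto 0 (4 ∷ 5 ∷ 3 ∷ 2 ∷ []) true))) (play 4 3 stop stop
    (play 1 0 stop (goto 0 (5 ∷ 1 ∷ 3 ∷ 0 ∷ []) true) (close 5 3 stop stop))))) ∷
  entry (state 4 ((0 , 1) ∷ (2 , 3) ∷ []) ((1 , red) ∷ (2 , red) ∷ (2 , blue) ∷ (3 , red) ∷ (3 ,
    blue) ∷ []) ((1 , 3) ∷ [])) 2 2 (play 0 3 stop stop (goto 15 (1 ∷ 2 ∷ []) false)) ∷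
  entry (state 5 ((2 , 3) ∷ (0 , 0) ∷ (1 , 1) ∷ (4 , 4) ∷ []) ((0 , red) ∷ (1 , red) ∷ (1 , blue) ∷
    (3 , blue) ∷ (4 , red) ∷ (4 , blue) ∷ []) ((0 , 1) ∷ (1 , 3) ∷ [])) 5 5 (play 0 4 stop stop
    (goto 0 (1 ∷ 2 ∷ 3 ∷ 0 ∷ 4 ∷ []) true)) ∷
  entry (state 5 ((1 , 2) ∷ (3 , 4) ∷ (0 , 0) ∷ []) ((0 , red) ∷ (0 , blue) ∷ (2 , red) ∷ (3 , blue)
    ∷ (4 , red) ∷ (4 , blue) ∷ []) ((0 , 2) ∷ (0 , 3) ∷ (3 , 4) ∷ [])) 4 4 (play 2 3 stop stop (goto
    51 (1 ∷ 4 ∷ 0 ∷ []) false)) ∷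
  entry (state 3 ((1 , 2) ∷ (0 , 0) ∷ []) ((0 , red) ∷ []) []) 8 13 (play 0 1 stop (play 0 2 stop
    stop (play 1 3 (goto 18 (3 ∷ 1 ∷ 0 ∷ []) false) stop (goto 0 (3 ∷ 0 ∷ []) false))) (goto 1 (2 ∷
    0 ∷ []) false)) ∷
  entry (state 2 ((0 , 1) ∷ []) ((1 , red) ∷ (1 , blue) ∷ []) []) 6 10 (play 0 2 (goto 33 (0 ∷ 1 ∷
    []) false) (goto 33 (0 ∷ 1 ∷ []) true) (goto 34 (2 ∷ 1 ∷ []) false)) ∷
  entry (state 2 ((0 , 1) ∷ []) ((1 , red) ∷ []) []) 7 12 (play 0 2 (play 2 3 stop (play 3 0 stop
    stop (goto 49 (2 ∷ 1 ∷ 3 ∷ []) true)) (goto 29 (3 ∷ 2 ∷ 1 ∷ 0 ∷ []) false)) (goto 2 (1 ∷ 0 ∷ [])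
    false) (play 2 3 (goto 15 (1 ∷ 2 ∷ []) false) (goto 6 (3 ∷ 2 ∷ 1 ∷ []) true) (goto 52 (3 ∷ 1 ∷
    []) false))) ∷
  entry (state 2 ((0 , 1) ∷ []) [] []) 9 15 (play 0 2 (goto 0 (2 ∷ 1 ∷ 0 ∷ []) false) (goto 0 (2 ∷ 1
    ∷ 0 ∷ []) true) (goto 22 (1 ∷ 2 ∷ []) false)) ∷
  entry (state 3 ((1 , 2) ∷ (0 , 0) ∷ []) ((0 , red) ∷ (2 , red) ∷ []) ((0 , 2) ∷ [])) 9 14 (play 1
    3 (play 0 1 stop (play 2 4 stop (play 3 0 stop stop (play 0 5 stop stop (play 5 2 stop stop
    (goto 15 (4 ∷ 3 ∷ 1 ∷ []) true)))) (play 0 4 stop stop (goto 14 (3 ∷ 1 ∷ 0 ∷ []) false))) (play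
    3 4 stop (play 3 0 stop stop (goto 29 (4 ∷ 2 ∷ 3 ∷ []) true)) (play 4 0 stop (play 4 2 stop stop
    (goto 30 (3 ∷ 0 ∷ []) false)) (goto 13 (3 ∷ 2 ∷ []) false)))) (play 0 3 stop stop (play 2 3 stop
    stop (goto 0 (0 ∷ 1 ∷ []) false))) (goto 22 (3 ∷ 2 ∷ []) false)) ∷
  entry (state 2 ((0 , 1) ∷ []) ((0 , red) ∷ (1 , blue) ∷ []) []) 7 11 (play 2 3 (goto 2 (3 ∷ 2 ∷ 0
    ∷ 1 ∷ []) false) (goto 2 (3 ∷ 2 ∷ 1 ∷ 0 ∷ []) true) (goto 0 (2 ∷ 3 ∷ 0 ∷ 1 ∷ []) false)) ∷
  entry (state 4 ((0 , 1) ∷ (2 , 3) ∷ []) ((2 , red) ∷ (3 , blue) ∷ []) ((0 , 1) ∷ [])) 6 10 (play 0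
    2 stop (goto 0 (1 ∷ 0 ∷ 3 ∷ 2 ∷ []) true) (goto 48 (1 ∷ 3 ∷ []) true)) ∷
  entry (state 4 ((0 , 1) ∷ (2 , 3) ∷ []) ((1 , red) ∷ (2 , red) ∷ (3 , red) ∷ (3 , blue) ∷ []) ((0
    , 1) ∷ (1 , 3) ∷ [])) 6 9 (play 1 4 stop (goto 9 (4 ∷ 0 ∷ 1 ∷ 2 ∷ 3 ∷ []) true) (play 0 2 stop
    (play 3 5 stop stop (goto 35 (4 ∷ 0 ∷ 5 ∷ 2 ∷ []) true)) (goto 61 (4 ∷ 3 ∷ []) false))) ∷
  entry (state 4 ((2 , 3) ∷ (0 , 0) ∷ (1 , 1) ∷ []) ((0 , red) ∷ (1 , red) ∷ (2 , red) ∷ (3 , blue)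
    ∷ []) ((0 , 1) ∷ [])) 7 10 (play 0 2 stop (play 0 4 stop stop (goto 8 (1 ∷ 4 ∷ 0 ∷ 3 ∷ 2 ∷ [])
    false)) (goto 0 (1 ∷ 0 ∷ 3 ∷ []) false)) ∷
  entry (state 3 ((1 , 2) ∷ (0 , 0) ∷ []) ((0 , red) ∷ (1 , red) ∷ (2 , blue) ∷ []) ((0 , 1) ∷ []))
    6 9 (play 0 3 stop (goto 6 (3 ∷ 0 ∷ 2 ∷ 1 ∷ []) true) (play 1 4 stop (play 0 2 stop stop (goto
    54 (4 ∷ 3 ∷ 1 ∷ []) true)) (goto 0 (3 ∷ 0 ∷ 4 ∷ 2 ∷ []) false))) ∷
  entry (state 4 ((0 , 1) ∷ (2 , 3) ∷ []) ((1 , red) ∷ (3 , blue) ∷ []) ((0 , 1) ∷ [])) 4 7 (play 0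
    4 (play 4 2 stop (play 0 2 stop stop (goto 12 (3 ∷ 1 ∷ 4 ∷ []) false)) (play 4 5 stop (play 3 0
    stop stop (goto 73 (1 ∷ 4 ∷ []) false)) (goto 3 (5 ∷ 3 ∷ 0 ∷ 1 ∷ []) true))) (play 4 2 (play 2 0
    stop stop (goto 12 (3 ∷ 1 ∷ 4 ∷ []) false)) stop (play 0 5 (play 1 4 stop stop (goto 73 (3 ∷ 0 ∷
    []) true)) stop (goto 1 (5 ∷ 1 ∷ 4 ∷ 3 ∷ []) false))) (play 4 2 (goto 0 (1 ∷ 4 ∷ 2 ∷ 3 ∷ [])
    false) (goto 0 (3 ∷ 2 ∷ 4 ∷ 1 ∷ []) true) (goto 71 (1 ∷ 3 ∷ []) false))) ∷
  entry (state 4 ((0 , 1) ∷ (2 , 3) ∷ []) ((0 , red) ∷ (1 , red) ∷ (2 , red) ∷ (3 , blue) ∷ []) ((1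
    , 2) ∷ [])) 3 5 (play 2 4 stop (play 3 0 stop stop (goto 72 (1 ∷ 2 ∷ []) false)) (goto 0 (4 ∷ 3
    ∷ 0 ∷ 1 ∷ []) true)) ∷
  entry (state 4 ((0 , 1) ∷ (2 , 3) ∷ []) ((1 , red) ∷ (2 , blue) ∷ (3 , blue) ∷ []) ((0 , 1) ∷ []))
    2 3 (play 0 2 (play 0 3 stop stop (goto 0 (1 ∷ 2 ∷ []) false)) stop (goto 2 (1 ∷ 3 ∷ []) false))
    ∷
  entry (state 2 ((0 , 1) ∷ []) ((0 , red) ∷ (1 , red) ∷ (1 , blue) ∷ []) []) 1 1 (close 0 1 stop
    stop) ∷
  entry (state 4 ((0 , 1) ∷ (2 , 3) ∷ []) ((1 , red) ∷ (2 , blue) ∷ (3 , blue) ∷ []) ((0 , 1) ∷ (2 ,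
    3) ∷ [])) 2 4 (play 0 2 (play 1 2 stop stop (goto 0 (0 ∷ 3 ∷ []) false)) stop (goto 0 (1 ∷ 3 ∷
    []) false)) ∷
  entry (state 2 ((0 , 1) ∷ []) ((0 , red) ∷ (1 , blue) ∷ []) []) 1 2 (close 0 1 stop stop) ∷
  entry (state 4 ((2 , 3) ∷ (0 , 0) ∷ (1 , 1) ∷ []) ((0 , red) ∷ (1 , red) ∷ (1 , blue) ∷ (3 , blue)
    ∷ []) ((0 , 1) ∷ (1 , 3) ∷ [])) 6 8 (play 0 4 stop (play 0 3 stop stop (play 1 2 stop stop (goto
    54 (4 ∷ 0 ∷ 1 ∷ []) true))) (play 1 4 stop stop (goto 5 (2 ∷ 3 ∷ 0 ∷ 1 ∷ []) true))) ∷
  entry (state 5 ((1 , 2) ∷ (3 , 4) ∷ (0 , 0) ∷ []) ((0 , red) ∷ (2 , red) ∷ (2 , blue) ∷ (3 , blue)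
    ∷ (4 , red) ∷ (4 , blue) ∷ []) ((0 , 2) ∷ (1 , 2) ∷ (2 , 4) ∷ [])) 6 8 (play 1 4 stop stop (goto
    20 (0 ∷ 3 ∷ 2 ∷ []) false)) ∷
  entry (state 2 ((0 , 1) ∷ []) ((0 , red) ∷ (1 , red) ∷ []) []) 6 10 (play 0 2 stop (goto 16 (1 ∷ 0
    ∷ []) false) (goto 36 (2 ∷ 1 ∷ []) false)) ∷
  entry (state 3 ((1 , 2) ∷ (0 , 0) ∷ []) ((0 , red) ∷ (1 , red) ∷ (1 , blue) ∷ (2 , red) ∷ (2 ,
    blue) ∷ []) ((0 , 1) ∷ (1 , 2) ∷ [])) 7 10 (play 0 2 stop stop (goto 15 (0 ∷ 1 ∷ []) false)) ∷
  entry (state 3 ((1 , 2) ∷ (0 , 0) ∷ []) ((0 , red) ∷ (1 , blue) ∷ (2 , red) ∷ (2 , blue) ∷ []) ((0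
    , 2) ∷ (1 , 2) ∷ [])) 6 8 (play 3 4 (play 4 1 stop stop (play 3 5 stop (play 0 3 stop stop (goto
    4 (5 ∷ 4 ∷ 2 ∷ 0 ∷ 3 ∷ []) true)) (play 0 5 stop (play 5 4 stop stop (goto 3 (0 ∷ 3 ∷ 2 ∷ [])
    false)) (goto 38 (3 ∷ 0 ∷ 4 ∷ 2 ∷ []) false)))) (play 4 0 stop stop (play 4 5 (play 5 1 stop
    stop (goto 4 (3 ∷ 5 ∷ 2 ∷ 0 ∷ 4 ∷ []) true)) stop (play 3 5 (play 5 1 stop stop (goto 3 (3 ∷ 0 ∷
    2 ∷ []) false)) stop (play 0 1 stop stop (goto 63 (3 ∷ 2 ∷ []) true))))) (goto 0 (0 ∷ 3 ∷ 4 ∷ 1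
    ∷ 2 ∷ []) false)) ∷
  entry (state 5 ((1 , 2) ∷ (3 , 4) ∷ (0 , 0) ∷ []) ((0 , red) ∷ (3 , blue) ∷ (4 , red) ∷ (4 , blue)
    ∷ []) ((0 , 4) ∷ (1 , 2) ∷ (3 , 4) ∷ [])) 5 7 (play 0 1 stop (play 2 4 stop stop (play 1 5 (play
    5 3 stop stop (goto 2 (0 ∷ 5 ∷ 1 ∷ []) false)) stop (goto 1 (5 ∷ 3 ∷ 0 ∷ []) true))) (goto 0 (2
    ∷ 0 ∷ 3 ∷ 4 ∷ []) false)) ∷
  entry (state 4 ((0 , 1) ∷ (2 , 3) ∷ []) ((1 , red) ∷ (2 , blue) ∷ (3 , red) ∷ (3 , blue) ∷ []) ((1
    , 3) ∷ (2 , 3) ∷ [])) 4 6 (play 2 4 (play 0 2 stop stop (play 4 1 stop (play 4 3 stop stop (goto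
    62 (4 ∷ 1 ∷ []) false)) (goto 61 (4 ∷ 3 ∷ []) false))) stop (goto 21 (0 ∷ 1 ∷ 4 ∷ 3 ∷ [])
    false)) ∷
  entry (state 3 ((0 , 1) ∷ (2 , 2) ∷ []) ((1 , red) ∷ (2 , red) ∷ (2 , blue) ∷ []) []) 3 4 (play 0
    2 stop stop (goto 60 (1 ∷ 2 ∷ []) false)) ∷
  entry (state 3 ((1 , 2) ∷ (0 , 0) ∷ []) ((0 , red) ∷ (0 , blue) ∷ (1 , red) ∷ (2 , red) ∷ (2 ,
    blue) ∷ []) ((0 , 2) ∷ (1 , 2) ∷ [])) 3 3 (play 0 1 stop stop (goto 60 (0 ∷ 2 ∷ []) false)) ∷
  entry (state 5 ((1 , 2) ∷ (3 , 4) ∷ (0 , 0) ∷ []) ((0 , red) ∷ (1 , blue) ∷ (2 , red) ∷ (2 , blue)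
    ∷ (3 , blue) ∷ (4 , red) ∷ (4 , blue) ∷ []) ((0 , 4) ∷ (1 , 4) ∷ (2 , 3) ∷ (3 , 4) ∷ [])) 4 4
    (play 0 3 stop stop (goto 19 (0 ∷ 4 ∷ 1 ∷ 2 ∷ []) false)) ∷
  entry (state 2 ((0 , 1) ∷ []) [] []) 8 14 (play 0 2 (goto 0 (1 ∷ 0 ∷ []) false) (goto 0 (1 ∷ 0 ∷
    []) true) (goto 13 (1 ∷ 2 ∷ []) false)) ∷
  entry (state 2 ((0 , 1) ∷ []) ((1 , red) ∷ []) []) 8 13 (play 2 3 (play 3 4 stop (goto 5 (2 ∷ 4 ∷
    3 ∷ 0 ∷ 1 ∷ []) false) (goto 3 (2 ∷ 0 ∷ 1 ∷ 4 ∷ 3 ∷ []) false)) (play 3 4 (goto 5 (4 ∷ 2 ∷ 3 ∷ 0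
    ∷ 1 ∷ []) false) stop (goto 1 (2 ∷ 4 ∷ 3 ∷ 0 ∷ 1 ∷ []) true)) (goto 0 (2 ∷ 3 ∷ 0 ∷ 1 ∷ [])
    false)) ∷
  entry (state 4 ((0 , 1) ∷ (2 , 3) ∷ []) ((3 , red) ∷ []) ((0 , 1) ∷ [])) 7 12 (play 0 4 (goto 2 (4
    ∷ 2 ∷ 3 ∷ 1 ∷ 0 ∷ []) false) (goto 0 (4 ∷ 1 ∷ 0 ∷ 2 ∷ 3 ∷ []) true) (play 1 2 (goto 3 (4 ∷ 1 ∷ 3
    ∷ 2 ∷ []) false) (goto 1 (4 ∷ 1 ∷ 2 ∷ 3 ∷ []) true) (goto 26 (4 ∷ 3 ∷ []) false))) ∷
  entry (state 5 ((1 , 2) ∷ (3 , 4) ∷ (0 , 0) ∷ []) ((0 , red) ∷ (2 , red) ∷ (4 , blue) ∷ []) ((0 ,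
    2) ∷ (1 , 2) ∷ [])) 7 11 (play 0 3 stop (play 2 4 stop stop (goto 22 (0 ∷ 1 ∷ 3 ∷ []) true))
    (goto 0 (1 ∷ 2 ∷ 0 ∷ 4 ∷ []) false)) ∷
  entry (state 4 ((0 , 1) ∷ (2 , 3) ∷ []) ((1 , red) ∷ (2 , red) ∷ (3 , blue) ∷ []) ((0 , 1) ∷ (1 ,
    2) ∷ [])) 6 10 (play 1 3 stop stop (goto 24 (0 ∷ 2 ∷ []) false)) ∷
  entry (state 5 ((1 , 2) ∷ (3 , 4) ∷ (0 , 0) ∷ []) ((0 , red) ∷ (2 , red) ∷ (4 , red) ∷ []) ((0 ,
    4) ∷ (3 , 4) ∷ [])) 7 11 (play 0 1 stop (play 4 1 stop stop (goto 20 (0 ∷ 3 ∷ 2 ∷ []) false))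
    (goto 0 (3 ∷ 4 ∷ 2 ∷ 0 ∷ []) false)) ∷
  entry (state 4 ((0 , 1) ∷ (2 , 3) ∷ []) ((1 , red) ∷ (2 , red) ∷ (3 , red) ∷ []) ((0 , 1) ∷ (1 ,
    3) ∷ [])) 6 10 (play 0 3 stop (play 0 2 stop stop (goto 20 (1 ∷ 3 ∷ []) false)) (goto 22 (1 ∷ 2
    ∷ []) false)) ∷
  entry (state 5 ((3 , 4) ∷ (0 , 0) ∷ (1 , 1) ∷ (2 , 2) ∷ []) ((0 , red) ∷ (1 , blue) ∷ (2 , red) ∷
    (2 , blue) ∷ (4 , red) ∷ []) ((0 , 2) ∷ (1 , 2) ∷ [])) 8 11 (play 2 3 stop stop (goto 0 (1 ∷ 4 ∷
    2 ∷ []) true)) ∷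
  entry (state 3 ((1 , 2) ∷ (0 , 0) ∷ []) ((0 , red) ∷ (1 , blue) ∷ (2 , red) ∷ (2 , blue) ∷ []) ((0
    , 2) ∷ [])) 7 10 (play 0 1 stop stop (goto 0 (0 ∷ 2 ∷ []) false)) ∷
  entry (state 2 ((0 , 1) ∷ []) ((0 , red) ∷ (1 , red) ∷ (1 , blue) ∷ []) ((0 , 1) ∷ [])) 6 9 (play
    0 2 stop (play 1 3 stop stop (goto 2 (2 ∷ 3 ∷ 0 ∷ []) true)) (goto 0 (2 ∷ 1 ∷ []) false)) ∷
  entry (state 2 ((0 , 1) ∷ []) ((1 , red) ∷ (1 , blue) ∷ []) []) 5 8 (play 0 2 (goto 0 (2 ∷ 0 ∷ 1 ∷
    []) false) (goto 0 (2 ∷ 0 ∷ 1 ∷ []) true) (goto 32 (2 ∷ 1 ∷ []) false)) ∷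
  entry (state 3 ((1 , 2) ∷ (0 , 0) ∷ []) ((0 , red) ∷ (1 , red) ∷ (2 , red) ∷ (2 , blue) ∷ []) ((0
    , 1) ∷ [])) 5 7 (play 0 3 stop (play 2 4 stop stop (goto 27 (3 ∷ 0 ∷ 4 ∷ 1 ∷ []) true)) (play 0
    4 stop (play 3 2 stop stop (goto 40 (4 ∷ 1 ∷ 0 ∷ []) true)) (play 3 1 stop (goto 34 (4 ∷ 3 ∷ 1 ∷
    2 ∷ []) true) (goto 43 (4 ∷ 2 ∷ []) false)))) ∷
  entry (state 3 ((1 , 2) ∷ (0 , 0) ∷ []) ((0 , red) ∷ (2 , red) ∷ (2 , blue) ∷ []) ((0 , 2) ∷ []))
    5 7 (play 0 3 stop (goto 0 (3 ∷ 0 ∷ 1 ∷ 2 ∷ []) true) (goto 4 (3 ∷ 0 ∷ 1 ∷ 2 ∷ []) false)) ∷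
  entry (state 4 ((2 , 3) ∷ (0 , 0) ∷ (1 , 1) ∷ []) ((0 , red) ∷ (1 , red) ∷ (1 , blue) ∷ (3 , red)
    ∷ (3 , blue) ∷ []) ((0 , 1) ∷ (1 , 3) ∷ [])) 5 6 (play 1 2 stop stop (goto 31 (0 ∷ 1 ∷ 3 ∷ [])
    false)) ∷
  entry (state 2 ((0 , 1) ∷ []) [] []) 7 13 (play 0 2 (goto 0 (2 ∷ 1 ∷ 0 ∷ []) false) (goto 0 (2 ∷ 1
    ∷ 0 ∷ []) true) (goto 6 (1 ∷ 2 ∷ []) false)) ∷
  entry (state 3 ((1 , 2) ∷ (0 , 0) ∷ []) ((0 , red) ∷ (2 , red) ∷ []) ((0 , 2) ∷ [])) 7 12 (play 0
    3 stop (play 3 2 stop stop (goto 10 (0 ∷ 1 ∷ 3 ∷ []) true)) (play 1 0 stop (play 3 4 (goto 4 (4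
    ∷ 2 ∷ 1 ∷ 3 ∷ 0 ∷ []) false) (goto 4 (4 ∷ 1 ∷ 2 ∷ 3 ∷ 0 ∷ []) true) (goto 0 (4 ∷ 0 ∷ 2 ∷ 1 ∷ [])
    false)) (goto 13 (3 ∷ 2 ∷ []) false))) ∷
  entry (state 4 ((0 , 1) ∷ (2 , 3) ∷ []) ((1 , red) ∷ (1 , blue) ∷ (2 , red) ∷ (3 , blue) ∷ []) ((1
    , 2) ∷ (1 , 3) ∷ (2 , 3) ∷ [])) 5 7 (play 2 4 stop (goto 6 (4 ∷ 0 ∷ 1 ∷ 3 ∷ 2 ∷ []) true) (goto
    0 (4 ∷ 3 ∷ 0 ∷ 1 ∷ []) true)) ∷
  entry (state 4 ((0 , 1) ∷ (2 , 3) ∷ []) ((1 , red) ∷ (3 , red) ∷ (3 , blue) ∷ []) ((0 , 1) ∷ (1 ,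
    3) ∷ [])) 4 6 (play 0 4 (play 4 2 stop (play 4 1 stop stop (goto 1 (0 ∷ 4 ∷ 2 ∷ 3 ∷ []) false))
    (goto 15 (0 ∷ 1 ∷ 4 ∷ 3 ∷ []) false)) (play 4 1 stop stop (play 2 4 (goto 1 (0 ∷ 4 ∷ 2 ∷ 3 ∷ [])
    true) stop (goto 40 (0 ∷ 3 ∷ []) true))) (goto 0 (4 ∷ 1 ∷ 2 ∷ 3 ∷ []) false)) ∷
  entry (state 4 ((0 , 1) ∷ (2 , 3) ∷ []) ((1 , red) ∷ (3 , red) ∷ (3 , blue) ∷ []) ((1 , 3) ∷ []))
    3 5 (play 1 2 stop (play 0 3 stop stop (goto 39 (2 ∷ 1 ∷ []) true)) (goto 36 (0 ∷ 3 ∷ [])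
    false)) ∷
  entry (state 4 ((0 , 1) ∷ (2 , 3) ∷ []) ((0 , red) ∷ (1 , red) ∷ (1 , blue) ∷ (2 , blue) ∷ (3 ,
    red) ∷ (3 , blue) ∷ []) ((0 , 1) ∷ (1 , 2) ∷ [])) 3 3 (play 0 2 stop stop (goto 39 (1 ∷ 3 ∷ [])
    false)) ∷
  entry (state 5 ((1 , 2) ∷ (3 , 4) ∷ (0 , 0) ∷ []) ((0 , red) ∷ (1 , red) ∷ (2 , blue) ∷ (3 , red)
    ∷ (4 , red) ∷ (4 , blue) ∷ []) ((0 , 3) ∷ (1 , 4) ∷ (2 , 4) ∷ (3 , 4) ∷ [])) 6 9 (play 2 3 stop
    stop (goto 6 (1 ∷ 4 ∷ []) false)) ∷
  entry (state 2 ((0 , 1) ∷ []) [] []) 6 12 (play 0 2 (goto 0 (2 ∷ 1 ∷ 0 ∷ []) false) (goto 0 (2 ∷ 1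
    ∷ 0 ∷ []) true) (goto 6 (1 ∷ 2 ∷ []) false)) ∷
  entry (state 3 ((1 , 2) ∷ (0 , 0) ∷ []) ((0 , red) ∷ (2 , red) ∷ []) ((0 , 2) ∷ [])) 6 11 (play 0
    3 stop (goto 3 (0 ∷ 1 ∷ 2 ∷ []) false) (play 0 4 stop (play 2 3 stop (goto 0 (4 ∷ 1 ∷ 2 ∷ 3 ∷ 0
    ∷ []) true) (goto 20 (1 ∷ 0 ∷ []) false)) (goto 7 (3 ∷ 4 ∷ 1 ∷ 2 ∷ []) false))) ∷
  entry (state 5 ((1 , 2) ∷ (3 , 4) ∷ (0 , 0) ∷ []) ((0 , red) ∷ (2 , red) ∷ (2 , blue) ∷ (3 , red)
    ∷ (4 , red) ∷ (4 , blue) ∷ []) ((0 , 4) ∷ (2 , 3) ∷ (2 , 4) ∷ (3 , 4) ∷ [])) 5 6 (play 0 1 stop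
    (play 4 5 stop stop (play 3 1 stop stop (goto 1 (5 ∷ 2 ∷ 0 ∷ []) false))) (goto 0 (0 ∷ 2 ∷ 3 ∷ 4
    ∷ []) false)) ∷
  entry (state 4 ((0 , 1) ∷ (2 , 3) ∷ []) ((0 , red) ∷ (1 , red) ∷ (1 , blue) ∷ (2 , red) ∷ (3 ,
    red) ∷ (3 , blue) ∷ []) ((0 , 3) ∷ (1 , 2) ∷ (1 , 3) ∷ (2 , 3) ∷ [])) 4 5 (play 0 4 stop (play 4
    2 stop stop (goto 9 (4 ∷ 3 ∷ 0 ∷ 1 ∷ []) true)) (play 4 3 stop stop (goto 33 (2 ∷ 1 ∷ [])
    false))) ∷
  entry (state 3 ((0 , 1) ∷ (2 , 2) ∷ []) ((1 , red) ∷ (1 , blue) ∷ (2 , red) ∷ (2 , blue) ∷ []) [])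
    3 3 (play 0 2 stop stop (goto 33 (1 ∷ 2 ∷ []) false)) ∷
  entry (state 3 ((1 , 2) ∷ (0 , 0) ∷ []) ((0 , red) ∷ (0 , blue) ∷ (2 , red) ∷ []) ((0 , 2) ∷ []))
    6 9 (play 0 1 stop stop (goto 0 (2 ∷ 0 ∷ []) false)) ∷
  entry (state 2 ((0 , 1) ∷ []) ((0 , red) ∷ (1 , red) ∷ (1 , blue) ∷ []) ((0 , 1) ∷ [])) 5 8 (play
    0 2 stop (play 1 3 stop stop (goto 10 (2 ∷ 3 ∷ 0 ∷ []) true)) (goto 15 (2 ∷ 1 ∷ []) false)) ∷
  entry (state 2 ((0 , 1) ∷ []) [] []) 5 11 (play 0 2 (goto 0 (1 ∷ 0 ∷ []) false) (goto 0 (1 ∷ 0 ∷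
    []) true) (goto 11 (1 ∷ 2 ∷ []) false)) ∷
  entry (state 2 ((0 , 1) ∷ []) ((1 , red) ∷ []) []) 5 9 (play 2 3 (play 3 4 stop (goto 7 (2 ∷ 4 ∷ 3
    ∷ 0 ∷ 1 ∷ []) false) (goto 5 (2 ∷ 0 ∷ 1 ∷ 4 ∷ 3 ∷ []) false)) (play 3 4 (goto 7 (4 ∷ 2 ∷ 3 ∷ 0 ∷
    1 ∷ []) false) stop (goto 1 (2 ∷ 4 ∷ 3 ∷ 0 ∷ 1 ∷ []) true)) (goto 0 (2 ∷ 3 ∷ 0 ∷ 1 ∷ []) false))
    ∷
  entry (state 4 ((0 , 1) ∷ (2 , 3) ∷ []) ((3 , red) ∷ []) ((0 , 1) ∷ [])) 4 8 (play 0 4 (goto 4 (4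
    ∷ 2 ∷ 3 ∷ 1 ∷ 0 ∷ []) false) (goto 0 (4 ∷ 1 ∷ 0 ∷ 2 ∷ 3 ∷ []) true) (play 1 2 (goto 5 (4 ∷ 1 ∷ 3
    ∷ 2 ∷ []) false) (goto 1 (4 ∷ 1 ∷ 2 ∷ 3 ∷ []) true) (goto 23 (4 ∷ 3 ∷ []) false))) ∷
  entry (state 5 ((1 , 2) ∷ (3 , 4) ∷ (0 , 0) ∷ []) ((0 , red) ∷ (2 , red) ∷ (4 , blue) ∷ []) ((0 ,
    2) ∷ (1 , 2) ∷ [])) 4 7 (play 0 3 stop (play 2 4 stop stop (goto 10 (0 ∷ 1 ∷ 3 ∷ []) true))
    (goto 0 (1 ∷ 2 ∷ 0 ∷ 4 ∷ []) false)) ∷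
  entry (state 4 ((0 , 1) ∷ (2 , 3) ∷ []) ((1 , red) ∷ (2 , red) ∷ (3 , blue) ∷ []) ((0 , 1) ∷ (1 ,
    2) ∷ [])) 3 6 (play 0 3 (goto 0 (1 ∷ 0 ∷ 2 ∷ 3 ∷ []) false) stop (goto 16 (1 ∷ 2 ∷ []) false)) ∷
  entry (state 4 ((0 , 1) ∷ (2 , 3) ∷ []) ((0 , red) ∷ (1 , red) ∷ (2 , red) ∷ (3 , red) ∷ (3 ,
    blue) ∷ []) ((0 , 1) ∷ (0 , 2) ∷ (1 , 3) ∷ [])) 3 4 (play 1 2 stop (goto 0 (0 ∷ 1 ∷ 2 ∷ 3 ∷ [])
    false) (goto 24 (0 ∷ 3 ∷ []) false)) ∷
  entry (state 4 ((0 , 1) ∷ (2 , 3) ∷ []) ((0 , red) ∷ (1 , red) ∷ (1 , blue) ∷ (2 , red) ∷ (2 ,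
    blue) ∷ (3 , red) ∷ (3 , blue) ∷ []) ((0 , 1) ∷ (0 , 2) ∷ (1 , 2) ∷ (1 , 3) ∷ [])) 3 3 (play 0 3
    stop stop (goto 24 (1 ∷ 2 ∷ []) false)) ∷
  entry (state 5 ((1 , 2) ∷ (3 , 4) ∷ (0 , 0) ∷ []) ((0 , red) ∷ (2 , red) ∷ (4 , red) ∷ []) ((0 ,
    4) ∷ (3 , 4) ∷ [])) 4 7 (play 0 1 stop (play 0 3 stop stop (play 1 4 stop stop (goto 22 (2 ∷ 0 ∷
    []) false))) (goto 0 (3 ∷ 4 ∷ 2 ∷ 0 ∷ []) false)) ∷
  entry (state 4 ((0 , 1) ∷ (2 , 3) ∷ []) ((1 , red) ∷ (2 , red) ∷ (3 , red) ∷ []) ((0 , 1) ∷ (1 ,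
    3) ∷ [])) 3 6 (play 0 3 stop (play 0 2 stop stop (goto 21 (1 ∷ 3 ∷ []) false)) (goto 20 (1 ∷ 2 ∷
    []) false)) ∷
  entry (state 5 ((3 , 4) ∷ (0 , 0) ∷ (1 , 1) ∷ (2 , 2) ∷ []) ((0 , red) ∷ (1 , blue) ∷ (2 , red) ∷
    (2 , blue) ∷ (4 , red) ∷ []) ((0 , 2) ∷ (1 , 2) ∷ [])) 5 7 (play 2 4 stop stop (goto 0 (0 ∷ 3 ∷
    2 ∷ []) false)) ∷
  entry (state 3 ((1 , 2) ∷ (0 , 0) ∷ []) ((0 , red) ∷ (2 , red) ∷ (2 , blue) ∷ []) ((0 , 2) ∷ []))
    4 6 (play 0 3 stop (goto 0 (3 ∷ 0 ∷ 1 ∷ 2 ∷ []) true) (play 0 1 stop (play 3 2 stop stop (goto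
    19 (1 ∷ 0 ∷ []) true)) (goto 16 (3 ∷ 2 ∷ []) false))) ∷
  entry (state 4 ((2 , 3) ∷ (0 , 0) ∷ (1 , 1) ∷ []) ((0 , red) ∷ (1 , red) ∷ (1 , blue) ∷ (3 , blue)
    ∷ []) ((0 , 1) ∷ (1 , 3) ∷ [])) 4 5 (play 1 2 stop stop (goto 12 (0 ∷ 3 ∷ 1 ∷ []) false)) ∷
  entry (state 2 ((0 , 1) ∷ []) [] []) 4 10 (play 0 2 (goto 0 (2 ∷ 1 ∷ 0 ∷ []) false) (goto 0 (2 ∷ 1
    ∷ 0 ∷ []) true) (goto 6 (1 ∷ 2 ∷ []) false)) ∷
  entry (state 3 ((1 , 2) ∷ (0 , 0) ∷ []) ((0 , red) ∷ (2 , red) ∷ []) ((0 , 2) ∷ [])) 4 9 (play 0 1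
    stop (play 2 3 stop (goto 1 (1 ∷ 2 ∷ []) false) (goto 0 (0 ∷ 3 ∷ 1 ∷ []) true)) (play 0 3 stop
    (goto 10 (3 ∷ 2 ∷ 0 ∷ []) true) (goto 12 (3 ∷ 2 ∷ []) false))) ∷
  entry (state 3 ((1 , 2) ∷ (0 , 0) ∷ []) ((0 , red) ∷ (0 , blue) ∷ (2 , red) ∷ []) ((0 , 2) ∷ []))
    3 5 (play 0 1 stop stop (goto 15 (2 ∷ 0 ∷ []) false)) ∷
  entry (state 2 ((0 , 1) ∷ []) ((1 , red) ∷ (1 , blue) ∷ []) []) 4 7 (play 0 2 (goto 0 (2 ∷ 0 ∷ 1 ∷
    []) false) (goto 0 (2 ∷ 0 ∷ 1 ∷ []) true) (goto 6 (2 ∷ 1 ∷ []) false)) ∷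
  entry (state 3 ((1 , 2) ∷ (0 , 0) ∷ []) ((0 , red) ∷ (1 , red) ∷ (2 , red) ∷ (2 , blue) ∷ []) ((0
    , 1) ∷ [])) 4 6 (play 1 3 stop (goto 0 (0 ∷ 1 ∷ 2 ∷ []) false) (play 0 3 stop (play 0 2 stop
    stop (goto 13 (3 ∷ 0 ∷ []) true)) (goto 13 (0 ∷ 2 ∷ []) false))) ∷
  entry (state 3 ((1 , 2) ∷ (0 , 0) ∷ []) ((0 , red) ∷ (1 , red) ∷ (1 , blue) ∷ (2 , red) ∷ (2 ,
    blue) ∷ []) ((0 , 1) ∷ (1 , 2) ∷ [])) 4 5 (play 0 3 stop (play 0 4 stop stop (play 4 2 stop stop
    (probe 0 1 stop stop stop stop))) (goto 0 (3 ∷ 0 ∷ 1 ∷ 2 ∷ []) false)) ∷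
  entry (state 4 ((0 , 1) ∷ (2 , 3) ∷ []) ((1 , red) ∷ (2 , red) ∷ (2 , blue) ∷ (3 , red) ∷ (3 ,
    blue) ∷ []) ((0 , 1) ∷ (1 , 2) ∷ (2 , 3) ∷ [])) 3 4 (play 0 3 stop stop (goto 11 (1 ∷ 2 ∷ [])
    false)) ∷
  entry (state 2 ((0 , 1) ∷ []) [] []) 3 9 (play 0 2 (goto 0 (2 ∷ 1 ∷ 0 ∷ []) false) (goto 0 (2 ∷ 1
    ∷ 0 ∷ []) true) (goto 5 (1 ∷ 2 ∷ []) false)) ∷
  entry (state 3 ((1 , 2) ∷ (0 , 0) ∷ []) ((0 , red) ∷ (2 , red) ∷ []) ((0 , 2) ∷ [])) 3 8 (play 0 1
    stop (play 2 3 stop (goto 1 (1 ∷ 2 ∷ []) false) (goto 5 (3 ∷ 1 ∷ []) true)) (goto 0 (0 ∷ 2 ∷ [])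
    false)) ∷
  entry (state 2 ((0 , 1) ∷ []) ((0 , red) ∷ (1 , red) ∷ []) ((0 , 1) ∷ [])) 2 5 (probe 0 1 stop
    (goto 8 (1 ∷ 0 ∷ []) false) stop (goto 8 (0 ∷ 1 ∷ []) false)) ∷
  entry (state 2 ((0 , 1) ∷ []) ((1 , red) ∷ (1 , blue) ∷ []) []) 3 6 (play 0 2 (goto 0 (2 ∷ 0 ∷ 1 ∷
    []) false) (goto 0 (2 ∷ 0 ∷ 1 ∷ []) true) (goto 4 (2 ∷ 1 ∷ []) false)) ∷
  entry (state 3 ((1 , 2) ∷ (0 , 0) ∷ []) ((0 , red) ∷ (1 , red) ∷ (2 , red) ∷ (2 , blue) ∷ []) ((0
    , 1) ∷ [])) 3 5 (play 1 3 stop (goto 0 (0 ∷ 2 ∷ 1 ∷ []) false) (goto 3 (3 ∷ 2 ∷ []) false)) ∷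
  entry (state 3 ((1 , 2) ∷ (0 , 0) ∷ []) ((0 , red) ∷ (1 , blue) ∷ (2 , red) ∷ (2 , blue) ∷ []) ((0
    , 2) ∷ (1 , 2) ∷ [])) 3 4 (play 0 1 stop stop (goto 5 (0 ∷ 2 ∷ []) false)) ∷
  entry (state 2 ((0 , 1) ∷ []) [] []) 2 8 (probe 0 1 (goto 0 (1 ∷ 0 ∷ []) false) (goto 0 (1 ∷ 0 ∷
    []) true) (goto 0 (0 ∷ 1 ∷ []) false) (goto 0 (0 ∷ 1 ∷ []) true)) ∷
  entry (state 2 ((0 , 1) ∷ []) ((1 , red) ∷ []) []) 2 6 (probe 0 1 (goto 2 (0 ∷ 1 ∷ []) false)
    (goto 1 (1 ∷ 0 ∷ []) false) stop (goto 0 (0 ∷ 1 ∷ []) false)) ∷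
  entry (state 2 ((0 , 1) ∷ []) ((1 , red) ∷ (1 , blue) ∷ []) []) 2 4 (probe 0 1 (goto 2 (0 ∷ 1 ∷
    []) false) (goto 2 (0 ∷ 1 ∷ []) true) stop stop) ∷
  entry (state 2 ((0 , 1) ∷ []) ((0 , red) ∷ (1 , blue) ∷ []) []) 2 5 (probe 1 0 (goto 1 (0 ∷ 1 ∷
    []) false) stop stop (goto 1 (1 ∷ 0 ∷ []) true)) ∷
  entry (state 2 ((0 , 1) ∷ []) ((0 , red) ∷ (1 , red) ∷ []) []) 2 5 (probe 1 0 stop (goto 0 (0 ∷ 1
    ∷ []) false) stop (goto 0 (1 ∷ 0 ∷ []) false)) ∷
  entry (state 2 ((0 , 1) ∷ []) ((0 , red) ∷ (1 , red) ∷ (1 , blue) ∷ []) ((0 , 1) ∷ [])) 2 3 (probe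
    0 1 stop (goto 0 (0 ∷ 1 ∷ []) false) stop stop) ∷
  entry (state 2 ((0 , 1) ∷ []) ((0 , red) ∷ (0 , blue) ∷ (1 , red) ∷ (1 , blue) ∷ []) ((0 , 1) ∷
    [])) 2 2 (probe 1 0 stop stop stop stop) ∷
  []

table-sound : T (sound table)
table-sound = tt

-- Claims: linear bounds for all numbers of missing edges

shift : ∀ a a′ p p′ x y → a′ + p ≤ a + p′ → a + x ≤ p + y → a′ + x ≤ p′ + y
shift a a′ p p′ x y h h′ = +-cancelʳ-≤ (a + p) (a′ + x) (p′ + y)
  (subst₂ _≤_ (lhs a a′ p x) (rhs a p p′ y) (+-mono-≤ h h′))
  where
  lhs : ∀ a a′ p x → (a′ + p) + (a + x) ≡ (a′ + x) + (a + p)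
  lhs = solve-∀
  rhs : ∀ a p p′ y → (a + p′) + (p + y) ≡ (p′ + y) + (a + p)
  rhs = solve-∀

-- Builder wins in b rounds with r edges missing if slack + 3 r ≤ 2 b, margin + r ≤ b and floor ≤ r.
-- For floor ≤ r < onset this is shown by the plans `small` for the table, in turn, and for
-- r ≥ onset by `plan`, which leads back to claims.
record Claim : Set where
  constructor claim
  field
    situation                : State
    slack margin floor onset : ℕ
    small                    : List Plan
    plan                     : Plan
open Claim

-- In all situations there is the green path Z from 0 to 1.  In 1, an end of Z has a red edge.  In 2
-- there is one more vertex with a red edge, in 3 and 4 there are two with edges of equal and of
-- different colours.  In 5 and 6 there is a second green path, in 5 also a vertex with a red edge.
claimAt : ℕ → Claim
claimAt 0 = claim (state 2 ((0 , 1) ∷ []) [] []) 3 6 2 10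
  ((goto 117 (0 ∷ 1 ∷ []) false) ∷ (goto 111 (0 ∷ 1 ∷ []) false) ∷ (goto 104 (0 ∷ 1 ∷ []) false) ∷
    (goto 92 (0 ∷ 1 ∷ []) false) ∷ (goto 85 (0 ∷ 1 ∷ []) false) ∷ (goto 78 (0 ∷ 1 ∷ []) false) ∷
    (goto 64 (0 ∷ 1 ∷ []) false) ∷ (goto 41 (0 ∷ 1 ∷ []) false) ∷ [])
  (play 1 2 (play 1 3 stop (play 1 4 stop stop (goto 4 (0 ∷ 4 ∷ 2 ∷ 3 ∷ []) false)) (goto 2 (0 ∷ 3 ∷
    2 ∷ []) false)) (play 1 3 (play 1 4 stop stop (goto 4 (0 ∷ 4 ∷ 3 ∷ 2 ∷ []) false)) stop (goto 2
    (0 ∷ 3 ∷ 2 ∷ []) true)) (goto 0 (0 ∷ 2 ∷ []) false))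
claimAt 1 = claim (state 2 ((0 , 1) ∷ []) ((0 , red) ∷ []) []) 2 5 7 9
  ((goto 40 (1 ∷ 0 ∷ []) false) ∷ (goto 65 (1 ∷ 0 ∷ []) false) ∷ [])
  (play 0 2 stop (play 0 3 stop stop (goto 2 (1 ∷ 3 ∷ 2 ∷ []) true)) (goto 0 (1 ∷ 2 ∷ []) false))
claimAt 2 = claim (state 3 ((0 , 1) ∷ (2 , 2) ∷ []) ((2 , red) ∷ []) []) 1 5 8 10
  ((goto 38 (2 ∷ 0 ∷ 1 ∷ []) false) ∷ (goto 23 (2 ∷ 0 ∷ 1 ∷ []) false) ∷ [])
  (play 2 3 stop (play 1 2 stop stop (play 2 4 stop stop (goto 2 (0 ∷ 4 ∷ 3 ∷ []) true))) (play 2 4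
    stop (play 1 2 stop stop (goto 2 (0 ∷ 3 ∷ 4 ∷ []) true)) (goto 6 (3 ∷ 4 ∷ 0 ∷ 1 ∷ []) false)))
claimAt 3 = claim (state 4 ((0 , 1) ∷ (2 , 2) ∷ (3 , 3) ∷ []) ((2 , red) ∷ (3 , red) ∷ []) []) 0 5 9
  11
  ((goto 23 (2 ∷ 0 ∷ 1 ∷ []) false) ∷ (goto 3 (2 ∷ 3 ∷ 0 ∷ 1 ∷ []) false) ∷ [])
  (play 2 4 stop (play 1 2 stop stop (play 2 5 stop stop (goto 4 (0 ∷ 5 ∷ 3 ∷ 4 ∷ []) false))) (play
    2 5 stop (play 1 2 stop stop (goto 4 (0 ∷ 4 ∷ 3 ∷ 5 ∷ []) false)) (goto 5 (4 ∷ 5 ∷ 3 ∷ 0 ∷ 1 ∷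
    []) false)))
claimAt 4 = claim (state 4 ((0 , 1) ∷ (2 , 2) ∷ (3 , 3) ∷ []) ((2 , red) ∷ (3 , blue) ∷ []) []) 0 5
  9 11
  ((goto 23 (2 ∷ 0 ∷ 1 ∷ []) false) ∷ (goto 9 (2 ∷ 3 ∷ 0 ∷ 1 ∷ []) false) ∷ [])
  (play 2 4 stop (play 1 2 stop stop (play 2 5 stop stop (goto 3 (0 ∷ 5 ∷ 4 ∷ 3 ∷ []) true))) (play
    2 5 stop (play 1 2 stop stop (goto 3 (0 ∷ 4 ∷ 5 ∷ 3 ∷ []) true)) (goto 5 (4 ∷ 5 ∷ 3 ∷ 0 ∷ 1 ∷
    []) true)))
claimAt 5 = claim (state 5 ((0 , 1) ∷ (3 , 4) ∷ (2 , 2) ∷ []) ((2 , red) ∷ []) []) 2 5 9 9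
  []
  (play 2 3 stop (play 2 4 stop stop (play 2 1 stop stop (goto 1 (3 ∷ 0 ∷ []) true))) (play 2 1 stop
    (play 2 0 stop stop (goto 1 (1 ∷ 4 ∷ []) true)) (goto 0 (4 ∷ 0 ∷ []) false)))
claimAt _ = claim (state 4 ((0 , 1) ∷ (2 , 3) ∷ []) [] []) 3 6 8 10
  ((goto 20 (0 ∷ 1 ∷ 2 ∷ 3 ∷ []) false) ∷ (goto 11 (0 ∷ 1 ∷ 2 ∷ 3 ∷ []) false) ∷ [])
  (play 1 4 (play 1 5 stop (play 1 2 stop stop (goto 4 (0 ∷ 3 ∷ 4 ∷ 5 ∷ []) false)) (goto 5 (0 ∷ 5 ∷
    4 ∷ 2 ∷ 3 ∷ []) false)) (play 1 5 (play 1 2 stop stop (goto 4 (0 ∷ 3 ∷ 5 ∷ 4 ∷ []) false)) stop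
    (goto 5 (0 ∷ 5 ∷ 4 ∷ 2 ∷ 3 ∷ []) true)) (goto 6 (0 ∷ 4 ∷ 2 ∷ 3 ∷ []) false))

Meets : Claim → ℕ → ℕ → Set
Meets c r b = slack c + 3 * r ≤ 2 * b × margin c + r ≤ b × floor c ≤ r

-- The number of rounds on which the plans of claims are run. It has to be at least their length,
-- and it is less than every `onset`, so that `budget` ≤ b follows from `onset` ≤ r ≤ b and b -
-- `budget` is a true difference.
budget : ℕ
budget = 6

-- Without subtraction, the first test says that `slack` + 3 r - 2 b does not grow. The `suc` in the
-- second is the round gained in `large-margin`. The last test makes sure that a round has been
-- spent, on which the induction rests.
reaches : Claim → ℕ → ℕ → ℕ → Bool
reaches c k r b = let d = claimAt k in
  ((slack d + 3 * r) + 2 * budget ≤ᵇ (slack c + 3 * onset c) + 2 * b) ∧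
  ((margin d + r) + budget ≤ᵇ (suc (margin c) + onset c) + b) ∧
  (floor d ≤ᵇ r) ∧ (b <ᵇ budget)

-- Below `onset` the bound by `margin` alone has to suffice; here the numbers are exact and the
-- table may be used.
smallWorks : Claim → List Plan → ℕ → Bool
smallWorks c []       r = r ≡ᵇ onset c
smallWorks c (p ∷ ps) r =
  Run.works (situationAt table) (listed table) true p (situation c) r (margin c + r) ∧ smallWorks c ps (suc r)

sane : Claim → Bool
sane c =
  smallWorks c (small c) (floor c) ∧ (2 * margin c <ᵇ slack c + onset c) ∧ (budget <ᵇ onset c) ∧
  Run.works (λ k → situation (claimAt k)) (reaches c) false (plan c) (situation c) (onset c) budget

all-sane : ∀ k → T (sane (claimAt k))
all-sane 0 = tt
all-sane 1 = tt
all-sane 2 = tt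
all-sane 3 = tt
all-sane 4 = tt
all-sane 5 = tt
all-sane (suc (suc (suc (suc (suc (suc _)))))) = tt

-- From `onset` on, the bound by `slack` implies the one by `margin` with a round to spare: 2 (b -
-- r) ≥ `slack` + r > 2 `margin`.
large-margin : ∀ c {r b} → T (2 * margin c <ᵇ slack c + onset c) → onset c ≤ r →
               slack c + 3 * r ≤ 2 * b → suc (margin c) + r ≤ b
large-margin c {r} {b} t s≤r h = ≰⇒> λ b≤ → <⇒≱ (<ᵇ⇒< (2 * margin c) _ t) (begin
  slack c + onset c                    ≤⟨ +-monoʳ-≤ (slack c) s≤r ⟩
  slack c + r                          ≤⟨ +-cancelʳ-≤ (2 * r) _ _ (begin
    slack c + r + 2 * r                ≡⟨ eq₁ (slack c) r ⟩
    slack c + 3 * r                    ≤⟨ h ⟩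
    2 * b                              ≤⟨ *-monoʳ-≤ 2 b≤ ⟩
    2 * (margin c + r)                 ≡⟨ eq₂ (margin c) r ⟩
    2 * margin c + 2 * r               ∎) ⟩
  2 * margin c                         ∎)
  where
  open ≤-Reasoning
  eq₁ : ∀ x r → x + r + 2 * r ≡ x + 3 * r
  eq₁ = solve-∀
  eq₂ : ∀ x r → 2 * (x + r) ≡ 2 * x + 2 * r
  eq₂ = solve-∀

-- The tests compare numerals at `onset` and `budget`. The offsets r₀ and b₀ are the same before and
-- after the plan, so by `shift` the comparison carries over to all larger numbers.
reach : ∀ c k r₀ b₀ r b → T (reaches c k r b) →
        slack c + 3 * (onset c + r₀) ≤ 2 * (budget + b₀) → suc (margin c) + (onset c + r₀) ≤ budget + b₀ →
        Meets (claimAt k) (r + r₀) (b + b₀) × b < budget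
reach c k r₀ b₀ r b t h₁ h₂ =
  ( subst₂ _≤_ (distr (slack d) 3 r r₀) (distr 0 2 b b₀)
      (shift (slack c + 3 * onset c) (slack d + 3 * r) (2 * budget) (2 * b) (3 * r₀) (2 * b₀)
        (≤ᵇ⇒≤ _ _ (proj₁ t₁))
        (subst₂ _≤_ (sym (distr (slack c) 3 (onset c) r₀)) (sym (distr 0 2 budget b₀)) h₁))
  , subst (_≤ b + b₀) (+-assoc (margin d) r r₀)
      (shift (suc (margin c) + onset c) (margin d + r) budget b r₀ b₀ (≤ᵇ⇒≤ _ _ (proj₁ t₂))
        (subst (_≤ budget + b₀) (sym (+-assoc (suc (margin c)) (onset c) r₀)) h₂))
  , ≤-trans (≤ᵇ⇒≤ _ _ (proj₁ t₃)) (m≤m+n r r₀)) , <ᵇ⇒< b budget (proj₂ t₃)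
  where
  d = claimAt k
  t₁ = ∧-T {(slack d + 3 * r) + 2 * budget ≤ᵇ (slack c + 3 * onset c) + 2 * b} t
  t₂ = ∧-T {(margin d + r) + budget ≤ᵇ (suc (margin c) + onset c) + b} (proj₂ t₁)
  t₃ = ∧-T {floor d ≤ᵇ r} (proj₂ t₂)
  distr : ∀ x n y z → x + n * y + n * z ≡ x + n * (y + z)
  distr = solve-∀

-- The case ℓ ≡ 3 (mod 4) needs one edge more than the slack of claims 3 and 4 allows.  As long as
-- Painter has never answered green twice, the ends 2 and 3 of the red-blue path have equal colours
-- just if an odd number m of red and blue edges is still allowed; 0 has both colours.
alike apart : State
alike = state 4 ((0 , 1) ∷ (2 , 2) ∷ (3 , 3) ∷ []) ((0 , red) ∷ (0 , blue) ∷ (2 , red) ∷ (3 , red) ∷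
  []) ((0 , 1) ∷ (0 , 2) ∷ (0 , 3) ∷ [])
apart = state 4 ((0 , 1) ∷ (2 , 2) ∷ (3 , 3) ∷ []) ((0 , red) ∷ (0 , blue) ∷ (2 , red) ∷ (3 , blue)
  ∷ []) ((0 , 1) ∷ (0 , 2) ∷ (0 , 3) ∷ [])

alikePlan apartPlan : Plan
alikePlan = play 2 4 stop (play 1 2 stop stop (play 2 5 stop stop (goto 0 (0 ∷ 5 ∷ 3 ∷ 4 ∷ [])
  false))) (play 2 5 stop (play 1 2 stop stop (goto 0 (0 ∷ 4 ∷ 3 ∷ 5 ∷ []) false)) (play 0 4 stop
  stop (goto 1 (1 ∷ 5 ∷ 3 ∷ []) false)))
apartPlan = play 2 4 stop (play 1 2 stop stop (play 2 5 stop stop (goto 0 (0 ∷ 5 ∷ 4 ∷ 3 ∷ [])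
  true))) (play 2 5 stop (play 1 2 stop stop (goto 0 (0 ∷ 4 ∷ 5 ∷ 3 ∷ []) true)) (play 0 4 stop stop
  (goto 1 (1 ∷ 5 ∷ 3 ∷ []) true)))

choose : State → State → ℕ → State
choose σ τ zero    = σ
choose σ τ (suc _) = τ

leaves : ℕ → ℕ → ℕ → Bool
leaves zero    r b = (r ≡ᵇ 2) ∧ (b ≡ᵇ 0)
leaves (suc _) r b = (r ≡ᵇ 1) ∧ (b ≡ᵇ 0)

-- The opening rounds

empty : State
empty = state 0 [] [] []

loosePlan tightPlan : Plan
loosePlan = play 0 1 (play 1 2 stop (play 1 3 stop stop (play 1 4 stop stop (goto 4 (3 ∷ 4 ∷ 0 ∷ 2
  ∷ []) false))) (play 1 3 stop (play 1 4 stop stop (goto 4 (2 ∷ 4 ∷ 0 ∷ 3 ∷ []) false)) (goto 2 (2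
  ∷ 3 ∷ 0 ∷ []) false))) (play 1 2 (play 1 3 stop stop (play 1 4 stop stop (goto 4 (3 ∷ 4 ∷ 2 ∷ 0 ∷
  []) false))) stop (play 1 3 (play 1 4 stop stop (goto 4 (2 ∷ 4 ∷ 3 ∷ 0 ∷ []) false)) stop (goto 2
  (2 ∷ 3 ∷ 0 ∷ []) true))) (play 1 2 (play 1 3 stop (play 1 4 stop stop (goto 4 (0 ∷ 4 ∷ 2 ∷ 3 ∷ [])
  false)) (goto 2 (0 ∷ 3 ∷ 2 ∷ []) false)) (play 1 3 (play 1 4 stop stop (goto 4 (0 ∷ 4 ∷ 3 ∷ 2 ∷
  []) false)) stop (goto 2 (0 ∷ 3 ∷ 2 ∷ []) true)) (goto 0 (0 ∷ 2 ∷ []) false))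
tightPlan = play 0 1 (play 1 2 stop (play 1 3 stop stop (goto 4 (1 ∷ 3 ∷ 0 ∷ 2 ∷ []) false)) (play
  1 3 stop (goto 4 (1 ∷ 2 ∷ 0 ∷ 3 ∷ []) false) (goto 2 (2 ∷ 3 ∷ 0 ∷ []) false))) (play 1 2 (play 1 3
  stop stop (goto 4 (1 ∷ 3 ∷ 2 ∷ 0 ∷ []) false)) stop (play 1 3 (goto 4 (1 ∷ 2 ∷ 3 ∷ 0 ∷ []) false)
  stop (goto 2 (2 ∷ 3 ∷ 0 ∷ []) true))) (play 1 2 (play 1 3 stop (goto 4 (1 ∷ 0 ∷ 2 ∷ 3 ∷ []) false)
  (goto 2 (0 ∷ 3 ∷ 2 ∷ []) false)) (play 1 3 (goto 4 (1 ∷ 0 ∷ 3 ∷ 2 ∷ []) false) stop (goto 2 (0 ∷ 3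
  ∷ 2 ∷ []) true)) (goto 0 (0 ∷ 2 ∷ []) false))

opening : ℕ → ℕ → ℕ → Bool
opening 0 r b = (r ≡ᵇ 0) ∧ (b ≡ᵇ 2)
opening 2 r b = (r ≡ᵇ 0) ∧ (b ≡ᵇ 1)
opening 4 r b = (r ≡ᵇ 0) ∧ (b ≡ᵇ 0)
opening _ r b = false

situationᵗ : ℕ → State
situationᵗ 4 = apart
situationᵗ k = situation (claimAt k)

openingᵗ : ℕ → ℕ → ℕ → Bool
openingᵗ 0 r b = (r ≡ᵇ 0) ∧ (b ≡ᵇ 1)
openingᵗ 2 r b = (r ≡ᵇ 0) ∧ (b ≡ᵇ 0)
openingᵗ 4 r b = (r ≡ᵇ 1) ∧ (b ≡ᵇ 0)
openingᵗ _ r b = false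

loose-works : T (Run.works (λ k → situation (claimAt k)) opening false loosePlan empty 2 4)
loose-works = tt

tight-works : T (Run.works situationᵗ openingᵗ false tightPlan empty 2 3)
tight-works = tt

equals : ∀ r r′ b b′ → T ((r ≡ᵇ r′) ∧ (b ≡ᵇ b′)) → r ≡ r′ × b ≡ b′
equals r r′ b b′ t = let p , q = ∧-T {r ≡ᵇ r′} t in ≡ᵇ⇒≡ r r′ p , ≡ᵇ⇒≡ b b′ q

-- Wins of Builder from the plans

module Conclusions (ℓ : ℕ) where
  open Strategy ℓ

  wins-mono : ∀ {σ r b b′} → b ≤ b′ → Wins σ r b → Wins σ r b′
  wins-mono b≤ w R = winIn-mono b≤ (w R)

  listed⇒wins : ∀ es → T (sound es) → ∀ k r b → T (listed es k r b) → Wins (situationAt es k) (r + 0) (b + 0)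
  listed⇒wins (e ∷ es) s zero r b t
    with w , s′ ← ∧-T {Run.works (situationAt es) (listed es) true (plan e) (situation e) (edges e) (rounds e)} s
    with p , q ← ∧-T {r ≡ᵇ edges e} t with refl ← ≡ᵇ⇒≡ r (edges e) p =
    wins-mono {situation e} (+-monoˡ-≤ 0 (≤ᵇ⇒≤ (rounds e) b q))
      (works⇒wins (situationAt es) (listed es) true 0 0 (λ _ → refl) (listed⇒wins es s′)
        (plan e) (edges e) (rounds e) w)
  listed⇒wins (e ∷ es) s (suc k) r b t =
    listed⇒wins es (proj₂ (∧-T {Run.works (situationAt es) (listed es) true (plan e) (situation e) (edges e) (rounds e)} s)) k r b t

  small⇒wins : ∀ c ps r₁ → T (smallWorks c ps r₁) → ∀ {r} → r₁ ≤ r → r < onset c →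
               Wins (situation c) r (margin c + r)
  small⇒wins c [] r₁ t r₁≤ r< with refl ← ≡ᵇ⇒≡ r₁ (onset c) t = ⊥-elim (<⇒≱ r< r₁≤)
  small⇒wins c (p ∷ ps) r₁ t {r} r₁≤ r<
    with w , t′ ← ∧-T {Run.works (situationAt table) (listed table) true p (situation c) r₁ (margin c + r₁)} t
    with m≤n⇒m<n∨m≡n r₁≤
  ... | inj₁ r₁< = small⇒wins c ps (suc r₁) t′ r₁< r<
  ... | inj₂ refl = subst₂ (Wins (situation c)) (+-identityʳ r) (+-identityʳ (margin c + r))
          (works⇒wins (situationAt table) (listed table) true 0 0 (λ _ → refl)
            (listed⇒wins table table-sound) p r (margin c + r) w)

  -- Claims refer to each other in circles, but a plan spends a round before it returns to a claim.
  -- Hence the induction on a bound `n` for the rounds, for all claims together.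
  claim-wins : ∀ n k r b → b < n → Meets (claimAt k) r b → Wins (situation (claimAt k)) r b
  claim-wins (suc n) k r b (s≤s b≤n) (h₁ , h₂ , h₃) = by-size
    where
    c = claimAt k
    t₁ = ∧-T {smallWorks c (small c) (floor c)} (all-sane k)
    t₂ = ∧-T {2 * margin c <ᵇ slack c + onset c} (proj₂ t₁)
    t₃ = ∧-T {budget <ᵇ onset c} (proj₂ t₂)
    by-size : Wins (situation c) r b
    by-size with onset c ≤? r
    ... | no s≰r = wins-mono {situation c} h₂ (small⇒wins c (small c) (floor c) (proj₁ t₁) h₃ (≰⇒> s≰r))
    ... | yes s≤r = subst₂ (Wins (situation c)) er eb
            (works⇒wins (λ k → situation (claimAt k)) (reaches c) false r₀ b₀ (λ ()) known
              (plan c) (onset c) budget (proj₂ t₃))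
      where
      r₀ = r ∸ onset c
      b₀ = b ∸ budget
      er : onset c + r₀ ≡ r
      er = m+[n∸m]≡n s≤r
      eb : budget + b₀ ≡ b
      eb = m+[n∸m]≡n (≤-trans (<⇒≤ (<ᵇ⇒< budget (onset c) (proj₁ t₃)))
             (≤-trans s≤r (≤-trans (m≤n+m r (margin c)) h₂)))
      known : ∀ k′ r′ b′ → T (reaches c k′ r′ b′) → Wins (situation (claimAt k′)) (r′ + r₀) (b′ + b₀)
      known k′ r′ b′ t =
        let m , b′< = reach c k′ r₀ b₀ r′ b′ t
              (subst₂ (λ x y → slack c + 3 * x ≤ 2 * y) (sym er) (sym eb) h₁)
              (subst₂ (λ x y → suc (margin c) + x ≤ y) (sym er) (sym eb) (large-margin c (proj₁ t₂) s≤r h₁))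
        in claim-wins n k′ (r′ + r₀) (b′ + b₀)
             (≤-trans (subst (b′ + b₀ <_) eb (+-monoˡ-< b₀ b′<)) b≤n) m

  single-wins : ∀ r b → 1 + 3 * r ≤ 2 * b → 5 + r ≤ b → 8 ≤ r → Wins (situation (claimAt 2)) r b
  single-wins r b p q s = claim-wins (suc b) 2 r b ≤-refl (p , q , s)

  -- Three rounds either use up one red or blue edge and bring two edges of the cycle, or Painter
  -- answers green twice at an end of the red-blue path. Then the edge from the vertex with both
  -- colours to this green P₃ is forced, three rounds have brought three edges, and the `slack`
  -- bound of claim 2 holds with equality.
  alternate : ∀ σ τ p → T (Run.works (choose τ (situation (claimAt 2))) leaves false p σ 4 3) →
              ∀ m → 5 ≤ m → Wins τ (2 + 2 * m) (2 + 3 * m) → Wins σ (2 + 2 * suc m) (2 + 3 * suc m)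
  alternate σ τ p t m 5≤m w = subst₂ (Wins σ) (eq₁ m) (eq₂ m)
    (works⇒wins (choose τ (situation (claimAt 2))) leaves false (2 * m) (2 + 3 * m) (λ ()) known p 4 3 t)
    where
    eq₁ : ∀ m → 4 + 2 * m ≡ 2 + 2 * suc m
    eq₁ = solve-∀
    eq₂ : ∀ m → 3 + (2 + 3 * m) ≡ 2 + 3 * suc m
    eq₂ = solve-∀
    eq₃ : ∀ m → 1 + 3 * (1 + 2 * m) ≡ 2 * (2 + 3 * m)
    eq₃ = solve-∀
    eq₄ : ∀ m → 2 * m + m ≡ 3 * m
    eq₄ = solve-∀
    known : ∀ k r b → T (leaves k r b) →
            Wins (choose τ (situation (claimAt 2)) k) (r + 2 * m) (b + (2 + 3 * m))
    known zero    r b t with refl , refl ← equals r 2 b 0 t = w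
    known (suc _) r b t with refl , refl ← equals r 1 b 0 t =
      single-wins (1 + 2 * m) (2 + 3 * m) (≤-reflexive (eq₃ m))
        (≤-trans (≤-reflexive (+-comm 6 (2 * m)))
          (≤-trans (+-monoʳ-≤ (2 * m) (s≤s 5≤m))
            (≤-trans (≤-reflexive (trans (+-suc (2 * m) m) (cong suc (eq₄ m)))) (n≤1+n _))))
        (≤-trans (≤ᵇ⇒≤ 8 11 tt) (s≤s (*-monoʳ-≤ 2 5≤m)))

  tight-wins : ∀ j → Wins alike (2 + 2 * (5 + 2 * j)) (2 + 3 * (5 + 2 * j)) ×
                     Wins apart (2 + 2 * (6 + 2 * j)) (2 + 3 * (6 + 2 * j))
  tight-wins j = odd j , next j (odd j)
    where
    next : ∀ j → Wins alike (2 + 2 * (5 + 2 * j)) (2 + 3 * (5 + 2 * j)) →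
           Wins apart (2 + 2 * (6 + 2 * j)) (2 + 3 * (6 + 2 * j))
    next j = alternate apart alike apartPlan tt (5 + 2 * j) (m≤m+n 5 (2 * j))
    odd : ∀ j → Wins alike (2 + 2 * (5 + 2 * j)) (2 + 3 * (5 + 2 * j))
    -- Here m = 5. The vertex 0 has both colours, so its edge to a new vertex is forced; this leaves
    -- 11 edges and 16 rounds, the first entry of the table.
    odd zero = works⇒wins (situationAt table) (listed table) true 0 0 (λ _ → refl)
      (listed⇒wins table table-sound) (play 0 4 stop stop (goto 0 (2 ∷ 3 ∷ 1 ∷ 4 ∷ []) false)) 12 17 tt
    odd (suc j) = subst (λ m → Wins alike (2 + 2 * m) (2 + 3 * m)) (eq j)
      (alternate alike apart alikePlan tt (6 + 2 * j) (m≤m+n 5 (suc (2 * j))) (next j (odd j)))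
      where
      eq : ∀ j → suc (6 + 2 * j) ≡ 5 + 2 * suc j
      eq = solve-∀

  empty-wins : ∀ b → Wins empty ℓ b → Win b []
  empty-wins b w = w {s = false} {ρ = λ l → l} record
    { bound     = 0
    ; paths     = []
    ; unique    = []
    ; missing   = sym (+-identityʳ ℓ)
    ; vertices< = []
    ; board<    = λ { (_ , inj₁ ()) ; (_ , inj₂ ()) }
    ; labels<   = λ ()
    ; injective = λ ()
    ; marks-ok  = λ _ ()
    ; links-ok  = λ ()
    }

builder-wins-loose : ∀ r₀ b₀ → 14 ≤ r₀ → 3 * r₀ ≤ 2 * b₀ →
                     WinIn (Path 3) (Path 3) (Cycle (2 + r₀)) (4 + b₀) []
builder-wins-loose r₀ b₀ 14≤ h = empty-wins (4 + b₀)
  (works⇒wins (λ k → situation (claimAt k)) opening false r₀ b₀ (λ ()) known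
    loosePlan 2 4 loose-works)
  where
  open Strategy (2 + r₀)
  open Conclusions (2 + r₀)
  -- Here ℓ ≥ 16 enters: 2 b₀ ≥ 3 r₀ ≥ 14 + 2 r₀, which is room enough for the margins of all three
  -- claims.
  r₀≤b₀ : 7 + r₀ ≤ b₀
  r₀≤b₀ = *-cancelˡ-≤ 2 (≤-trans (≤-reflexive (eq r₀)) (≤-trans (+-monoˡ-≤ (2 * r₀) 14≤)
            (≤-trans (≤-reflexive (eq′ r₀)) h)))
    where
    eq : ∀ r → 2 * (7 + r) ≡ 14 + 2 * r
    eq = solve-∀
    eq′ : ∀ r → r + 2 * r ≡ 3 * r
    eq′ = solve-∀
  dbl : ∀ n b → 2 * n + 2 * b ≡ 2 * (n + b)
  dbl = solve-∀
  known : ∀ k r b → T (opening k r b) → Wins (situation (claimAt k)) (r + r₀) (b + b₀)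
  known 0 r b t with refl , refl ← equals r 0 b 2 t = claim-wins _ 0 r₀ (2 + b₀) ≤-refl
    ( ≤-trans (+-mono-≤ (n≤1+n 3) h) (≤-reflexive (dbl 2 b₀))
    , ≤-trans (n≤1+n _) (≤-trans r₀≤b₀ (m≤n+m b₀ 2)) , ≤-trans (≤ᵇ⇒≤ 2 14 tt) 14≤)
  known 2 r b t with refl , refl ← equals r 0 b 1 t = claim-wins _ 2 r₀ (1 + b₀) ≤-refl
    ( ≤-trans (+-mono-≤ (n≤1+n 1) h) (≤-reflexive (dbl 1 b₀))
    , ≤-trans (m≤n+m _ 2) (≤-trans r₀≤b₀ (m≤n+m b₀ 1)) , ≤-trans (≤ᵇ⇒≤ 8 14 tt) 14≤)
  known 4 r b t with refl , refl ← equals r 0 b 0 t = claim-wins _ 4 r₀ b₀ ≤-refl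
    (h , ≤-trans (m≤n+m _ 2) r₀≤b₀ , ≤-trans (≤ᵇ⇒≤ 9 14 tt) 14≤)

builder-wins-tight : ∀ j → WinIn (Path 3) (Path 3) (Cycle (15 + 4 * j)) (23 + 6 * j) []
builder-wins-tight j = empty-wins (23 + 6 * j)
  (works⇒wins situationᵗ openingᵗ false r₀ b₀ (λ ()) known
    tightPlan 2 3 tight-works)
  where
  open Strategy (15 + 4 * j)
  open Conclusions (15 + 4 * j)
  r₀ = 13 + 4 * j
  b₀ = 20 + 6 * j
  eq₁ : ∀ j → 2 + 2 * (6 + 2 * j) ≡ 1 + (13 + 4 * j)
  eq₁ = solve-∀
  eq₂ : ∀ j → 2 + 3 * (6 + 2 * j) ≡ 20 + 6 * j
  eq₂ = solve-∀
  eq₃ : ∀ j → 3 + 3 * (13 + 4 * j) ≡ 2 * (1 + (20 + 6 * j))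
  eq₃ = solve-∀
  eq₄ : ∀ j → 1 + 3 * (13 + 4 * j) ≡ 2 * (20 + 6 * j)
  eq₄ = solve-∀
  4j≤6j : 4 * j ≤ 6 * j
  4j≤6j = *-monoˡ-≤ j (≤ᵇ⇒≤ 4 6 tt)
  known : ∀ k r b → T (openingᵗ k r b) → Wins (situationᵗ k) (r + r₀) (b + b₀)
  known 0 r b t with refl , refl ← equals r 0 b 1 t = claim-wins _ 0 r₀ (1 + b₀) ≤-refl
    (≤-reflexive (eq₃ j) , +-mono-≤ (≤ᵇ⇒≤ 19 21 tt) 4j≤6j , m≤m+n 2 _)
  known 2 r b t with refl , refl ← equals r 0 b 0 t = claim-wins _ 2 r₀ b₀ ≤-refl
    (≤-reflexive (eq₄ j) , +-mono-≤ (≤ᵇ⇒≤ 18 20 tt) 4j≤6j , m≤m+n 8 _)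
  -- A red, a blue and a green edge meet at one vertex. The ends of the red-blue path have different
  -- colours, and m = 6 + 2 j.
  known 4 r b t with refl , refl ← equals r 1 b 0 t =
    subst₂ (Wins apart) (eq₁ j) (eq₂ j) (proj₂ (tight-wins j))

-- Degrees and counting

hit : ℕ → ℕ → ℕ
hit x v = if x ≡ᵇ v then 1 else 0

hit-refl : ∀ v → hit v v ≡ 1
hit-refl v with v ≡ᵇ v | ≡⇒≡ᵇ v v refl
... | true | _ = refl

hit-≢ : ∀ {x v} → x ≢ v → hit x v ≡ 0
hit-≢ {x} {v} x≢v with x ≡ᵇ v in e
... | true  = ⊥-elim (x≢v (≡ᵇ⇒≡ x v (subst T (sym e) tt)))
... | false = refl

deg : Colour → Board → ℕ → ℕ
deg c []                v = 0
deg c ((x , y , d) ∷ B) v = (if sameᶜ c d then hit x v + hit y v else 0) + deg c B v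

count : Colour → Board → ℕ
count c []                = 0
count c ((x , y , d) ∷ B) = (if sameᶜ c d then 1 else 0) + count c B

length-count : ∀ B → length B ≡ count red B + count blue B + count green B
length-count []                    = refl
length-count ((_ , _ , red)   ∷ B) = cong suc (length-count B)
length-count ((_ , _ , blue)  ∷ B) =
  trans (cong suc (length-count B)) (cong (_+ count green B) (sym (+-suc (count red B) (count blue B))))
length-count ((_ , _ , green) ∷ B) =
  trans (cong suc (length-count B)) (sym (+-suc (count red B + count blue B) (count green B)))

sum-map-+ : ∀ (f g : ℕ → ℕ) vs → sum (map (λ v → f v + g v) vs) ≡ sum (map f vs) + sum (map g vs)
sum-map-+ f g []       = refl
sum-map-+ f g (v ∷ vs) = trans (cong (f v + g v +_) (sum-map-+ f g vs)) (interchange (f v) (g v) _ _)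
  where
  interchange : ∀ a b c d → a + b + (c + d) ≡ a + c + (b + d)
  interchange = solve-∀

sum-hit : ∀ x {vs} → Unique vs → sum (map (hit x) vs) ≤ 1
sum-hit x []            = z≤n
sum-hit x {v ∷ vs} (p ∷ u) with x ≟ v
... | yes refl = ≤-reflexive (cong₂ _+_ (hit-refl x) (missed p))
  where
  missed : ∀ {vs} → All (x ≢_) vs → sum (map (hit x) vs) ≡ 0
  missed []       = refl
  missed (q ∷ qs) = cong₂ _+_ (hit-≢ q) (missed qs)
... | no x≢v = subst (_≤ 1) (sym (cong (_+ sum (map (hit x) vs)) (hit-≢ x≢v))) (sum-hit x u)

-- Handshake lemma: each of the two ends of an edge occurs at most once among different vertices.
sum-deg : ∀ c B {vs} → Unique vs → sum (map (deg c B) vs) ≤ 2 * count c B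
sum-deg c [] {vs} u = ≤-reflexive (zeros vs)
  where
  zeros : ∀ vs → sum (map (deg c []) vs) ≡ 0
  zeros []       = refl
  zeros (v ∷ vs) = zeros vs
sum-deg c ((x , y , d) ∷ B) {vs} u with sameᶜ c d
... | false = sum-deg c B u
... | true  = begin
  sum (map (λ v → hit x v + hit y v + deg c B v) vs)              ≡⟨ sum-map-+ (λ v → hit x v + hit y v) _ vs ⟩
  sum (map (λ v → hit x v + hit y v) vs) + sum (map (deg c B) vs) ≡⟨ cong (_+ _) (sum-map-+ (hit x) (hit y) vs) ⟩
  sum (map (hit x) vs) + sum (map (hit y) vs) + _                 ≤⟨ +-mono-≤ (+-mono-≤ (sum-hit x u) (sum-hit y u)) (sum-deg c B u) ⟩
  2 + 2 * count c B                                               ≡⟨ sym (*-suc 2 (count c B)) ⟩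
  2 * suc (count c B)                                             ∎
  where open ≤-Reasoning

same-refl : ∀ c → sameᶜ c c ≡ true
same-refl red   = refl
same-refl blue  = refl
same-refl green = refl

deg-∷ : ∀ c e B v → deg c B v ≤ deg c (e ∷ B) v
deg-∷ c (x , y , d) B v = m≤n+m _ _

deg-new : ∀ c x y B v → deg c ((x , y , c) ∷ B) v ≡ hit x v + hit y v + deg c B v
deg-new c x y B v rewrite same-refl c = refl

deg-edge : ∀ {B c x y} → HasEdge B c x y → 1 ≤ deg c B x
deg-edge {(x , y , c) ∷ B} (inj₁ (here refl)) rewrite deg-new c x y B x | hit-refl x = s≤s z≤n
deg-edge {(y , x , c) ∷ B} (inj₂ (here refl)) rewrite deg-new c y x B x | hit-refl x =
  subst (1 ≤_) (cong (_+ deg c B x) (+-comm 1 (hit y x))) (s≤s z≤n)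
deg-edge {e ∷ B} {c} {x} (inj₁ (there p)) = ≤-trans (deg-edge {B} (inj₁ p)) (deg-∷ c e B x)
deg-edge {e ∷ B} {c} {x} (inj₂ (there p)) = ≤-trans (deg-edge {B} (inj₂ p)) (deg-∷ c e B x)

-- An entry of the board gives `x` only one neighbour, so different neighbours come from different
-- entries.
deg-two : ∀ {B c x y z} → y ≢ z → HasEdge B c x y → HasEdge B c x z → 2 ≤ deg c B x
deg-two {[]} _ (inj₁ ()) _
deg-two {[]} _ (inj₂ ()) _
deg-two {e ∷ B} {c} {x} {y} {z} y≢z p q = go (split p) (split q)
  where
  New : ℕ → Set
  New y = 1 + deg c B x ≤ deg c (e ∷ B) x × ((e ≡ (x , y , c)) ⊎ (e ≡ (y , x , c)))
  split : ∀ {y} → HasEdge (e ∷ B) c x y → New y ⊎ HasEdge B c x y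
  split {y} (inj₁ (here refl)) = inj₁ (≤-reflexive′ , inj₁ refl)
    where
    ≤-reflexive′ : 1 + deg c B x ≤ deg c ((x , y , c) ∷ B) x
    ≤-reflexive′ rewrite deg-new c x y B x | hit-refl x = s≤s (m≤n+m _ (hit y x))
  split {y} (inj₂ (here refl)) = inj₁ (≤-reflexive′ , inj₂ refl)
    where
    ≤-reflexive′ : 1 + deg c B x ≤ deg c ((y , x , c) ∷ B) x
    ≤-reflexive′ rewrite deg-new c y x B x | hit-refl x =
      subst (1 + deg c B x ≤_) (cong (_+ deg c B x) (+-comm 1 (hit y x))) (s≤s (m≤n+m _ (hit y x)))
  split (inj₁ (there p)) = inj₂ (inj₁ p)
  split (inj₂ (there p)) = inj₂ (inj₂ p)
  go : New y ⊎ HasEdge B c x y → New z ⊎ HasEdge B c x z → 2 ≤ deg c (e ∷ B) x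
  go (inj₂ p)       (inj₂ q)       = ≤-trans (deg-two {B} y≢z p q) (deg-∷ c e B x)
  go (inj₁ (l , _)) (inj₂ q)       = ≤-trans (s≤s (deg-edge {B} q)) l
  go (inj₂ p)       (inj₁ (l , _)) = ≤-trans (s≤s (deg-edge {B} p)) l
  go (inj₁ (_ , inj₁ refl)) (inj₁ (_ , inj₁ refl)) = ⊥-elim (y≢z refl)
  go (inj₁ (_ , inj₁ refl)) (inj₁ (_ , inj₂ refl)) = ⊥-elim (y≢z refl)
  go (inj₁ (_ , inj₂ refl)) (inj₁ (_ , inj₁ refl)) = ⊥-elim (y≢z refl)
  go (inj₁ (_ , inj₂ refl)) (inj₁ (_ , inj₂ refl)) = ⊥-elim (y≢z refl)

deg⇒edge : ∀ c B x → 1 ≤ deg c B x → ∃ λ y → HasEdge B c x y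
deg⇒edge c ((a , b , d) ∷ B) x h with sameᶜ c d in e
... | false = let y , q = deg⇒edge c B x h in y , hasEdge-∷ _ q
... | true with refl ← sameᶜ⇒≡ {c} {d} (subst T (sym e) tt) with a ≟ x | b ≟ x
... | yes refl | _        = b , hasEdge-new
... | no _     | yes refl = a , hasEdge-sym hasEdge-new
... | no a≢x   | no b≢x   =
  let y , q = deg⇒edge c B x (subst (1 ≤_) (cong₂ (λ m n → m + n + deg c B x) (hit-≢ a≢x) (hit-≢ b≢x)) h)
  in y , hasEdge-∷ _ q

module _ {B : Board} where

  P₃-degree : ∀ {c} → ContainsMono B c (Path 3) → ∃ λ v → 2 ≤ deg c B v
  P₃-degree (f , inj , edges) = f (suc zero) ,
    deg-two (λ e → case inj e of λ ()) (hasEdge-sym (edges zero (suc zero) refl)) (edges (suc zero) (suc (suc zero)) refl)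

  green-path : ∀ n (f : Fin (suc n) → ℕ) → (∀ i j → suc (toℕ i) ≡ toℕ j → HasEdge B green (f i) (f j)) →
               GreenPath B (f zero) (f (fromℕ n)) (tabulate f)
  green-path zero    f e = single (f zero)
  green-path (suc n) f e = e zero (suc zero) refl ∷ green-path n (f ∘ suc) (λ i j p → e (suc i) (suc j) (cong suc p))

record GreenCycle (B : Board) (ℓ : ℕ) : Set where
  field
    {first last} : ℕ
    {vertices}   : List ℕ
    path         : GreenPath B first last vertices
    unique       : Unique vertices
    order≡         : length vertices ≡ ℓ
    closing      : HasEdge B green first last
    degrees      : All (λ v → 2 ≤ deg green B v) vertices

-- From length three on, the predecessor and the successor of a vertex on the cycle differ, and
-- `deg-two` applies to them.
greenCycle⁻ : ∀ {B k} → ContainsMono B green (Cycle (3 + k)) → GreenCycle B (3 + k)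
greenCycle⁻ {B} {k} (f , inj , edges) = record
  { path    = green-path {B} (2 + k) f (λ i j e → edges i j (inj₁ e))
  ; unique  = tabulate⁺ inj
  ; order≡    = length-tabulate f
  ; closing = edges zero (fromℕ (2 + k)) (inj₂ (refl , cong suc (toℕ-fromℕ (2 + k))))
  ; degrees = All.tabulate⁺ two
  }
  where
  distinct : ∀ {i j} → toℕ i ≢ toℕ j → f i ≢ f j
  distinct ne e = ne (cong toℕ (inj e))
  two : ∀ i → 2 ≤ deg green B (f i)
  two zero = deg-two (distinct {suc zero} {fromℕ (2 + k)} λ e → case trans e (toℕ-fromℕ (2 + k)) of λ ())
    (edges zero (suc zero) (inj₁ refl)) (edges zero (fromℕ (2 + k)) (inj₂ (refl , cong suc (toℕ-fromℕ (2 + k)))))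
  two (suc i) with m≤n⇒m<n∨m≡n (toℕ<n i)
  ... | inj₁ i<k = deg-two (distinct {prev} {next} λ e → <⇒≢ (≤-trans (≤-reflexive (cong suc ep)) (n≤1+n _)) (trans e en))
          (hasEdge-sym (edges prev (suc i) (inj₁ (cong suc ep)))) (edges (suc i) next (inj₁ (sym en)))
    where
    p<  = m<n⇒m<1+n (toℕ<n i)
    prev = fromℕ< p<
    ep : toℕ prev ≡ toℕ i
    ep = toℕ-fromℕ< p<
    next = fromℕ< (s≤s i<k)
    en : toℕ next ≡ suc (suc (toℕ i))
    en = toℕ-fromℕ< (s≤s i<k)
  ... | inj₂ i≡k = deg-two (distinct {prev} {zero} λ e → case trans (sym i≡k) (cong suc (trans (sym ep) e)) of λ ())
          (hasEdge-sym (edges prev (suc i) (inj₁ (cong suc ep)))) (hasEdge-sym (edges zero (suc i) (inj₂ (refl , cong suc i≡k))))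
    where
    p<  = m<n⇒m<1+n (toℕ<n i)
    prev = fromℕ< p<
    ep : toℕ prev ≡ toℕ i
    ep = toℕ-fromℕ< p<

-- Weights along a green cycle

module _ {B : Board} (w : ℕ → ℕ) (t : ℕ) (heavy : ∀ {u v} → HasEdge B green u v → t ≤ w u + w v) where

  Steady : ∀ {x y vs} → GreenPath B x y vs → Set
  Steady (single _)        = ⊤
  Steady (_∷_ {x} {y} _ p) = w x + w y ≡ t × Steady p

  extend-sum : ∀ {a m S} x y z → a ≤ w x + w y → m + (w y + w z) ≤ 2 * S + t →
               a + m + (w x + w z) ≤ 2 * (w x + S) + t
  extend-sum {a} {m} {S} x y z h ih = begin
    a + m + (w x + w z)               ≤⟨ +-monoˡ-≤ (w x + w z) (+-monoˡ-≤ m h) ⟩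
    w x + w y + m + (w x + w z)       ≡⟨ eq₁ (w x) (w y) m (w z) ⟩
    w x + w x + (m + (w y + w z))     ≤⟨ +-monoʳ-≤ (w x + w x) ih ⟩
    w x + w x + (2 * S + t)           ≡⟨ eq₂ (w x) S t ⟩
    2 * (w x + S) + t                 ∎
    where
    open ≤-Reasoning
    eq₁ : ∀ a b m c → a + b + m + (a + c) ≡ a + a + (m + (b + c))
    eq₁ = solve-∀
    eq₂ : ∀ a S t → a + a + (2 * S + t) ≡ 2 * (a + S) + t
    eq₂ = solve-∀

  -- Adding up `heavy` over the edges counts inner vertices twice and the two ends once. The ends
  -- are added once more on the left, and `t` on the right as there is one edge less than there are
  -- vertices.
  path-sum : ∀ {x y vs} → GreenPath B x y vs →
             t * length vs + (w x + w y) ≤ 2 * sum (map w vs) + t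
  path-sum (single x) = ≤-reflexive (eq t (w x))
    where
    eq : ∀ t a → t * 1 + (a + a) ≡ 2 * (a + 0) + t
    eq = solve-∀
  path-sum (_∷_ {x} {y} {z} {vs} e p) rewrite *-suc t (length vs) =
    extend-sum x y z (heavy e) (path-sum p)

  -- A single edge of weight other than `t` makes the whole sum strict.
  path-steady : ∀ {x y vs} (p : GreenPath B x y vs) →
                Steady p ⊎ t * length vs + (w x + w y) < 2 * sum (map w vs) + t
  path-steady (single x) = inj₁ tt
  path-steady (_∷_ {x} {y} {z} {vs} e p) rewrite *-suc t (length vs) with w x + w y ≟ t | path-steady p
  ... | yes q | inj₁ s = inj₁ (q , s)
  ... | no q  | _      = inj₂ (extend-sum x y z (≤∧≢⇒< (heavy e) (q ∘ sym)) (path-sum p))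
  ... | yes q | inj₂ h = inj₂ (subst (λ n → n + (w x + w z) ≤ 2 * (w x + sum (map w vs)) + t)
                           (+-suc t (t * length vs)) (extend-sum {S = sum (map w vs)} x y z (heavy e) h))

  module _ {ℓ : ℕ} (C : GreenCycle B ℓ) where
    open GreenCycle C

    cycle-sum : t * ℓ ≤ 2 * sum (map w vertices)
    cycle-sum = +-cancelʳ-≤ t _ _ (begin
      t * ℓ + t                                    ≤⟨ +-monoʳ-≤ (t * ℓ) (heavy closing) ⟩
      t * ℓ + (w first + w last)                   ≡⟨ cong (λ n → t * n + (w first + w last)) (sym order≡) ⟩
      t * length vertices + (w first + w last)     ≤⟨ path-sum path ⟩
      2 * sum (map w vertices) + t                 ∎)
      where open ≤-Reasoning

    cycle-steady : 2 * sum (map w vertices) ≤ t * ℓ → Steady path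
    cycle-steady h with path-steady path
    ... | inj₁ s  = s
    ... | inj₂ h′ = ⊥-elim (<⇒≱ h′ (begin
      2 * sum (map w vertices) + t                 ≤⟨ +-mono-≤ h (heavy closing) ⟩
      t * ℓ + (w first + w last)                   ≡⟨ cong (λ n → t * n + (w first + w last)) (sym order≡) ⟩
      t * length vertices + (w first + w last)     ∎))
      where open ≤-Reasoning

module _ {B : Board} {w : ℕ → ℕ} {heavy : ∀ {u v} → HasEdge B green u v → 2 ≤ w u + w v} where

  steady-forward : ∀ {x y vs} (p : GreenPath B x y vs) → Steady w 2 heavy p → w x ≡ 1 → All (λ v → w v ≡ 1) vs
  steady-forward (single _)        _       e = e ∷ []
  steady-forward (_∷_ {x} {y} _ p) (q , s) e =
    e ∷ steady-forward p s (suc-injective (trans (cong (_+ w y) (sym e)) q))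

  steady-backward : ∀ {x y vs v} (p : GreenPath B x y vs) → Steady w 2 heavy p → v ∈ vs → w v ≡ 1 → w x ≡ 1
  steady-backward (single _)        _       (here refl) e = e
  steady-backward (_ ∷ p)           _       (here refl) e = e
  steady-backward (_∷_ {x} {y} _ p) (q , s) (there m)   e =
    suc-injective (trans (+-comm 1 (w x)) (trans (cong (w x +_) (sym (steady-backward p s m e))) q))

-- Strategies of Painter

-- Painter keeps the invariant, under which a win takes `N` edges, and a round adds only one edge to
-- the board.
survives : ∀ {G₁ G₂ G₃} (Inv : Board → Set) N →
  (∀ {B} → Inv B → Won G₁ G₂ G₃ B → N ≤ length B) →
  (∀ {B} x y → Inv B → x ≢ y → ¬ Adjacent B x y → ∃ λ c → Inv ((x , y , c) ∷ B)) →
  ∀ n {B} → Inv B → WinIn G₁ G₂ G₃ n B → N ≤ n + length B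
survives Inv N end paint zero    I w        = end I w
survives Inv N end paint (suc n) {B} I (inj₁ w) = ≤-trans (end I w) (m≤n+m (length B) (suc n))
survives Inv N end paint (suc n) {B} I (inj₂ (x , y , x≢y , ¬a , k)) with paint x y I x≢y ¬a
... | c , I′ = ≤-trans (survives Inv N end paint n I′ (k c)) (≤-reflexive (+-suc n (length B)))

hasEdge-∷⁻ : ∀ {B x y d c u v} → HasEdge ((x , y , d) ∷ B) c u v →
             (c ≡ d × ((u ≡ x × v ≡ y) ⊎ (u ≡ y × v ≡ x))) ⊎ HasEdge B c u v
hasEdge-∷⁻ (inj₁ (here refl)) = inj₁ (refl , inj₁ (refl , refl))
hasEdge-∷⁻ (inj₂ (here refl)) = inj₁ (refl , inj₂ (refl , refl))
hasEdge-∷⁻ (inj₁ (there p))   = inj₂ (inj₁ p)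
hasEdge-∷⁻ (inj₂ (there p))   = inj₂ (inj₂ p)

deg-other : ∀ {c d} x y B v → c ≢ d → deg c ((x , y , d) ∷ B) v ≡ deg c B v
deg-other {c} {d} x y B v c≢d with sameᶜ c d in e
... | true  = ⊥-elim (c≢d (sameᶜ⇒≡ {c} {d} (subst T (sym e) tt)))
... | false = refl

-- A record, as are the two below, so that the colour, the board and the vertices can be inferred
-- from the type.
record Free (c : Colour) (B : Board) (x y : ℕ) : Set where
  constructor free
  field degrees≡0 : deg c B x + deg c B y ≡ 0

record Matching (c : Colour) (B : Board) : Set where
  constructor matching
  field degree≤1 : ∀ v → deg c B v ≤ 1
open Matching

record Covered (c : Colour) (B : Board) (x y : ℕ) : Set where
  constructor covering
  field degrees≥1 : 1 ≤ deg c B x + deg c B y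
open Covered

free? : ∀ c B x y → Dec (Free c B x y)
free? c B x y = map′ free Free.degrees≡0 (deg c B x + deg c B y ≟ 0)

matching-new : ∀ {c B x y} → x ≢ y → Free c B x y → Matching c B → Matching c ((x , y , c) ∷ B)
matching-new {c} {B} {x} {y} x≢y (free f) (matching m) = matching at-most
  where
  at-most : ∀ v → deg c ((x , y , c) ∷ B) v ≤ 1
  at-most v rewrite deg-new c x y B v with x ≟ v | y ≟ v
  ... | yes refl | yes refl = ⊥-elim (x≢y refl)
  ... | yes refl | no y≢v   rewrite hit-refl x | hit-≢ y≢v | m+n≡0⇒m≡0 (deg c B x) f = ≤-refl
  ... | no x≢v   | yes refl rewrite hit-refl y | hit-≢ x≢v | m+n≡0⇒n≡0 (deg c B x) f = ≤-refl
  ... | no x≢v   | no y≢v   rewrite hit-≢ x≢v | hit-≢ y≢v = m v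

matching-other : ∀ {c d B x y} → c ≢ d → Matching c B → Matching c ((x , y , d) ∷ B)
matching-other {B = B} {x} {y} c≢d (matching m) =
  matching λ v → subst (_≤ 1) (sym (deg-other x y B v c≢d)) (m v)

covered-∷ : ∀ {c B x y} e → Covered c B x y → Covered c (e ∷ B) x y
covered-∷ {c} {B} {x} {y} e (covering h) =
  covering (≤-trans h (+-mono-≤ (deg-∷ c e B x) (deg-∷ c e B y)))

covered-sym : ∀ {c B x y} → Covered c B x y → Covered c B y x
covered-sym {c} {B} {x} {y} (covering h) = covering (subst (1 ≤_) (+-comm (deg c B x) (deg c B y)) h)

¬free⇒covered : ∀ {c B x y} → ¬ Free c B x y → Covered c B x y
¬free⇒covered f = covering (n≢0⇒n>0 (f ∘ free))

no-P₃ : ∀ {c B} → Matching c B → ¬ ContainsMono B c (Path 3)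
no-P₃ (matching m) P = let v , h = P₃-degree P in <⇒≱ h (m v)

-- The greedy Painter

record Greedy (B : Board) : Set where
  field
    matchingʳ : Matching red B
    matchingᵇ : Matching blue B
    covered   : ∀ {x y} → HasEdge B green x y → Covered red B x y × Covered blue B x y
open Greedy

greedy-paints : ∀ {B} x y → Greedy B → x ≢ y → ¬ Adjacent B x y → ∃ λ c → Greedy ((x , y , c) ∷ B)
greedy-paints {B} x y G x≢y _ with free? red B x y | free? blue B x y
... | yes f | _ = red , record
  { matchingʳ = matching-new x≢y f (matchingʳ G)
  ; matchingᵇ = matching-other (λ ()) (matchingᵇ G)
  ; covered   = λ h → case hasEdge-∷⁻ h of λ where
      (inj₂ h′) → let p , q = covered G h′ in covered-∷ _ p , covered-∷ _ q
  }
... | no _ | yes f = blue , record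
  { matchingʳ = matching-other (λ ()) (matchingʳ G)
  ; matchingᵇ = matching-new x≢y f (matchingᵇ G)
  ; covered   = λ h → case hasEdge-∷⁻ h of λ where
      (inj₂ h′) → let p , q = covered G h′ in covered-∷ _ p , covered-∷ _ q
  }
... | no f | no f′ = green , record
  { matchingʳ = matching-other (λ ()) (matchingʳ G)
  ; matchingᵇ = matching-other (λ ()) (matchingᵇ G)
  ; covered   = λ h → case hasEdge-∷⁻ h of λ where
      (inj₁ (_ , inj₁ (refl , refl))) → covered-∷ _ (¬free⇒covered f) , covered-∷ _ (¬free⇒covered f′)
      (inj₁ (_ , inj₂ (refl , refl))) →
        covered-∷ _ (covered-sym (¬free⇒covered f)) , covered-∷ _ (covered-sym (¬free⇒covered f′))
      (inj₂ h′) → let p , q = covered G h′ in covered-∷ _ p , covered-∷ _ q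
  }

green-count : ∀ {B ℓ} → GreenCycle B ℓ → ℓ ≤ count green B
green-count {B} {ℓ} C = *-cancelˡ-≤ 2 (begin
  2 * ℓ                                    ≡⟨ cong (2 *_) (sym order≡) ⟩
  2 * length vertices                      ≤⟨ twice vertices degrees ⟩
  sum (map (deg green B) vertices)         ≤⟨ sum-deg green B unique ⟩
  2 * count green B                        ∎)
  where
  open GreenCycle C
  open ≤-Reasoning
  twice : ∀ vs → All (λ v → 2 ≤ deg green B v) vs → 2 * length vs ≤ sum (map (deg green B) vs)
  twice []       []       = z≤n
  twice (v ∷ vs) (p ∷ ps) = ≤-trans (≤-reflexive (*-suc 2 (length vs))) (+-mono-≤ p (twice vs ps))

-- An edge of colour `c` has two ends, each of which lies on at most two edges of the cycle. It thus
-- covers at most four of the ℓ edges.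
cover-count : ∀ {c B ℓ} → (∀ {x y} → HasEdge B green x y → Covered c B x y) → GreenCycle B ℓ → ℓ ≤ 4 * count c B
cover-count {c} {B} {ℓ} cov C = begin
  ℓ                                        ≡⟨ sym (*-identityˡ ℓ) ⟩
  1 * ℓ                                    ≤⟨ cycle-sum (deg c B) 1 (degrees≥1 ∘ cov) C ⟩
  2 * sum (map (deg c B) vertices)         ≤⟨ *-monoʳ-≤ 2 (sum-deg c B unique) ⟩
  2 * (2 * count c B)                      ≡⟨ sym (*-assoc 2 2 (count c B)) ⟩
  4 * count c B                            ∎
  where
  open GreenCycle C
  open ≤-Reasoning

greedy-lasts : ∀ {B k} → Greedy B → Won (Path 3) (Path 3) (Cycle (3 + k)) B →
  ∃ λ p → ∃ λ q → 3 + k ≤ 4 * p × 3 + k ≤ 4 * q × p + q + (3 + k) ≤ length B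
greedy-lasts G (inj₁ P)        = ⊥-elim (no-P₃ (matchingʳ G) P)
greedy-lasts G (inj₂ (inj₁ P)) = ⊥-elim (no-P₃ (matchingᵇ G) P)
greedy-lasts {B} G (inj₂ (inj₂ M)) = count red B , count blue B ,
  cover-count (proj₁ ∘ covered G) C , cover-count (proj₂ ∘ covered G) C ,
  ≤-trans (+-monoʳ-≤ _ (green-count C)) (≤-reflexive (sym (length-count B)))
  where C = greenCycle⁻ M

-- The careful Painter, for lengths divisible by four

load : Board → ℕ → ℕ
load B v = deg red B v + deg blue B v

Unbalanced : Board → Set
Unbalanced B = ∃ λ v → deg red B v ≢ deg blue B v

ends : Board → List ℕ
ends []                = []
ends ((x , y , _) ∷ B) = x ∷ y ∷ ends B

∈-ends : ∀ {B c x y} → HasEdge B c x y → x ∈ ends B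
∈-ends (inj₁ (here refl)) = here refl
∈-ends (inj₂ (here refl)) = there (here refl)
∈-ends (inj₁ (there p))   = there (there (∈-ends (inj₁ p)))
∈-ends (inj₂ (there p))   = there (there (∈-ends (inj₂ p)))

-- A vertex without edges has red and blue degree 0, so a search among the ends of edges decides
-- this.
unbalanced? : ∀ B → Dec (Unbalanced B)
unbalanced? B with any? (λ v → ¬? (deg red B v ≟ deg blue B v)) (ends B)
... | yes a = yes (let v , _ , ne = find a in v , ne)
... | no ¬a = no λ (v , ne) → ¬a (lose (touched v ne) ne)
  where
  touched : ∀ v → deg red B v ≢ deg blue B v → v ∈ ends B
  touched v ne with deg red B v in r | deg blue B v in b
  ... | zero  | zero  = ⊥-elim (ne refl)
  ... | suc _ | _     = ∈-ends (proj₂ (deg⇒edge red B v (subst (1 ≤_) (sym r) (s≤s z≤n))))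
  ... | zero  | suc _ = ∈-ends (proj₂ (deg⇒edge blue B v (subst (1 ≤_) (sym b) (s≤s z≤n))))

-- Holds for an edge that is green only because red or blue would have balanced the board.
record Spared (B : Board) (x y : ℕ) : Set where
  constructor spared
  field
    loadˡ    : 1 ≤ load B x
    loadʳ    : 1 ≤ load B y
    {full}   : ℕ
    full-red  : 1 ≤ deg red B full
    full-blue : 1 ≤ deg blue B full

spared-∷ : ∀ {B x y} e → Spared B x y → Spared (e ∷ B) x y
spared-∷ {B} {x} {y} e (spared p q r s) = spared
  (≤-trans p (+-mono-≤ (deg-∷ red e B x) (deg-∷ blue e B x)))
  (≤-trans q (+-mono-≤ (deg-∷ red e B y) (deg-∷ blue e B y)))
  (≤-trans r (deg-∷ red e B _)) (≤-trans s (deg-∷ blue e B _))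

spared-sym : ∀ {B x y} → Spared B x y → Spared B y x
spared-sym (spared p q r s) = spared q p r s

Green : Board → ℕ → ℕ → Set
Green B x y = (Covered red B x y × Covered blue B x y) ⊎ Spared B x y

green-∷ : ∀ {B x y} e → Green B x y → Green (e ∷ B) x y
green-∷ e (inj₁ (p , q)) = inj₁ (covered-∷ e p , covered-∷ e q)
green-∷ e (inj₂ s)       = inj₂ (spared-∷ e s)

green-sym : ∀ {B x y} → Green B x y → Green B y x
green-sym (inj₁ (p , q)) = inj₁ (covered-sym p , covered-sym q)
green-sym (inj₂ s)       = inj₂ (spared-sym s)

-- By `unbalanced` some vertex has load 1, which rules out the loads 0, 2, 0, 2, ... on the cycle;
-- it can hold only once there is a red or blue edge. That red is preferred to blue shows in
-- `blues`, which helps to rule out load 1 everywhere.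
record Careful (B : Board) : Set where
  field
    loopless   : ∀ {c x y} → HasEdge B c x y → x ≢ y
    matchingʳ  : Matching red B
    matchingᵇ  : Matching blue B
    greens     : ∀ {x y} → HasEdge B green x y → Green B x y
    blues      : ∀ {x y} → HasEdge B blue x y → Covered red B x y
    unbalanced : count red B + count blue B ≡ 0 ⊎ Unbalanced B
open Careful

careful-loopless : ∀ {B x y d} → Careful B → x ≢ y → ∀ {c u v} → HasEdge ((x , y , d) ∷ B) c u v → u ≢ v
careful-loopless G x≢y h with hasEdge-∷⁻ h
... | inj₁ (_ , inj₁ (refl , refl)) = x≢y
... | inj₁ (_ , inj₂ (refl , refl)) = x≢y ∘ sym
... | inj₂ h′ = loopless G h′

-- The colour c would have balanced the board, so x already has a d-neighbour w; this is neither x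
-- nor y, so it already has both colours.
module _ {B : Board} {x y : ℕ} (G : Careful B) (¬adj : ¬ Adjacent B x y) (c d : Colour) (d≢c : d ≢ c)
         (balanced : ∀ v → deg c ((x , y , c) ∷ B) v ≡ deg d ((x , y , c) ∷ B) v) where

  private
    other : ∀ v → deg c ((x , y , c) ∷ B) v ≡ deg d B v
    other v = trans (balanced v) (deg-other x y B v d≢c)

    at-x : 1 ≤ deg d B x
    at-x = subst (1 ≤_) (other x) (deg-edge {(x , y , c) ∷ B} {c} {x} {y} hasEdge-new)

    at-y : 1 ≤ deg d B y
    at-y = subst (1 ≤_) (other y) (deg-edge {(x , y , c) ∷ B} {c} {y} {x} (hasEdge-sym hasEdge-new))

  full-vertex : 1 ≤ deg d B x × 1 ≤ deg d B y × ∃ λ w → 1 ≤ deg c B w × 1 ≤ deg d B w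
  full-vertex with deg⇒edge d B x at-x
  ... | w , h = at-x , at-y , w , subst (1 ≤_) eq at-w , at-w
    where
    at-w : 1 ≤ deg d B w
    at-w = deg-edge (hasEdge-sym h)
    x≢w : x ≢ w
    x≢w = loopless G h
    y≢w : y ≢ w
    y≢w refl = ¬adj (_ , h)
    eq : deg d B w ≡ deg c B w
    eq = trans (sym (other w)) (trans (deg-new c x y B w)
           (cong₂ (λ m n → m + n + deg c B w) (hit-≢ x≢w) (hit-≢ y≢w)))

careful-green : ∀ {B x y} → Careful B → x ≢ y → Green B x y → Careful ((x , y , green) ∷ B)
careful-green G x≢y g = record
  { loopless   = careful-loopless G x≢y
  ; matchingʳ  = matching-other (λ ()) (matchingʳ G)
  ; matchingᵇ  = matching-other (λ ()) (matchingᵇ G)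
  ; greens     = λ h → case hasEdge-∷⁻ h of λ where
      (inj₁ (_ , inj₁ (refl , refl))) → green-∷ _ g
      (inj₁ (_ , inj₂ (refl , refl))) → green-∷ _ (green-sym g)
      (inj₂ h′) → green-∷ _ (greens G h′)
  ; blues      = λ h → case hasEdge-∷⁻ h of λ where
      (inj₂ h′) → covered-∷ _ (blues G h′)
  ; unbalanced = unbalanced G
  }

careful-paints : ∀ {B} x y → Careful B → x ≢ y → ¬ Adjacent B x y → ∃ λ c → Careful ((x , y , c) ∷ B)
careful-paints {B} x y G x≢y ¬adj with free? red B x y | free? blue B x y
... | no f | no f′ = green , careful-green G x≢y (inj₁ (¬free⇒covered f , ¬free⇒covered f′))
... | yes f | _ with unbalanced? ((x , y , red) ∷ B)
...   | yes u = red , record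
  { loopless   = careful-loopless G x≢y
  ; matchingʳ  = matching-new x≢y f (matchingʳ G)
  ; matchingᵇ  = matching-other (λ ()) (matchingᵇ G)
  ; greens     = λ h → case hasEdge-∷⁻ h of λ where
      (inj₂ h′) → green-∷ _ (greens G h′)
  ; blues      = λ h → case hasEdge-∷⁻ h of λ where
      (inj₂ h′) → covered-∷ _ (blues G h′)
  ; unbalanced = inj₂ u
  }
...   | no ¬u =
  let p , q , w , r , b = full-vertex G ¬adj red blue (λ ()) (λ v → decidable-stable (_ ≟ _) (λ ne → ¬u (v , ne)))
  in green , careful-green G x≢y (inj₂ (spared (m≤n⇒m≤o+n _ p) (m≤n⇒m≤o+n _ q) r b))
careful-paints {B} x y G x≢y ¬adj | no f | yes f′ with unbalanced? ((x , y , blue) ∷ B)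
...   | yes u = blue , record
  { loopless   = careful-loopless G x≢y
  ; matchingʳ  = matching-other (λ ()) (matchingʳ G)
  ; matchingᵇ  = matching-new x≢y f′ (matchingᵇ G)
  ; greens     = λ h → case hasEdge-∷⁻ h of λ where
      (inj₂ h′) → green-∷ _ (greens G h′)
  ; blues      = λ h → case hasEdge-∷⁻ h of λ where
      (inj₁ (_ , inj₁ (refl , refl))) → covered-∷ _ (¬free⇒covered f)
      (inj₁ (_ , inj₂ (refl , refl))) → covered-∷ _ (covered-sym (¬free⇒covered f))
      (inj₂ h′) → covered-∷ _ (blues G h′)
  ; unbalanced = inj₂ u
  }
...   | no ¬u =
  let p , q , w , b , r = full-vertex G ¬adj blue red (λ ()) (λ v → decidable-stable (_ ≟ _) (λ ne → ¬u (v , ne ∘ sym)))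
  in green , careful-green G x≢y (inj₂ (spared (m≤n⇒m≤n+o _ p) (m≤n⇒m≤n+o _ q) r b))

module _ {B : Board} (G : Careful B) where

  heavy : ∀ {x y} → HasEdge B green x y → 2 ≤ load B x + load B y
  heavy {x} {y} h with greens G h
  ... | inj₂ (spared p q _ _) = +-mono-≤ p q
  ... | inj₁ (covering p , covering q) =
    ≤-trans (+-mono-≤ p q) (≤-reflexive (interchange (deg red B x) (deg red B y) (deg blue B x) (deg blue B y)))
    where
    interchange : ∀ a b c d → a + b + (c + d) ≡ a + c + (b + d)
    interchange = solve-∀

  sum-load : ∀ {vs} → Unique vs → sum (map (load B) vs) ≤ 2 * (count red B + count blue B)
  sum-load {vs} u = begin
    sum (map (load B) vs)                                    ≡⟨ sum-map-+ (deg red B) (deg blue B) vs ⟩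
    sum (map (deg red B) vs) + sum (map (deg blue B) vs)     ≤⟨ +-mono-≤ (sum-deg red B u) (sum-deg blue B u) ⟩
    2 * count red B + 2 * count blue B                       ≡⟨ sym (*-distribˡ-+ 2 (count red B) (count blue B)) ⟩
    2 * (count red B + count blue B)                         ∎
    where open ≤-Reasoning

  -- A blue edge has a red edge at one of its ends, and this end has load at least 2.
  no-blue : (∀ v → load B v ≤ 1) → ∀ v → deg blue B v ≡ 0
  no-blue light v with deg blue B v in e
  ... | zero  = refl
  ... | suc _ with deg⇒edge blue B v (subst (1 ≤_) (sym e) (s≤s z≤n))
  ... | w , h with m+n≥1⇒ (deg red B v) (degrees≥1 (blues G h))
    where
    m+n≥1⇒ : ∀ m {n} → 1 ≤ m + n → 1 ≤ m ⊎ 1 ≤ n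
    m+n≥1⇒ zero    p = inj₂ p
    m+n≥1⇒ (suc m) p = inj₁ (s≤s z≤n)
  ... | inj₁ p = ⊥-elim (<⇒≱ (+-mono-≤ p (deg-edge h)) (light v))
  ... | inj₂ p = ⊥-elim (<⇒≱ (+-mono-≤ p (deg-edge (hasEdge-sym h))) (light w))

  -- A green edge either meets a blue edge, which `no-blue` forbids, or was spared because of a
  -- vertex with both colours, which has load at least 2.
  overloaded : ∀ {x y} → HasEdge B green x y → ¬ (∀ v → load B v ≤ 1)
  overloaded h light with greens G h
  ... | inj₂ (spared _ _ r b) = <⇒≱ (+-mono-≤ r b) (light _)
  ... | inj₁ (_ , covering q) =
    <⇒≱ q (≤-reflexive (cong₂ _+_ (no-blue light _) (no-blue light _)))

  module _ {ℓ : ℕ} (C : GreenCycle B ℓ) where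
    open GreenCycle C

    cycle-load : ℓ ≤ 2 * (count red B + count blue B)
    cycle-load = ≤-trans (*-cancelˡ-≤ 2 (cycle-sum (load B) 2 heavy C)) (sum-load unique)

    -- Equality makes neighbouring loads on the cycle add up to exactly 2 and leaves no load outside
    -- the cycle. A vertex with different red and blue degrees has load 1, so it lies on the cycle
    -- and spreads load 1 along it in both directions. Then no vertex has load 2, against
    -- `overloaded`.
    not-tight : 0 < ℓ → 2 * (count red B + count blue B) ≢ ℓ
    not-tight 0<ℓ tight = overloaded closing light
      where
      steady : Steady (load B) 2 heavy path
      steady = cycle-steady (load B) 2 heavy C (*-monoʳ-≤ 2 (≤-trans (sum-load unique) (≤-reflexive tight)))
      outside : ∀ v → v ∉ vertices → load B v ≡ 0
      outside v v∉ = n≤0⇒n≡0 (+-cancelʳ-≤ (sum (map (load B) vertices)) _ _ (begin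
        load B v + sum (map (load B) vertices)    ≤⟨ sum-load (All.¬Any⇒All¬ vertices v∉ ∷ unique) ⟩
        2 * (count red B + count blue B)          ≡⟨ tight ⟩
        ℓ                                         ≤⟨ *-cancelˡ-≤ 2 (cycle-sum (load B) 2 heavy C) ⟩
        sum (map (load B) vertices)               ∎))
        where open ≤-Reasoning
      odd : ∃ λ v → load B v ≡ 1
      odd with unbalanced G
      ... | inj₁ z = ⊥-elim (<⇒≱ 0<ℓ (≤-reflexive (trans (sym tight) (cong (2 *_) z))))
      ... | inj₂ (v , ne) = v , one (deg red B v) (deg blue B v) (degree≤1 (matchingʳ G) v) (degree≤1 (matchingᵇ G) v) ne
        where
        one : ∀ a b → a ≤ 1 → b ≤ 1 → a ≢ b → a + b ≡ 1
        one zero zero _ _ ne = ⊥-elim (ne refl)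
        one zero (suc zero) _ _ _ = refl
        one (suc zero) zero _ _ _ = refl
        one (suc zero) (suc zero) _ _ ne = ⊥-elim (ne refl)
        one (suc (suc _)) _ (s≤s ()) _ _
        one _ (suc (suc _)) _ (s≤s ()) _
      inside : proj₁ odd ∈ vertices
      inside with proj₁ odd ∈? vertices
      ... | yes m = m
      ... | no ∉  = case trans (sym (proj₂ odd)) (outside _ ∉) of λ ()
      ones : All (λ v → load B v ≡ 1) vertices
      ones = steady-forward {B} {load B} {heavy} path steady
        (steady-backward {B} {load B} {heavy} path steady inside (proj₂ odd))
      light : ∀ v → load B v ≤ 1
      light v with v ∈? vertices
      ... | yes m = ≤-reflexive (All.lookup ones m)
      ... | no ∉  = subst (_≤ 1) (sym (outside v ∉)) z≤n

careful-lasts : ∀ {B} k → Careful B → Won (Path 3) (Path 3) (Cycle (4 * suc k)) B →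
                suc (6 * suc k) ≤ length B
careful-lasts k G (inj₁ P)        = ⊥-elim (no-P₃ (matchingʳ G) P)
careful-lasts k G (inj₂ (inj₁ P)) = ⊥-elim (no-P₃ (matchingᵇ G) P)
careful-lasts {B} k G (inj₂ (inj₂ M)) = begin
  suc (6 * suc k)                               ≡⟨ eq (suc k) ⟩
  suc (2 * suc k) + 4 * suc k                   ≤⟨ +-mono-≤ enough (green-count C) ⟩
  count red B + count blue B + count green B    ≡⟨ sym (length-count B) ⟩
  length B                                      ∎
  where
  open ≤-Reasoning
  eq : ∀ k → suc (6 * k) ≡ suc (2 * k) + 4 * k
  eq = solve-∀
  four : ∀ k → 4 * suc k ≡ 3 + (1 + 4 * k)
  four = solve-∀
  double : ∀ k → 4 * k ≡ 2 * (2 * k)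
  double = solve-∀
  C : GreenCycle B (4 * suc k)
  C = subst (GreenCycle B) (sym (four k))
        (greenCycle⁻ (subst (λ n → ContainsMono B green (Cycle n)) (four k) M))
  enough : 2 * suc k < count red B + count blue B
  enough = ≤∧≢⇒< (*-cancelˡ-≤ 2 (≤-trans (≤-reflexive (sym (double (suc k)))) (cycle-load G C)))
             λ e → not-tight G C (s≤s z≤n) (trans (cong (2 *_) (sym e)) (sym (double (suc k))))

greedy-bound : ∀ N k → (∀ p q → 3 + k ≤ 4 * p → 3 + k ≤ 4 * q → N ≤ p + q + (3 + k)) →
               ∀ m → WinIn (Path 3) (Path 3) (Cycle (3 + k)) m [] → N ≤ m
greedy-bound N k h m w = subst (N ≤_) (+-identityʳ m) (survives Greedy N
  (λ G won → let p , q , hp , hq , l = greedy-lasts G won in ≤-trans (h p q hp hq) l)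
  greedy-paints m start w)
  where
  start : Greedy []
  start = record
    { matchingʳ = matching λ _ → z≤n
    ; matchingᵇ = matching λ _ → z≤n
    ; covered   = λ { (inj₁ ()) ; (inj₂ ()) }
    }

careful-bound : ∀ k m → WinIn (Path 3) (Path 3) (Cycle (4 * suc k)) m [] → suc (6 * suc k) ≤ m
careful-bound k m w = subst (suc (6 * suc k) ≤_) (+-identityʳ m)
  (survives Careful _ (careful-lasts k) careful-paints m start w)
  where
  start : Careful []
  start = record
    { loopless   = λ { (inj₁ ()) ; (inj₂ ()) }
    ; matchingʳ  = matching λ _ → z≤n
    ; matchingᵇ  = matching λ _ → z≤n
    ; greens     = λ { (inj₁ ()) ; (inj₂ ()) }
    ; blues      = λ { (inj₁ ()) ; (inj₂ ()) }
    ; unbalanced = inj₁ refl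
    }

-- The online Ramsey number

quarter : ∀ s t p → 1 ≤ s → s + 4 * t ≤ 4 * p → suc t ≤ p
quarter s t p 1≤s h = *-cancelˡ-< 4 t p (≤-trans (+-monoˡ-≤ (4 * t) 1≤s) h)

-- For ℓ = s + 4 t with s ≥ 1, rounding ℓ/4 up gives at least t + 1 red and t + 1 blue edges besides
-- the ℓ green ones.
quarters : ∀ s t p q → 1 ≤ s → s + 4 * t ≤ 4 * p → s + 4 * t ≤ 4 * q →
           (2 + s) + 6 * t ≤ p + q + (s + 4 * t)
quarters s t p q 1≤s hp hq = ≤-trans (≤-reflexive (eq s t))
  (+-monoˡ-≤ (s + 4 * t) (+-mono-≤ (quarter s t p 1≤s hp) (quarter s t q 1≤s hq)))
  where
  eq : ∀ s t → (2 + s) + 6 * t ≡ suc t + suc t + (s + 4 * t)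
  eq = solve-∀

ramsey-tight : ∀ j → IsOnlineRamseyNumber (Path 3) (Path 3) (Cycle (15 + 4 * j)) (23 + 6 * j)
ramsey-tight j = builder-wins-tight j , greedy-bound (23 + 6 * j) (12 + 4 * j) λ p q hp hq →
  ≤-trans (≤-reflexive (eq₁ j)) (≤-trans (quarters 3 (3 + j) p q (s≤s z≤n)
    (≤-trans (≤-reflexive (eq₂ j)) hp) (≤-trans (≤-reflexive (eq₂ j)) hq))
    (≤-reflexive (cong (p + q +_) (eq₂ j))))
  where
  eq₁ : ∀ j → 23 + 6 * j ≡ 5 + 6 * (3 + j)
  eq₁ = solve-∀
  eq₂ : ∀ j → 3 + 4 * (3 + j) ≡ 15 + 4 * j
  eq₂ = solve-∀

-- The opening is charged four rounds for two edges of the cycle, so that 3 r₀ ≤ 2 b₀ is left for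
-- the rest. For ℓ ≡ 3 (mod 4) the value (3ℓ + 1)/2 misses this hypothesis by one and is treated
-- apart.
upper-loose : ∀ ℓ N → 16 ≤ ℓ → 2 + 3 * ℓ ≤ 2 * N → WinIn (Path 3) (Path 3) (Cycle ℓ) N []
upper-loose (suc (suc r₀)) N (s≤s (s≤s 14≤r₀)) h =
  subst (λ n → WinIn (Path 3) (Path 3) (Cycle (2 + r₀)) n []) eN (builder-wins-loose r₀ b₀ 14≤r₀ 3r₀≤2b₀)
  where
  eq : ∀ r → 8 + 3 * r ≡ 2 + 3 * (2 + r)
  eq = solve-∀
  h′ : 8 + 3 * r₀ ≤ 2 * N
  h′ = ≤-trans (≤-reflexive (eq r₀)) h
  b₀ = N ∸ 4
  eN : 4 + b₀ ≡ N
  eN = m+[n∸m]≡n {4} {N} (*-cancelˡ-≤ 2 (≤-trans (m≤m+n 8 _) h′))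
  3r₀≤2b₀ : 3 * r₀ ≤ 2 * b₀
  3r₀≤2b₀ = +-cancelˡ-≤ 8 _ _ (≤-trans h′ (≤-reflexive (trans (cong (2 *_) (sym eN)) (*-distribˡ-+ 2 4 b₀))))

half-lower : ∀ x → x ≤ 1 + 2 * (x / 2)
half-lower x = ≤-trans (≤-reflexive (m≡m%n+[m/n]*n x 2))
  (+-mono-≤ (≤-pred (m%n<n x 2)) (≤-reflexive (*-comm (x / 2) 2)))

half-upper : ∀ x n → x < 2 * suc n → x / 2 ≤ n
half-upper x n h = ≤-pred (m<n*o⇒m/o<n (subst (x <_) (*-comm 2 (suc n)) h))

-- The values are 6 t + 1, 6 t + 3 and 6 t + 4 for s = 0, 1, 2. The last two are what the greedy
-- count gives; for s = 0 that count gives only 6 t, and the careful Painter gains the missing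
-- round.
lower-loose : ∀ s t → s < 3 → 4 ≤ t → ∀ m →
  WinIn (Path 3) (Path 3) (Cycle (s + t * 4)) m [] → (3 * ((s + t * 4) + 1)) / 2 ≤ m
lower-loose 0 (suc k) _ _ m w = ≤-trans (half-upper _ (suc (6 * suc k)) (≤-reflexive (eq k)))
  (careful-bound k m (subst (λ n → WinIn (Path 3) (Path 3) (Cycle n) m []) (*-comm (suc k) 4) w))
  where
  eq : ∀ k → suc (3 * ((suc k * 4) + 1)) ≡ 2 * suc (suc (6 * suc k))
  eq = solve-∀
lower-loose 1 (suc k) _ _ m w = ≤-trans (half-upper _ (3 + 6 * suc k) (≤-trans (n≤1+n _) (≤-reflexive (eq k))))
  (greedy-bound _ (2 + 4 * k) (λ p q hp hq →
    ≤-trans (quarters 1 (suc k) p q ≤-refl (≤-trans (≤-reflexive (eq′ k)) hp) (≤-trans (≤-reflexive (eq′ k)) hq))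
      (≤-reflexive (cong (p + q +_) (eq′ k)))) m
    (subst (λ n → WinIn (Path 3) (Path 3) (Cycle n) m []) (eq″ k) w))
  where
  eq : ∀ k → suc (suc (3 * ((1 + suc k * 4) + 1))) ≡ 2 * suc (3 + 6 * suc k)
  eq = solve-∀
  eq′ : ∀ k → 1 + 4 * suc k ≡ 3 + (2 + 4 * k)
  eq′ = solve-∀
  eq″ : ∀ k → 1 + suc k * 4 ≡ 3 + (2 + 4 * k)
  eq″ = solve-∀
lower-loose 2 (suc k) _ _ m w = ≤-trans (half-upper _ (4 + 6 * suc k) (≤-reflexive (eq k)))
  (greedy-bound _ (3 + 4 * k) (λ p q hp hq →
    ≤-trans (quarters 2 (suc k) p q (s≤s z≤n) (≤-trans (≤-reflexive (eq′ k)) hp) (≤-trans (≤-reflexive (eq′ k)) hq))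
      (≤-reflexive (cong (p + q +_) (eq′ k)))) m
    (subst (λ n → WinIn (Path 3) (Path 3) (Cycle n) m []) (eq″ k) w))
  where
  eq : ∀ k → suc (3 * ((2 + suc k * 4) + 1)) ≡ 2 * suc (4 + 6 * suc k)
  eq = solve-∀
  eq′ : ∀ k → 2 + 4 * suc k ≡ 3 + (3 + 4 * k)
  eq′ = solve-∀
  eq″ : ∀ k → 2 + suc k * 4 ≡ 3 + (3 + 4 * k)
  eq″ = solve-∀
lower-loose (suc (suc (suc _))) _ (s≤s (s≤s (s≤s ()))) _ _ _

theorem1p2 : ∀ (ℓ : ℕ) → 16 ≤ ℓ →
    ((ℓ % 4 ≡ 3) → IsOnlineRamseyNumber (Path 3) (Path 3) (Cycle ℓ) ((3 * ℓ + 1) / 2)) ×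
    (¬ (ℓ % 4 ≡ 3) → IsOnlineRamseyNumber (Path 3) (Path 3) (Cycle ℓ) ((3 * (ℓ + 1)) / 2))
theorem1p2 ℓ 16≤ℓ = tight , loose
  where
  t = ℓ / 4
  split : ℓ ≡ ℓ % 4 + t * 4
  split = m≡m%n+[m/n]*n ℓ 4
  4≤t : 4 ≤ t
  4≤t = *-cancelʳ-< 4 3 t (+-cancelˡ-< 3 (3 * 4) (t * 4)
    (≤-trans 16≤ℓ (≤-trans (≤-reflexive split) (+-monoˡ-≤ (t * 4) (≤-pred (m%n<n ℓ 4))))))

  tight : ℓ % 4 ≡ 3 → IsOnlineRamseyNumber (Path 3) (Path 3) (Cycle ℓ) ((3 * ℓ + 1) / 2)
  tight s = subst (λ n → IsOnlineRamseyNumber (Path 3) (Path 3) (Cycle n) ((3 * n + 1) / 2)) (sym eℓ)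
    (subst (IsOnlineRamseyNumber (Path 3) (Path 3) (Cycle (15 + 4 * j)))
      (sym (trans (cong (_/ 2) (eN j)) (m*n/n≡m (23 + 6 * j) 2))) (ramsey-tight j))
    where
    j = t ∸ 3
    eq : ∀ j → 3 + (3 + j) * 4 ≡ 15 + 4 * j
    eq = solve-∀
    eN : ∀ j → 3 * (15 + 4 * j) + 1 ≡ (23 + 6 * j) * 2
    eN = solve-∀
    eℓ : ℓ ≡ 15 + 4 * j
    eℓ = trans split (trans (cong (_+ t * 4) s)
      (trans (cong (λ n → 3 + n * 4) (sym (m+[n∸m]≡n {3} {t} (<⇒≤ 4≤t)))) (eq j)))

  loose : ¬ (ℓ % 4 ≡ 3) → IsOnlineRamseyNumber (Path 3) (Path 3) (Cycle ℓ) ((3 * (ℓ + 1)) / 2)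
  loose s = upper-loose ℓ _ 16≤ℓ (≤-pred (≤-trans (≤-reflexive (eq ℓ)) (half-lower (3 * (ℓ + 1))))) ,
    λ m w → subst (λ n → (3 * (n + 1)) / 2 ≤ m) (sym split)
      (lower-loose (ℓ % 4) t (≤∧≢⇒< (≤-pred (m%n<n ℓ 4)) s) 4≤t m
        (subst (λ n → WinIn (Path 3) (Path 3) (Cycle n) m []) split w))
    where
    eq : ∀ ℓ → suc (2 + 3 * ℓ) ≡ 3 * (ℓ + 1)
    eq = solve-∀
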